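{- Let $\mathcal{D}$ be a p-admissible concrete domain and let $\mathcal{O}$ be an $\mathcal{EL}_\bot[\mathcal{D}]$ ontology. Algorithm 1 (given in the context), run on $\mathcal{O}$, terminates in time polynomial in the size of $\mathcal{O}$ and computes the classification $$\mathsf{CL}(\mathcal{O})=\{\langle C,D\rangle \mid C,D\in\mathsf{sub}(\mathcal{O}),\ \mathcal{O}\models C\sqsubseteq D\},$$ that is, for all $C,D\in\mathsf{sub}(\mathcal{O})$, the pair $\langle C,D\rangle$ belongs to the output of Algorithm 1 if and only if $\mathcal{O}\models C\sqsubseteq D$.
   Context: **Concrete domains.** Given a set of predicates $\mathsf{N_P}$ with arities, a concrete domain (CD) $\mathcal{D}=(\Delta^{\mathcal{D}},\cdot^{\mathcal{D}})$ consists of a set $\Delta^{\mathcal{D}}$ and relations $P^{\mathcal{D}}\subseteq(\Delta^{\mathcal{D}})^{k}$ for each $P\in\mathsf{N_P}$ of arity $k$. $\mathsf{N_P}$ always contains a nullary predicate $\bot$ with $\bot^{\mathcal{D}}=\emptyset$ and a unary predicate $\top$ with $\top^{\mathcal{D}}=\Delta^{\mathcal{D}}$. Given a set $\mathsf{N_V}$ of variables, a constraint is $\alpha=P(x_1,\dots,x_k)$ with $x_i\in\mathsf{N_V}$. An assignment $v:\mathsf{N_V}\to\Delta^{\mathcal{D}}$ satisfies $\alpha$ if $(v(x_1),\dots,v(x_k))\in P^{\mathcal{D}}$. An implication $\gamma\to\delta$ ($\gamma$ a conjunction, $\delta$ a disjunction of constraints) is valid, written $\mathcal{D}\models\gamma\to\delta$,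 if every assignment satisfying all constraints in $\gamma$ satisfies some constraint in $\delta$. $\mathcal{D}$ is convex if for every valid implication $\gamma\to\delta$ there is a disjunct $\alpha$ of $\delta$ such that $\gamma\to\alpha$ is valid; $\mathcal{D}$ is p-admissible if it is convex and validity of implications is decidable in polynomial time. **The logics.** Let $\mathsf{N_C},\mathsf{N_R}$ be disjoint countably infinite sets of concept and role names. $\mathcal{EL}_\bot$ concepts are given by $C,D::=\top\mid\bot\mid A\mid C\sqcap D\mid\exists r.C$ ($A\in\mathsf{N_C}$, $r\in\mathsf{N_R}$); $\mathcal{EL}_\bot[\mathcal{D}]$ concepts additionally allow $[\alpha]$ for constraints $\alpha$ of $\mathcal{D}$. An ontology is a finite set of axioms (GCIs) $C\sqsubseteq D$. An interpretation $\mathcal{I}$ has a non-empty domain $\Delta^{\mathcal{I}}$, interprets $A$ as a subset $A^{\mathcal{I}}$ of $\Delta^{\mathcal{I}}$, $r$ as a binary relation $r^{\mathcal{I}}$ on $\Delta^{\mathcal{I}}$, and each variable $x\in\mathsf{N_V}$ as a partial function $x^{\mathcal{I}}:\Delta^{\mathcal{I}}\to\Delta^{\mathcal{D}}$. The concepts $\top,\bot,\sqcap,\exists r.C$ are interpreted as usual; $[\alpha]^{\mathcal{I}}$ is the set of all $d\in\Delta^{\mathcal{I}}$ such that $x^{\mathcal{I}}(d)$ is defined for all variables $x$ in $\alpha$ and the assignment $x\mapsto x^{\mathcal{I}}(d)$ satisfies $\alpha$. $\mathcal{I}$ is a model of $C\sqsubseteq D$ if $C^{\mathcal{I}}\subseteq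 D^{\mathcal{I}}$, and of $\mathcal{O}$ if it is a model of all its axioms; $\mathcal{O}\models C\sqsubseteq D$ means every model of $\mathcal{O}$ is a model of $C\sqsubseteq D$. $\mathsf{sub}(\mathcal{O})$ is the set of subconcepts of all concepts appearing in $\mathcal{O}$, and $\mathsf{CL}(\mathcal{O})$ is defined as in the claim, for both $\mathcal{EL}_\bot$ and $\mathcal{EL}_\bot[\mathcal{D}]$ ontologies. **Abstraction.** $\mathcal{C}(\mathcal{O})$ is the finite set of constraints occurring in $\mathcal{O}$. $\mathcal{O}^{ -\mathcal{D}}$ is the $\mathcal{EL}_\bot$ ontology obtained from $\mathcal{O}$ by replacing each $\alpha\in\mathcal{C}(\mathcal{O})$ by a fresh concept name $A_\alpha$. **Algorithm 1.** Classifications $\mathsf{CL}(\mathcal{O}')$ of $\mathcal{EL}_\bot$ ontologies are computed by a polynomial-time $\mathcal{EL}_\bot$ classifier, and validity of implications in $\mathcal{D}$ is tested by a polynomial-time procedure. 1. Set $\mathcal{O}':=\mathcal{O}^{ -\mathcal{D}}$ and $\mathcal{N}:=\emptyset$. 2. While $\mathcal{N}\neq\mathsf{CL}(\mathcal{O}')$: set $\mathcal{N}:=\mathsf{CL}(\mathcal{O}')$; then for each $C\in\mathsf{sub}(\mathcal{O}^{ -\mathcal{D}})$: - let $\mathbf{D}_C:=\{\alpha\in\mathcal{C}(\mathcal{O})\mid\langle C,A_\alpha\rangle\in\mathsf{CL}(\mathcal{O}')\}$, and write $\mathbf{D}_C=\{\alpha_1,\dots,\alpha_k\}$ (if $k=0$,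 the conjunction $A_{\alpha_1}\sqcap\dots\sqcap A_{\alpha_k}$ is $\top$); - if $\mathcal{D}\models\bigwedge\mathbf{D}_C\to\bot$, add the axiom $A_{\alpha_1}\sqcap\dots\sqcap A_{\alpha_k}\sqsubseteq\bot$ to $\mathcal{O}'$; - otherwise, add to $\mathcal{O}'$ all axioms $A_{\alpha_1}\sqcap\dots\sqcap A_{\alpha_k}\sqsubseteq A_\beta$ with $\beta\in\mathcal{C}(\mathcal{O})$ and $\mathcal{D}\models\bigwedge\mathbf{D}_C\to\beta$. 3. Return $\mathcal{N}$ with every $A_\alpha$ ($\alpha\in\mathcal{C}(\mathcal{O})$) replaced by $[\alpha]$.
   Formalization: Assignments are partial (a constraint holds only if its variables are defined), in validity, convexity and Algorithm 1's tests; with total assignments the claim fails, e.g. for O = {A ⊑ A, [⊤(x)] ⊑ B}, where Algorithm 1 outputs ⟨A,[⊤(x)]⟩ though x may be undefined. -}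

module Defs where

open import Level using (Level; 0ℓ)
open import Data.Bool.Base using (Bool; true; false)
open import Data.Empty using (⊥)
open import Data.Fin.Base using (Fin; zero; suc)
open import Data.List.Base using (List; []; _∷_; _++_; concatMap)
open import Data.List.Membership.Propositional using (_∈_)
open import Data.List.NonEmpty.Base using (List⁺; _∷_; toList)
import Data.List.NonEmpty.Base as List⁺
open import Data.List.Relation.Unary.All using (All)
open import Data.List.Relation.Unary.Any using (Any)
open import Data.Maybe.Base using (Maybe; just)
open import Data.Nat.Base using (ℕ; zero; suc; _+_; _*_; _^_; _≤_)
open import Data.Nat.Binary.Base using (ℕᵇ; zero; 2[1+_]; 1+[2_])
open import Data.Product.Base using (∃; ∃₂; ∃-syntax; _×_; _,_)
open import Data.Sum.Base using (_⊎_; inj₁; inj₂)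
open import Data.Unit.Base using (⊤)
open import Data.Vec.Base using (Vec; []; _∷_)
import Data.Vec.Base as Vec
import Data.Vec.Properties as Vec
open import Function.Bundles using (_⇔_)
open import Relation.Binary.PropositionalEquality
  using (_≡_; refl; sym; trans; cong; cong₂)
open import Relation.Nullary.Negation using (¬_)

------------------------------------------------------------------------
-- Machine model: a first-order functional language on binary trees, with
-- a cost semantics.  With nil, cons, case distinction and recursion as
-- unit-cost steps (and sharing of subtrees), polynomial time in this
-- language is polynomial time on Turing machines; see Jones,
-- "Computability and Complexity from a Programming Perspective".

infixr 5 _∙_

data Tree : Set where
  nil : Tree
  _∙_ : Tree → Tree → Tree

size : Tree → ℕ
size nil     = 1
size (x ∙ y) = 1 + size x + size y

-- `Term k n` is an expression with n variables in scope (de Bruijn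
-- indices) in the body of a function with k arguments.  `case` binds the
-- left subtree as variable 0 and the right subtree as variable 1;
-- `self` is a recursive call of the enclosing function; in `if`, nil is
-- false and every other tree is true.

infix 2 if_then_else_

data Term (k : ℕ) : ℕ → Set

Fun : ℕ → Set
Fun k = Term k k

data Term k where
  var           : ∀ {n} → Fin n → Term k n
  nil           : ∀ {n} → Term k n
  _∙_           : ∀ {n} → Term k n → Term k n → Term k n
  if_then_else_ : ∀ {n} → Term k n → Term k n → Term k n → Term k n
  case          : ∀ {n} → Term k n → Term k n → Term k (2 + n) → Term k n
  self          : ∀ {n} → Vec (Term k n) k → Term k n
  call          : ∀ {m n} → Fun m → Vec (Term k n) m → Term k n

-- `f , ρ ⊢ e ⇓ v ⟨ t ⟩`: inside the function f, under the environment ρ,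
-- the expression e evaluates to v in t steps.

infix 4 _,_⊢_⇓_⟨_⟩ _,_⊢_⇓*_⟨_⟩ _·_⇓_⟨_⟩

data _,_⊢_⇓_⟨_⟩ : ∀ {k n} → Fun k → Vec Tree n → Term k n → Tree → ℕ → Set
data _,_⊢_⇓*_⟨_⟩ : ∀ {k n m} → Fun k → Vec Tree n → Vec (Term k n) m → Vec Tree m → ℕ → Set

data _,_⊢_⇓_⟨_⟩ where
  ⇓var  : ∀ {k n} {f : Fun k} {ρ : Vec Tree n} {i} →
          f , ρ ⊢ var i ⇓ Vec.lookup ρ i ⟨ 1 ⟩
  ⇓nil  : ∀ {k n} {f : Fun k} {ρ : Vec Tree n} →
          f , ρ ⊢ nil ⇓ nil ⟨ 1 ⟩
  ⇓cons : ∀ {k n} {f : Fun k} {ρ : Vec Tree n} {d e x y s t} →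
          f , ρ ⊢ d ⇓ x ⟨ s ⟩ → f , ρ ⊢ e ⇓ y ⟨ t ⟩ →
          f , ρ ⊢ d ∙ e ⇓ x ∙ y ⟨ 1 + s + t ⟩
  ⇓then : ∀ {k n} {f : Fun k} {ρ : Vec Tree n} {c d e x y v s t} →
          f , ρ ⊢ c ⇓ x ∙ y ⟨ s ⟩ → f , ρ ⊢ d ⇓ v ⟨ t ⟩ →
          f , ρ ⊢ if c then d else e ⇓ v ⟨ 1 + s + t ⟩
  ⇓else : ∀ {k n} {f : Fun k} {ρ : Vec Tree n} {c d e v s t} →
          f , ρ ⊢ c ⇓ nil ⟨ s ⟩ → f , ρ ⊢ e ⇓ v ⟨ t ⟩ →
          f , ρ ⊢ if c then d else e ⇓ v ⟨ 1 + s + t ⟩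
  ⇓case-nil  : ∀ {k n} {f : Fun k} {ρ : Vec Tree n} {c d e v s t} →
               f , ρ ⊢ c ⇓ nil ⟨ s ⟩ → f , ρ ⊢ d ⇓ v ⟨ t ⟩ →
               f , ρ ⊢ case c d e ⇓ v ⟨ 1 + s + t ⟩
  ⇓case-cons : ∀ {k n} {f : Fun k} {ρ : Vec Tree n} {c d e x y v s t} →
               f , ρ ⊢ c ⇓ x ∙ y ⟨ s ⟩ → f , x ∷ y ∷ ρ ⊢ e ⇓ v ⟨ t ⟩ →
               f , ρ ⊢ case c d e ⇓ v ⟨ 1 + s + t ⟩
  ⇓self : ∀ {k n} {f : Fun k} {ρ : Vec Tree n} {es vs v s t} →
          f , ρ ⊢ es ⇓* vs ⟨ s ⟩ → f , vs ⊢ f ⇓ v ⟨ t ⟩ →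
          f , ρ ⊢ self es ⇓ v ⟨ 1 + s + t ⟩
  ⇓call : ∀ {k n m} {f : Fun k} {ρ : Vec Tree n} {g : Fun m} {es vs v s t} →
          f , ρ ⊢ es ⇓* vs ⟨ s ⟩ → g , vs ⊢ g ⇓ v ⟨ t ⟩ →
          f , ρ ⊢ call g es ⇓ v ⟨ 1 + s + t ⟩

data _,_⊢_⇓*_⟨_⟩ where
  []  : ∀ {k n} {f : Fun k} {ρ : Vec Tree n} →
        f , ρ ⊢ [] ⇓* [] ⟨ 0 ⟩
  _∷_ : ∀ {k n m} {f : Fun k} {ρ : Vec Tree n} {e v s t}
          {es : Vec (Term k n) m} {vs : Vec Tree m} →
        f , ρ ⊢ e ⇓ v ⟨ s ⟩ → f , ρ ⊢ es ⇓* vs ⟨ t ⟩ →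
        f , ρ ⊢ e ∷ es ⇓* v ∷ vs ⟨ s + t ⟩

_·_⇓_⟨_⟩ : ∀ {k} → Fun k → Vec Tree k → Tree → ℕ → Set
f · xs ⇓ v ⟨ t ⟩ = f , xs ⊢ f ⇓ v ⟨ t ⟩

------------------------------------------------------------------------
-- Representing data as trees

record Code (A : Set) : Set where
  field
    encode    : A → Tree
    injective : ∀ {x y} → encode x ≡ encode y → x ≡ y

open Code {{...}} public using (encode)

∙-injˡ : ∀ {a b c d : Tree} → a ∙ b ≡ c ∙ d → a ≡ c
∙-injˡ refl = refl

∙-injʳ : ∀ {a b c d : Tree} → a ∙ b ≡ c ∙ d → b ≡ d
∙-injʳ refl = refl

instance
  code-⊥ : Code ⊥
  code-⊥ = record { encode = λ () ; injective = λ {} }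

  code-Bool : Code Bool
  code-Bool = record { encode = enc ; injective = λ {x} {y} → inj x y }
    where
    enc : Bool → Tree
    enc false = nil
    enc true  = nil ∙ nil
    inj : ∀ x y → enc x ≡ enc y → x ≡ y
    inj false false _ = refl
    inj true  true  _ = refl

  code-ℕᵇ : Code ℕᵇ
  code-ℕᵇ = record { encode = enc ; injective = λ {x} {y} → inj x y }
    where
    enc : ℕᵇ → Tree
    enc zero     = nil
    enc 2[1+ n ] = nil ∙ enc n
    enc 1+[2 n ] = (nil ∙ nil) ∙ enc n
    inj : ∀ x y → enc x ≡ enc y → x ≡ y
    inj zero     zero     _ = refl
    inj 2[1+ x ] 2[1+ y ] p = cong 2[1+_] (inj x y (∙-injʳ p))
    inj 1+[2 x ] 1+[2 y ] p = cong 1+[2_] (inj x y (∙-injʳ p))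

  code-× : ∀ {A B} → {{Code A}} → {{Code B}} → Code (A × B)
  code-× {{a}} {{b}} = record
    { encode    = λ (x , y) → Code.encode a x ∙ Code.encode b y
    ; injective = λ p → cong₂ _,_ (Code.injective a (∙-injˡ p)) (Code.injective b (∙-injʳ p))
    }

  code-⊎ : ∀ {A B} → {{Code A}} → {{Code B}} → Code (A ⊎ B)
  code-⊎ {A} {B} {{a}} {{b}} = record { encode = enc ; injective = λ {x} {y} → inj x y }
    where
    enc : A ⊎ B → Tree
    enc (inj₁ x) = nil ∙ Code.encode a x
    enc (inj₂ y) = (nil ∙ nil) ∙ Code.encode b y
    inj : ∀ x y → enc x ≡ enc y → x ≡ y
    inj (inj₁ x) (inj₁ y) p = cong inj₁ (Code.injective a (∙-injʳ p))
    inj (inj₂ x) (inj₂ y) p = cong inj₂ (Code.injective b (∙-injʳ p))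

  code-List : ∀ {A} → {{Code A}} → Code (List A)
  code-List {A} {{a}} = record { encode = enc ; injective = λ {x} {y} → inj x y }
    where
    enc : List A → Tree
    enc []       = nil
    enc (x ∷ xs) = Code.encode a x ∙ enc xs
    inj : ∀ xs ys → enc xs ≡ enc ys → xs ≡ ys
    inj []       []       _ = refl
    inj (x ∷ xs) (y ∷ ys) p = cong₂ _∷_ (Code.injective a (∙-injˡ p)) (inj xs ys (∙-injʳ p))

  code-List⁺ : ∀ {A} → {{Code A}} → Code (List⁺ A)
  code-List⁺ {A} {{a}} = record { encode = λ xs → encode (toList xs) ; injective = inj }
    where
    inj : ∀ {xs ys : List⁺ A} → encode (toList xs) ≡ encode (toList ys) → xs ≡ ys
    inj {x ∷ xs} {y ∷ ys} p with Code.injective (code-List {{a}}) {x ∷ xs} {y ∷ ys} p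
    ... | refl = refl

-- The program f meets the input-output specification R, in time polynomial
-- in the size of the (encoded) input; in particular it halts on every input.

_SolvesInPolyTime_ : ∀ {A B : Set} {ℓ : Level} → {{Code A}} → {{Code B}} →
                     Fun 1 → (A → B → Set ℓ) → Set ℓ
_SolvesInPolyTime_ {A} {B} f R =
  ∃₂ λ (c d : ℕ) → ∀ (a : A) → ∃₂ λ (b : B) (t : ℕ) →
    f · encode a ∷ [] ⇓ encode b ⟨ t ⟩ ×
    t ≤ c * size (encode a) ^ d + c ×
    R a b

------------------------------------------------------------------------
-- Concrete domains

-- Complexity statements presuppose that predicates and variables are
-- finitely represented, hence the two codes.

record ConcreteDomain : Set₁ where
  field
    NP      : ℕ → Set
    NV      : Set
    Δ       : Set
    ⟦_⟧ᴾ    : ∀ {k} → NP k → Vec Δ k → Set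
    ⊥ᴾ      : NP 0
    ⊤ᴾ      : NP 1
    ⊥ᴾ-empty : ¬ ⟦ ⊥ᴾ ⟧ᴾ []
    ⊤ᴾ-full  : ∀ a → ⟦ ⊤ᴾ ⟧ᴾ (a ∷ [])
    code-NP : Code (∃ NP)
    code-NV : Code NV

record Constraint (𝒟 : ConcreteDomain) : Set where
  constructor constraint
  open ConcreteDomain 𝒟
  field
    {arity} : ℕ
    pred    : NP arity
    args    : Vec NV arity

instance
  code-Constraint : ∀ {𝒟} → Code (Constraint 𝒟)
  code-Constraint {𝒟} = record { encode = enc ; injective = inj }
    where
    open ConcreteDomain 𝒟
    enc : Constraint 𝒟 → Tree
    enc (constraint {k} P xs) =
      Code.encode code-NP (k , P) ∙ Code.encode (code-List {{code-NV}}) (Vec.toList xs)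
    inj : ∀ {α β} → enc α ≡ enc β → α ≡ β
    inj {constraint P xs} {constraint Q ys} p with Code.injective code-NP (∙-injˡ p)
    ... | refl = cong (constraint P)
      (trans (sym (Vec.cast-is-id refl xs))
        (Vec.toList-injective refl xs ys
          (Code.injective (code-List {{code-NV}}) (∙-injʳ p))))

module _ (𝒟 : ConcreteDomain) where
  open ConcreteDomain 𝒟

  -- Assignments are partial, since the values of the variables at an
  -- element of an interpretation form a partial assignment.  A constraint
  -- is satisfied only if all its variables are defined.  If validity only
  -- took total assignments into account, γ → ⊤ᴾ(x) would be valid for
  -- every γ, whereas an element in the extension of γ need not have an
  -- x-value.

  Assignment : Set
  Assignment = NV → Maybe Δ

  Satisfies : Assignment → Constraint 𝒟 → Set
  Satisfies v (constraint P xs) =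
    ∃[ as ] Vec.map v xs ≡ Vec.map just as × ⟦ P ⟧ᴾ as

  -- Disjunctions are non-empty; falsity is the constraint ⊥ᴾ().

  Valid : List (Constraint 𝒟) → List⁺ (Constraint 𝒟) → Set
  Valid γ δ = ∀ (v : Assignment) → All (Satisfies v) γ → Any (Satisfies v) (toList δ)

  ⊥-constraint : Constraint 𝒟
  ⊥-constraint = constraint ⊥ᴾ []

  Convex : Set
  Convex = ∀ γ δ → Valid γ δ → ∃[ α ] α ∈ toList δ × Valid γ List⁺.[ α ]

  DecidesValidity : List (Constraint 𝒟) × List⁺ (Constraint 𝒟) → Bool → Set
  DecidesValidity (γ , δ) b = b ≡ true ⇔ Valid γ δ

  record PAdmissible : Set where
    field
      convex   : Convex
      tester   : Fun 1
      validity : tester SolvesInPolyTime DecidesValidity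

------------------------------------------------------------------------
-- Concepts over concept names N and constraints K: 𝓔𝓛⊥ is the case K = ⊥.

RoleName : Set
RoleName = ℕᵇ

infixr 7 _⊓_

data Concept (N K : Set) : Set where
  ⊤ᶜ  : Concept N K
  ⊥ᶜ  : Concept N K
  nm  : N → Concept N K
  [_] : K → Concept N K
  _⊓_ : Concept N K → Concept N K → Concept N K
  ∃ᶜ  : RoleName → Concept N K → Concept N K

infix 6 _⊑_

record GCI (N K : Set) : Set where
  constructor _⊑_
  field
    lhs rhs : Concept N K

Ontology : Set → Set → Set
Ontology N K = List (GCI N K)

sub : ∀ {N K} → Concept N K → List (Concept N K)
sub C@(D ⊓ E)  = C ∷ sub D ++ sub E
sub C@(∃ᶜ r D) = C ∷ sub D
sub C          = C ∷ []

subᴼ : ∀ {N K} → Ontology N K → List (Concept N K)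
subᴼ = concatMap λ (C ⊑ D) → sub C ++ sub D

tag⊤ tag⊥ tagName tagConstraint tag⊓ tag∃ tag₁ tag₂ : Tree
tag⊤          = nil
tag⊥          = nil ∙ tag⊤
tagName       = nil ∙ tag⊥
tagConstraint = nil ∙ tagName
tag⊓          = nil ∙ tagConstraint
tag∃          = nil ∙ tag⊓
-- the tags used by code-⊎
tag₁          = nil
tag₂          = nil ∙ nil

instance
  code-Concept : ∀ {N K} → {{Code N}} → {{Code K}} → Code (Concept N K)
  code-Concept {N} {K} {{cn}} {{ck}} = record { encode = enc ; injective = λ {x} {y} → inj x y }
    where
    enc : Concept N K → Tree
    enc ⊤ᶜ       = tag⊤ ∙ nil
    enc ⊥ᶜ       = tag⊥ ∙ nil
    enc (nm A)   = tagName ∙ Code.encode cn A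
    enc [ α ]    = tagConstraint ∙ Code.encode ck α
    enc (C ⊓ D)  = tag⊓ ∙ (enc C ∙ enc D)
    enc (∃ᶜ r C) = tag∃ ∙ (encode r ∙ enc C)
    inj : ∀ C D → enc C ≡ enc D → C ≡ D
    inj ⊤ᶜ       ⊤ᶜ       _ = refl
    inj ⊥ᶜ       ⊥ᶜ       _ = refl
    inj (nm A)   (nm B)   p = cong nm (Code.injective cn (∙-injʳ p))
    inj [ α ]    [ β ]    p = cong [_] (Code.injective ck (∙-injʳ p))
    inj (C ⊓ D)  (E ⊓ F)  p =
      cong₂ _⊓_ (inj C E (∙-injˡ (∙-injʳ p))) (inj D F (∙-injʳ (∙-injʳ p)))
    inj (∃ᶜ r C) (∃ᶜ s D) p =
      cong₂ ∃ᶜ (Code.injective code-ℕᵇ (∙-injˡ (∙-injʳ p))) (inj C D (∙-injʳ (∙-injʳ p)))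

  code-GCI : ∀ {N K} → {{Code N}} → {{Code K}} → Code (GCI N K)
  code-GCI = record
    { encode    = λ (C ⊑ D) → encode C ∙ encode D
    ; injective = λ p → cong₂ _⊑_ (Code.injective code-Concept (∙-injˡ p))
                                  (Code.injective code-Concept (∙-injʳ p))
    }

------------------------------------------------------------------------
-- Interpretations

record Interpretation (N : Set) : Set₁ where
  field
    Dom   : Set
    point : Dom
    name  : N → Dom → Set
    role  : RoleName → Dom → Dom → Set

module _ {N K : Set} (I : Interpretation N) (κ : K → Interpretation.Dom I → Set) where
  open Interpretation I

  Ext : Concept N K → Dom → Set
  Ext ⊤ᶜ       d = ⊤
  Ext ⊥ᶜ       d = ⊥
  Ext (nm A)   d = name A d
  Ext [ α ]    d = κ α d
  Ext (C ⊓ D)  d = Ext C d × Ext D d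
  Ext (∃ᶜ r C) d = ∃[ e ] role r d e × Ext C e

  ModelOfGCI : GCI N K → Set
  ModelOfGCI (C ⊑ D) = ∀ d → Ext C d → Ext D d

  ModelOf : Ontology N K → Set
  ModelOf = All ModelOfGCI

-- 𝓔𝓛⊥

Entails : ∀ {N} → Ontology N ⊥ → GCI N ⊥ → Set₁
Entails {N} O ax = ∀ (I : Interpretation N) → ModelOf I (λ ()) O → ModelOfGCI I (λ ()) ax

IsClassification : ∀ {N} → Ontology N ⊥ → List (Concept N ⊥ × Concept N ⊥) → Set₁
IsClassification O L =
  ∀ C D → (C , D) ∈ L ⇔ (C ∈ subᴼ O × D ∈ subᴼ O × Entails O (C ⊑ D))

record Classifier (N : Set) {{_ : Code N}} : Set₁ where
  field
    program : Fun 1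
    correct : program SolvesInPolyTime IsClassification {N}

-- 𝓔𝓛⊥[𝒟]

ConceptName : Set
ConceptName = ℕᵇ

module _ (𝒟 : ConcreteDomain) where
  open ConcreteDomain 𝒟

  Conceptᴰ : Set
  Conceptᴰ = Concept ConceptName (Constraint 𝒟)

  GCIᴰ : Set
  GCIᴰ = GCI ConceptName (Constraint 𝒟)

  Ontologyᴰ : Set
  Ontologyᴰ = Ontology ConceptName (Constraint 𝒟)

  record Interpretationᴰ : Set₁ where
    field
      base : Interpretation ConceptName
    open Interpretation base public
    field
      value : NV → Dom → Maybe Δ

    holds : Constraint 𝒟 → Dom → Set
    holds α d = Satisfies 𝒟 (λ x → value x d) α

  Entailsᴰ : Ontologyᴰ → GCIᴰ → Set₁
  Entailsᴰ O ax = ∀ (I : Interpretationᴰ) → let open Interpretationᴰ I in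
    ModelOf base holds O → ModelOfGCI base holds ax

  -- The concept names of the abstraction.  Freshness of the names
  -- A_α = inj₂ α is ensured by the disjoint union.

  Nameᴬ : Set
  Nameᴬ = ConceptName ⊎ Constraint 𝒟

------------------------------------------------------------------------
-- Algorithm 1 as a program.  The comments show the variables in scope,
-- starting with variable 0.

pattern v0 = var zero
pattern v1 = var (suc zero)
pattern v2 = var (suc (suc zero))
pattern v3 = var (suc (suc (suc zero)))
pattern v4 = var (suc (suc (suc (suc zero))))
pattern v5 = var (suc (suc (suc (suc (suc zero)))))

⌜_⌝ : ∀ {k n} → Tree → Term k n
⌜ nil ⌝   = nil
⌜ x ∙ y ⌝ = ⌜ x ⌝ ∙ ⌜ y ⌝

yes no : ∀ {k n} → Term k n
yes = ⌜ encode true ⌝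
no  = ⌜ encode false ⌝

equal : Fun 2                     -- a b
equal =
  case v0 (if v1 then no else yes)
    (case v3 no                   -- b₁ b₂ a₁ a₂ a b
      (if self (v2 ∷ v0 ∷ []) then self (v3 ∷ v1 ∷ []) else no))

member : Fun 2                    -- x l
member =
  case v1 no                      -- y l′ x l
    (if call equal (v2 ∷ v0 ∷ []) then yes else self (v2 ∷ v1 ∷ []))

subset : Fun 2                    -- l m
subset =
  case v0 yes                     -- x l′ l m
    (if call member (v0 ∷ v3 ∷ []) then self (v1 ∷ v3 ∷ []) else no)

sameSet : Fun 2                   -- l m
sameSet = if call subset (v0 ∷ v1 ∷ []) then call subset (v1 ∷ v0 ∷ []) else no

-- concepts as trees

_is_ : ∀ {k n} → Term k n → Tree → Term k n
e is tag = call equal (e ∷ ⌜ tag ⌝ ∷ [])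

-- A_α
abstractName : ∀ {k n} → Term k n → Term k n
abstractName α = ⌜ tagName ⌝ ∙ (⌜ tag₂ ⌝ ∙ α)

abstractConcept : Fun 1           -- C
abstractConcept =
  case v0 nil                     -- tag p C
    (if v0 is tagName       then ⌜ tagName ⌝ ∙ (⌜ tag₁ ⌝ ∙ v1) else
     if v0 is tagConstraint then abstractName v1 else
     if v0 is tag⊓          then case v1 nil           -- D E tag p C
                                   (⌜ tag⊓ ⌝ ∙ (self (v0 ∷ []) ∙ self (v1 ∷ []))) else
     if v0 is tag∃          then case v1 nil           -- r D tag p C
                                   (⌜ tag∃ ⌝ ∙ (v0 ∙ self (v1 ∷ []))) else
     v2)

-- C with every A_α replaced by [ α ]
concretiseConcept : Fun 1         -- C
concretiseConcept =
  case v0 nil                     -- tag p C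
    (if v0 is tagName       then case v1 nil           -- tag′ q tag p C
                                   (if v0 is tag₂ then ⌜ tagConstraint ⌝ ∙ v1
                                                  else ⌜ tagName ⌝ ∙ v1) else
     if v0 is tag⊓          then case v1 nil           -- D E tag p C
                                   (⌜ tag⊓ ⌝ ∙ (self (v0 ∷ []) ∙ self (v1 ∷ []))) else
     if v0 is tag∃          then case v1 nil           -- r D tag p C
                                   (⌜ tag∃ ⌝ ∙ (v0 ∙ self (v1 ∷ []))) else
     v2)

-- apply g to both components of every pair in a list
mapPairs : Fun 1 → Fun 1          -- l
mapPairs g =
  case v0 nil                     -- pair l′ l
    (case v0 nil                  -- C D pair l′ l
      ((call g (v0 ∷ []) ∙ call g (v1 ∷ [])) ∙ self (v3 ∷ [])))

abstractOntology : Fun 1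
abstractOntology = mapPairs abstractConcept

concretisePairs : Fun 1
concretisePairs = mapPairs concretiseConcept

subconcepts : Fun 2               -- C acc
subconcepts =
  v0 ∙ case v0 v1                 -- tag p C acc
    (if v0 is tag⊓ then case v1 nil                    -- D E tag p C acc
                          (self (v0 ∷ self (v1 ∷ v5 ∷ []) ∷ [])) else
     if v0 is tag∃ then case v1 nil                    -- r D tag p C acc
                          (self (v1 ∷ v5 ∷ [])) else
     v3)

constraintsOfConcept : Fun 2      -- C acc
constraintsOfConcept =
  case v0 v1                      -- tag p C acc
    (if v0 is tagConstraint then (if call member (v1 ∷ v3 ∷ []) then v3 else v1 ∙ v3) else
     if v0 is tag⊓          then case v1 nil           -- D E tag p C acc
                                   (self (v0 ∷ self (v1 ∷ v5 ∷ []) ∷ [])) else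
     if v0 is tag∃          then case v1 nil           -- r D tag p C acc
                                   (self (v1 ∷ v5 ∷ [])) else
     v3)

-- accumulate g over the two sides of every axiom
collect : Fun 2 → Fun 1           -- O
collect g =
  case v0 nil                     -- axiom O′ O
    (case v0 nil                  -- C D axiom O′ O
      (call g (v0 ∷ call g (v1 ∷ self (v3 ∷ []) ∷ []) ∷ [])))

-- sub(O)
subOntology : Fun 1
subOntology = collect subconcepts

-- 𝒞(O), without repetitions
constraints : Fun 1
constraints = collect constraintsOfConcept

-- A_α₁ ⊓ … ⊓ A_αₖ, which is ⊤ for k = 0
conjunction : Fun 1               -- αs
conjunction =
  case v0 (⌜ tag⊤ ⌝ ∙ nil)        -- α αs′ αs
    (if v1 then ⌜ tag⊓ ⌝ ∙ (abstractName v0 ∙ self (v1 ∷ [])) else abstractName v0)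

-- { α ∈ cs ∣ ⟨ C , A_α ⟩ ∈ cl }
selectD : Fun 3                   -- C cs cl
selectD =
  case v1 nil                     -- α cs′ C cs cl
    (if call member ((v2 ∙ abstractName v0) ∷ v4 ∷ [])
     then v0 ∙ self (v2 ∷ v1 ∷ v4 ∷ [])
     else self (v2 ∷ v1 ∷ v4 ∷ []))

-- `valid` tests validity in the concrete domain, `classify` is the 𝓔𝓛⊥
-- classifier, and `falsum` is the code of the constraint ⊥ᴾ().

module Algorithm (valid classify : Fun 1) (falsum : Tree) where

  -- 𝒟 ⊨ ⋀ γ → α
  _implies_ : ∀ {k n} → Term k n → Term k n → Term k n
  γ implies α = call valid ((γ ∙ (α ∙ nil)) ∷ [])

  -- O′ with the axioms ⋀ D ⊑ A_β for all β ∈ cs implied by D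
  addImplied : Fun 3              -- D cs O′
  addImplied =
    case v1 v2                    -- β cs′ D cs O′
      (if v2 implies v0
       then (call conjunction (v2 ∷ []) ∙ abstractName v0) ∙ self (v2 ∷ v1 ∷ v4 ∷ [])
       else self (v2 ∷ v1 ∷ v4 ∷ []))

  addAxioms : Fun 3               -- D cs O′
  addAxioms =
    if v0 implies ⌜ falsum ⌝
    then (call conjunction (v0 ∷ []) ∙ (⌜ tag⊥ ⌝ ∙ nil)) ∙ v2
    else call addImplied (v0 ∷ v1 ∷ v2 ∷ [])

  forEach : Fun 3                 -- S cs O′
  forEach =
    case v0 v2                    -- C S′ S cs O′
      (self (v1 ∷ v3 ∷
        call addAxioms
          (call selectD (v0 ∷ v3 ∷ call classify (v4 ∷ []) ∷ []) ∷ v3 ∷ v4 ∷ []) ∷ []))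

  while : Fun 4                   -- N O′ S cs
  while =
    if call sameSet (v0 ∷ call classify (v1 ∷ []) ∷ [])
    then v0
    else self (call classify (v1 ∷ []) ∷ call forEach (v2 ∷ v3 ∷ v1 ∷ []) ∷ v2 ∷ v3 ∷ [])

  main : Fun 1                    -- O
  main =
    call concretisePairs
      (call while
        (nil ∷
         call abstractOntology (v0 ∷ []) ∷
         call subOntology (call abstractOntology (v0 ∷ []) ∷ []) ∷
         call constraints (v0 ∷ []) ∷ []) ∷ [])

algorithm1 : (𝒟 : ConcreteDomain) → PAdmissible 𝒟 → Classifier (Nameᴬ 𝒟) → Fun 1
algorithm1 𝒟 adm cls =
  Algorithm.main (PAdmissible.tester adm) (Classifier.program cls) (encode (⊥-constraint 𝒟))

-- The specification of the output on the input O.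

ComputesClassification : ∀ {𝒟} → Ontologyᴰ 𝒟 → List (Conceptᴰ 𝒟 × Conceptᴰ 𝒟) → Set₁
ComputesClassification {𝒟} O L =
  ∀ C D → C ∈ subᴼ O → D ∈ subᴼ O → (C , D) ∈ L ⇔ Entailsᴰ 𝒟 O (C ⊑ D)

{-# OPTIONS --safe #-}

-- Termination.  The axioms added by a pass depend only on the sets D_C,
-- which grow with the ontology.  If none of them changes over two
-- consecutive passes, the second pass adds nothing new and the loop stops.
-- Hence, for consecutive ontologies O, O′ of the loop, the total size of
-- the sets D_C for O plus that for O′ strictly increases, and the number
-- of passes is at most linear in |sub(O)| · |𝒞(O)|.
--
-- Running time.  Every pass enlarges the ontology by a polynomial in the
-- size of the input, so classifier and validity test always run on inputs
-- of polynomial size.  A classification is small even though trees are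
-- shared: its length is bounded by the height of the tree, hence by the
-- running time, and its members are subconcepts of the ontology.
--
-- Soundness.  A model of O becomes a model of all generated axioms if A_α
-- is interpreted as the extension of [α].
--
-- Completeness.  The elements of the canonical model are the satisfiable
-- C ∈ sub(O), with C in A iff C ⊑ A is entailed and C an r-predecessor of
-- D iff C ⊑ ∃r.D is entailed.  The set D_C is closed under implication in
-- 𝒟 and does not imply ⊥, so by convexity some assignment satisfies
-- exactly the constraints of D_C; it gives the values of the variables at C.

module Submission where

import Level
open import Level using (0ℓ; suc)
open import Axiom.ExcludedMiddle using (ExcludedMiddle)
open import Defs

open import Data.Bool.Base using (Bool; true; false; _∧_; _∨_)
  renaming (if_then_else_ to ifᵇ_then_else_)
open import Data.Empty using (⊥; ⊥-elim)
open import Data.List.Base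
  using (List; []; _∷_; _++_; foldr; map; length; filter; cartesianProduct)
import Data.List.Membership.DecPropositional as DecMembership
open import Data.List.Membership.Propositional using (_∈_; lose)
import Data.List.Membership.Propositional.Properties as List
open import Data.List.NonEmpty.Base using (List⁺)
import Data.List.NonEmpty.Base as List⁺
import Data.List.Properties as List
open import Data.List.Relation.Binary.Pointwise.Base using (Pointwise; []; _∷_)
import Data.List.Relation.Binary.Pointwise as Pointwise
import Data.List.Relation.Binary.Sublist.Heterogeneous.Properties as HSublist
open import Data.List.Relation.Binary.Sublist.Propositional using (⊆-refl)
import Data.List.Relation.Binary.Sublist.Propositional as Sublist using (_⊆_)
import Data.List.Relation.Binary.Sublist.Propositional.Properties as Sublist
open import Data.List.Relation.Binary.Subset.Propositional using (_⊆_)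
import Data.List.Relation.Binary.Subset.Propositional.Properties as Subset
open import Data.List.Relation.Unary.All using (All; []; _∷_; all?)
import Data.List.Relation.Unary.All as All
import Data.List.Relation.Unary.All.Properties as All
open import Data.List.Relation.Unary.Any using (Any; here; there)
open import Data.Maybe.Base using (Maybe; just; nothing)
import Data.Maybe.Base as Maybe
open import Data.Nat.Base as ℕ
  using (ℕ; zero; _+_; _*_; _∸_; _^_; _≤_; _<_; _≤ᵇ_; _⊔_; z≤n; s≤s)
import Data.Nat.Properties as ℕ
open import Data.Nat.Tactic.RingSolver using (solve-∀)
open import Data.Product.Base using (∃; ∃₂; _×_; _,_; proj₁; proj₂; uncurry; <_,_>)
import Data.Product.Base as Product
open import Data.Sum.Base using (_⊎_; inj₁; inj₂)
import Data.Sum.Base as Sum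
open import Data.Unit.Base using (tt)
open import Data.Vec.Base using (Vec; []; _∷_)
import Data.Vec.Base as Vec
import Data.Vec.Relation.Unary.All as VecAll
import Data.Vec.Relation.Unary.All.Properties as VecAll
open import Function.Base using (_∘_; id)
open import Function.Bundles using (mk⇔; Equivalence)
open import Relation.Binary.Definitions using (DecidableEquality)
open import Relation.Binary.PropositionalEquality
  using (_≡_; refl; sym; trans; cong; cong₂; subst; subst₂; module ≡-Reasoning)
open import Relation.Nullary.Decidable
  using (Dec; does; _×-dec_; True; False; toWitness; fromWitness;
         toWitnessFalse; fromWitnessFalse; ¬?)
import Relation.Nullary.Decidable as Dec
open import Relation.Nullary.Negation using (¬_; contradiction)
open import Relation.Unary using (Decidable)

-- Polynomials with natural coefficients

infixl 6 _⊕_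
infixl 7 _⊗_

data Poly : Set where
  con ind : ℕ → Poly
  _⊕_ _⊗_ : Poly → Poly → Poly

pattern x₀ = ind 0
pattern x₁ = ind 1
pattern x₂ = ind 2
pattern x₃ = ind 3
pattern x₄ = ind 4
pattern x₅ = ind 5

Values : Set
Values = List ℕ

-- Missing entries count as 0, in step with `nthᵖ`, so substitution is correct for lists of any
-- length.
nth : Values → ℕ → ℕ
nth []       _         = 0
nth (x ∷ _)  zero      = x
nth (_ ∷ xs) (ℕ.suc i) = nth xs i

⟦_⟧ : Poly → Values → ℕ
⟦ con c ⟧ σ = c
⟦ ind i ⟧ σ = nth σ i
⟦ p ⊕ q ⟧ σ = ⟦ p ⟧ σ + ⟦ q ⟧ σ
⟦ p ⊗ q ⟧ σ = ⟦ p ⟧ σ * ⟦ q ⟧ σ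

⟦_⟧* : List Poly → Values → Values
⟦ ps ⟧* σ = map (λ p → ⟦ p ⟧ σ) ps

nthᵖ : List Poly → ℕ → Poly
nthᵖ []       _         = con 0
nthᵖ (p ∷ _)  zero      = p
nthᵖ (_ ∷ ps) (ℕ.suc i) = nthᵖ ps i

substitute : List Poly → Poly → Poly
substitute ps (con c) = con c
substitute ps (ind i) = nthᵖ ps i
substitute ps (p ⊕ q) = substitute ps p ⊕ substitute ps q
substitute ps (p ⊗ q) = substitute ps p ⊗ substitute ps q

⟦nth⟧ : ∀ ps i σ → ⟦ nthᵖ ps i ⟧ σ ≡ nth (⟦ ps ⟧* σ) i
⟦nth⟧ []       i         σ = refl
⟦nth⟧ (p ∷ ps) zero      σ = refl
⟦nth⟧ (p ∷ ps) (ℕ.suc i) σ = ⟦nth⟧ ps i σ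

⟦substitute⟧ : ∀ ps p σ → ⟦ substitute ps p ⟧ σ ≡ ⟦ p ⟧ (⟦ ps ⟧* σ)
⟦substitute⟧ ps (con c) σ = refl
⟦substitute⟧ ps (ind i) σ = ⟦nth⟧ ps i σ
⟦substitute⟧ ps (p ⊕ q) σ = cong₂ _+_ (⟦substitute⟧ ps p σ) (⟦substitute⟧ ps q σ)
⟦substitute⟧ ps (p ⊗ q) σ = cong₂ _*_ (⟦substitute⟧ ps p σ) (⟦substitute⟧ ps q σ)

infix 4 _≤*_

_≤*_ : Values → Values → Set
_≤*_ = Pointwise _≤_

nth-mono : ∀ {σ τ} → σ ≤* τ → ∀ i → nth σ i ≤ nth τ i
nth-mono []         i         = ℕ.z≤n
nth-mono (x≤y ∷ _)  zero      = x≤y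
nth-mono (_ ∷ σ≤τ)  (ℕ.suc i) = nth-mono σ≤τ i

⟦⟧-mono : ∀ {σ τ} p → σ ≤* τ → ⟦ p ⟧ σ ≤ ⟦ p ⟧ τ
⟦⟧-mono (con c) σ≤τ = ℕ.≤-refl
⟦⟧-mono (ind i) σ≤τ = nth-mono σ≤τ i
⟦⟧-mono (p ⊕ q) σ≤τ = ℕ.+-mono-≤ (⟦⟧-mono p σ≤τ) (⟦⟧-mono q σ≤τ)
⟦⟧-mono (p ⊗ q) σ≤τ = ℕ.*-mono-≤ (⟦⟧-mono p σ≤τ) (⟦⟧-mono q σ≤τ)

-- Normal forms and coefficientwise comparison of polynomials

Monomial : Set
Monomial = List ℕ

NormalForm : Set
NormalForm = List (ℕ × Monomial)

-- Keeping the indices sorted makes monomials that agree up to commutativity equal as lists, so that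
-- like terms are found and merged.
insert : ℕ → Monomial → Monomial
insert i []      = i ∷ []
insert i (j ∷ m) with i ≤ᵇ j
... | true  = i ∷ j ∷ m
... | false = j ∷ insert i m

addTerm : ℕ → Monomial → NormalForm → NormalForm
addTerm c m []            = (c , m) ∷ []
addTerm c m ((d , n) ∷ p) with List.≡-dec ℕ._≟_ m n
... | Dec.yes _ = (c + d , n) ∷ p
... | Dec.no  _ = (d , n) ∷ addTerm c m p

add : NormalForm → NormalForm → NormalForm
add p q = foldr (λ (c , m) → addTerm c m) q p

scale : ℕ → Monomial → NormalForm → NormalForm → NormalForm
scale c m p q = foldr (λ (d , n) → addTerm (c * d) (foldr insert n m)) q p

normalise : Poly → NormalForm
normalise (con c) = (c , []) ∷ []
normalise (ind i) = (1 , i ∷ []) ∷ []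
normalise (p ⊕ q) = add (normalise p) (normalise q)
normalise (p ⊗ q) = foldr (λ (c , m) → scale c m (normalise q)) [] (normalise p)

subtractTerm : ℕ → Monomial → NormalForm → Maybe NormalForm
subtractTerm zero        m p             = just p
subtractTerm c@(ℕ.suc _) m []            = nothing
subtractTerm c@(ℕ.suc _) m ((d , n) ∷ p) with List.≡-dec ℕ._≟_ m n | c ℕ.≤? d
... | Dec.yes _ | Dec.yes _ = just ((d ∸ c , n) ∷ p)
... | Dec.yes _ | Dec.no  _ = nothing
... | Dec.no  _ | _         = Maybe.map ((d , n) ∷_) (subtractTerm c m p)

dominated : NormalForm → NormalForm → Bool
dominated []            q = true
dominated ((c , m) ∷ p) q with subtractTerm c m q
... | just r  = dominated p r
... | nothing = false

infix 4 _≤ᵖ_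

-- Compares coefficient by coefficient, which suffices for the inequality at all natural values but
-- is not necessary: `x₀` does not pass against `x₀ ⊗ x₀`. On concrete polynomials the test
-- computes, so `refl` discharges the comparisons below.
_≤ᵖ_ : Poly → Poly → Bool
p ≤ᵖ q = dominated (normalise p) (normalise q)

module _ (σ : Values) where

  ⟦_⟧ᵐ : Monomial → ℕ
  ⟦_⟧ᵐ = foldr (λ i → nth σ i *_) 1

  ⟦_⟧ⁿ : NormalForm → ℕ
  ⟦_⟧ⁿ = foldr (λ (c , m) → c * ⟦ m ⟧ᵐ +_) 0

  insert-correct : ∀ i m → ⟦ insert i m ⟧ᵐ ≡ nth σ i * ⟦ m ⟧ᵐ
  insert-correct i []      = refl
  insert-correct i (j ∷ m) with i ≤ᵇ j
  ... | true  = refl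
  ... | false rewrite insert-correct i m = swap (nth σ j) (nth σ i) ⟦ m ⟧ᵐ
    where
    swap : ∀ a b c → a * (b * c) ≡ b * (a * c)
    swap = solve-∀

  insert-all-correct : ∀ m n → ⟦ foldr insert n m ⟧ᵐ ≡ ⟦ m ⟧ᵐ * ⟦ n ⟧ᵐ
  insert-all-correct []      n = sym (ℕ.*-identityˡ _)
  insert-all-correct (i ∷ m) n = begin
    ⟦ insert i (foldr insert n m) ⟧ᵐ  ≡⟨ insert-correct i (foldr insert n m) ⟩
    nth σ i * ⟦ foldr insert n m ⟧ᵐ   ≡⟨ cong (nth σ i *_) (insert-all-correct m n) ⟩
    nth σ i * (⟦ m ⟧ᵐ * ⟦ n ⟧ᵐ)        ≡⟨ ℕ.*-assoc (nth σ i) _ _ ⟨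
    nth σ i * ⟦ m ⟧ᵐ * ⟦ n ⟧ᵐ          ∎
    where open ≡-Reasoning

  addTerm-correct : ∀ c m p → ⟦ addTerm c m p ⟧ⁿ ≡ c * ⟦ m ⟧ᵐ + ⟦ p ⟧ⁿ
  addTerm-correct c m []            = refl
  addTerm-correct c m ((d , n) ∷ p) with List.≡-dec ℕ._≟_ m n
  ... | Dec.yes refl = gather c d ⟦ n ⟧ᵐ ⟦ p ⟧ⁿ
    where
    gather : ∀ c d n p → (c + d) * n + p ≡ c * n + (d * n + p)
    gather = solve-∀
  ... | Dec.no _ rewrite addTerm-correct c m p = swap (d * ⟦ n ⟧ᵐ) (c * ⟦ m ⟧ᵐ) ⟦ p ⟧ⁿ
    where
    swap : ∀ a b c → a + (b + c) ≡ b + (a + c)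
    swap = solve-∀

  scale-correct : ∀ c m p q → ⟦ scale c m p q ⟧ⁿ ≡ c * ⟦ m ⟧ᵐ * ⟦ p ⟧ⁿ + ⟦ q ⟧ⁿ
  scale-correct c m []            q = cong (_+ ⟦ q ⟧ⁿ) (sym (ℕ.*-zeroʳ (c * ⟦ m ⟧ᵐ)))
  scale-correct c m ((d , n) ∷ p) q
    rewrite addTerm-correct (c * d) (foldr insert n m) (scale c m p q)
          | insert-all-correct m n
          | scale-correct c m p q
          = distrib c d ⟦ m ⟧ᵐ ⟦ n ⟧ᵐ ⟦ p ⟧ⁿ ⟦ q ⟧ⁿ
    where
    distrib : ∀ c d m n p q → c * d * (m * n) + (c * m * p + q) ≡ c * m * (d * n + p) + q
    distrib = solve-∀

  normalise-correct : ∀ p → ⟦ normalise p ⟧ⁿ ≡ ⟦ p ⟧ σ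
  normalise-correct (con c) = trans (ℕ.+-identityʳ _) (ℕ.*-identityʳ c)
  normalise-correct (ind i) = identities (nth σ i)
    where
    identities : ∀ x → 1 * (x * 1) + 0 ≡ x
    identities = solve-∀
  normalise-correct (p ⊕ q) = trans (sum (normalise p))
    (cong₂ _+_ (normalise-correct p) (normalise-correct q))
    where
    sum : ∀ r → ⟦ add r (normalise q) ⟧ⁿ ≡ ⟦ r ⟧ⁿ + ⟦ normalise q ⟧ⁿ
    sum []            = refl
    sum ((c , m) ∷ r) = trans (addTerm-correct c m (add r (normalise q)))
      (trans (cong (c * ⟦ m ⟧ᵐ +_) (sum r)) (sym (ℕ.+-assoc (c * ⟦ m ⟧ᵐ) _ _)))
  normalise-correct (p ⊗ q) = trans (product (normalise p))
    (cong₂ _*_ (normalise-correct p) (normalise-correct q))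
    where
    product : ∀ r → ⟦ foldr (λ (c , m) → scale c m (normalise q)) [] r ⟧ⁿ ≡ ⟦ r ⟧ⁿ * ⟦ normalise q ⟧ⁿ
    product []            = refl
    product ((c , m) ∷ r) = trans (scale-correct c m (normalise q) _)
      (trans (cong (c * ⟦ m ⟧ᵐ * ⟦ normalise q ⟧ⁿ +_) (product r))
             (sym (ℕ.*-distribʳ-+ ⟦ normalise q ⟧ⁿ (c * ⟦ m ⟧ᵐ) _)))

  subtractTerm-correct : ∀ c m p {r} → subtractTerm c m p ≡ just r →
                         ⟦ p ⟧ⁿ ≡ c * ⟦ m ⟧ᵐ + ⟦ r ⟧ⁿ
  subtractTerm-correct zero        m p             refl = refl
  subtractTerm-correct c@(ℕ.suc _) m ((d , n) ∷ p) eq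
    with List.≡-dec ℕ._≟_ m n | c ℕ.≤? d
  subtractTerm-correct c@(ℕ.suc _) m ((d , n) ∷ p) refl | Dec.yes refl | Dec.yes c≤d = begin
    d * ⟦ n ⟧ᵐ + ⟦ p ⟧ⁿ                     ≡⟨ cong (λ e → e * ⟦ n ⟧ᵐ + ⟦ p ⟧ⁿ) (ℕ.m+[n∸m]≡n c≤d) ⟨
    (c + (d ∸ c)) * ⟦ n ⟧ᵐ + ⟦ p ⟧ⁿ         ≡⟨ split c (d ∸ c) ⟦ n ⟧ᵐ ⟦ p ⟧ⁿ ⟩
    c * ⟦ n ⟧ᵐ + ((d ∸ c) * ⟦ n ⟧ᵐ + ⟦ p ⟧ⁿ) ∎
    where
    open ≡-Reasoning
    split : ∀ c d n p → (c + d) * n + p ≡ c * n + (d * n + p)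
    split = solve-∀
  ... | Dec.no _ | _ with subtractTerm c m p in found
  subtractTerm-correct c@(ℕ.suc _) m ((d , n) ∷ p) refl | Dec.no _ | _ | just r
    rewrite subtractTerm-correct c m p found = swap (d * ⟦ n ⟧ᵐ) (c * ⟦ m ⟧ᵐ) ⟦ r ⟧ⁿ
    where
    swap : ∀ a b c → a + (b + c) ≡ b + (a + c)
    swap = solve-∀

  dominated-correct : ∀ p q → dominated p q ≡ true → ⟦ p ⟧ⁿ ≤ ⟦ q ⟧ⁿ
  dominated-correct []            q _  = ℕ.z≤n
  dominated-correct ((c , m) ∷ p) q eq with subtractTerm c m q in found
  ... | just r rewrite subtractTerm-correct c m q found =
    ℕ.+-monoʳ-≤ (c * ⟦ m ⟧ᵐ) (dominated-correct p r eq)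

  ≤ᵖ-sound : ∀ p q → (p ≤ᵖ q) ≡ true → ⟦ p ⟧ σ ≤ ⟦ q ⟧ σ
  ≤ᵖ-sound p q eq rewrite sym (normalise-correct p) | sym (normalise-correct q) =
    dominated-correct (normalise p) (normalise q) eq

-- Evaluation within polynomial bounds

infix 4 _·_↓_⟨_∣_⟩ _∣_,_⊢_↓_⟨_⟩ _∣_,_⊢_↓*_⟨_⟩

-- The time bound is a polynomial, kept as syntax so that bounds can be
-- inferred by unification and compared by computation.
record _·_↓_⟨_∣_⟩ {k} (f : Fun k) (xs : Vec Tree k) (v : Tree) (p : Poly) (σ : Values) : Set where
  constructor halts
  field
    {time} : ℕ
    run    : f · xs ⇓ v ⟨ time ⟩
    bound  : time ≤ ⟦ p ⟧ σ

record _∣_,_⊢_↓_⟨_⟩ (σ : Values) {k n} (f : Fun k) (ρ : Vec Tree n) (e : Term k n)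
                    (v : Tree) (p : Poly) : Set where
  constructor evals
  field
    {time} : ℕ
    run    : f , ρ ⊢ e ⇓ v ⟨ time ⟩
    bound  : time ≤ ⟦ p ⟧ σ

record _∣_,_⊢_↓*_⟨_⟩ (σ : Values) {k n m} (f : Fun k) (ρ : Vec Tree n) (es : Vec (Term k n) m)
                     (vs : Vec Tree m) (p : Poly) : Set where
  constructor evals*
  field
    {time} : ℕ
    run    : f , ρ ⊢ es ⇓* vs ⟨ time ⟩
    bound  : time ≤ ⟦ p ⟧ σ

-- A callee states its bound over the values `τ` of its own arguments. Once the caller bounds these
-- by polynomials `s` in its values, monotonicity turns the callee's bound into one of the caller.
substitute-bound : ∀ {σ τ t} s q → t ≤ ⟦ q ⟧ τ → τ ≤* ⟦ s ⟧* σ → t ≤ ⟦ substitute s q ⟧ σ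
substitute-bound {σ} {τ} {t} s q t≤ τ≤ =
  subst (t ≤_) (sym (⟦substitute⟧ s q σ)) (ℕ.≤-trans t≤ (⟦⟧-mono q τ≤))

module _ {σ : Values} {k n} {f : Fun k} {ρ : Vec Tree n} where

  private variable
    c d e  : Term k n
    p q    : Poly
    v x y : Tree

  ↓var : ∀ {i} → σ ∣ f , ρ ⊢ var i ↓ Vec.lookup ρ i ⟨ con 1 ⟩
  ↓var = evals ⇓var ℕ.≤-refl

  ↓nil : σ ∣ f , ρ ⊢ nil ↓ nil ⟨ con 1 ⟩
  ↓nil = evals ⇓nil ℕ.≤-refl

  ↓cons : σ ∣ f , ρ ⊢ d ↓ x ⟨ p ⟩ → σ ∣ f , ρ ⊢ e ↓ y ⟨ q ⟩ →
          σ ∣ f , ρ ⊢ d ∙ e ↓ x ∙ y ⟨ con 1 ⊕ p ⊕ q ⟩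
  ↓cons (evals r s≤) (evals r′ t≤) = evals (⇓cons r r′) (s≤s (ℕ.+-mono-≤ s≤ t≤))

  ↓then : σ ∣ f , ρ ⊢ c ↓ x ∙ y ⟨ p ⟩ → σ ∣ f , ρ ⊢ d ↓ v ⟨ q ⟩ →
          σ ∣ f , ρ ⊢ if c then d else e ↓ v ⟨ con 1 ⊕ p ⊕ q ⟩
  ↓then (evals r s≤) (evals r′ t≤) = evals (⇓then r r′) (s≤s (ℕ.+-mono-≤ s≤ t≤))

  ↓else : σ ∣ f , ρ ⊢ c ↓ nil ⟨ p ⟩ → σ ∣ f , ρ ⊢ e ↓ v ⟨ q ⟩ →
          σ ∣ f , ρ ⊢ if c then d else e ↓ v ⟨ con 1 ⊕ p ⊕ q ⟩
  ↓else (evals r s≤) (evals r′ t≤) = evals (⇓else r r′) (s≤s (ℕ.+-mono-≤ s≤ t≤))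

  ↓case-nil : ∀ {e} → σ ∣ f , ρ ⊢ c ↓ nil ⟨ p ⟩ → σ ∣ f , ρ ⊢ d ↓ v ⟨ q ⟩ →
              σ ∣ f , ρ ⊢ case c d e ↓ v ⟨ con 1 ⊕ p ⊕ q ⟩
  ↓case-nil (evals r s≤) (evals r′ t≤) = evals (⇓case-nil r r′) (s≤s (ℕ.+-mono-≤ s≤ t≤))

  ↓case-cons : ∀ {e} → σ ∣ f , ρ ⊢ c ↓ x ∙ y ⟨ p ⟩ → σ ∣ f , x ∷ y ∷ ρ ⊢ e ↓ v ⟨ q ⟩ →
               σ ∣ f , ρ ⊢ case c d e ↓ v ⟨ con 1 ⊕ p ⊕ q ⟩
  ↓case-cons (evals r s≤) (evals r′ t≤) = evals (⇓case-cons r r′) (s≤s (ℕ.+-mono-≤ s≤ t≤))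

  -- For calls whose arguments are only bounded by `s`, such as an accumulator or a classification
  -- of unknown size. `↓self` and `↓call` are the cases of exact sizes.
  ↓self≤ : ∀ {es vs τ} s → τ ≤* ⟦ s ⟧* σ → σ ∣ f , ρ ⊢ es ↓* vs ⟨ p ⟩ → f · vs ↓ v ⟨ q ∣ τ ⟩ →
           σ ∣ f , ρ ⊢ self es ↓ v ⟨ con 1 ⊕ p ⊕ substitute s q ⟩
  ↓self≤ {q = q} s τ≤ (evals* r s≤) (halts r′ t≤) =
    evals (⇓self r r′) (s≤s (ℕ.+-mono-≤ s≤ (substitute-bound s q t≤ τ≤)))

  ↓call≤ : ∀ {m} {g : Fun m} {es vs τ} s → τ ≤* ⟦ s ⟧* σ →
           σ ∣ f , ρ ⊢ es ↓* vs ⟨ p ⟩ → g · vs ↓ v ⟨ q ∣ τ ⟩ →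
           σ ∣ f , ρ ⊢ call g es ↓ v ⟨ con 1 ⊕ p ⊕ substitute s q ⟩
  ↓call≤ {q = q} s τ≤ (evals* r s≤) (halts r′ t≤) =
    evals (⇓call r r′) (s≤s (ℕ.+-mono-≤ s≤ (substitute-bound s q t≤ τ≤)))

  ↓self : ∀ {es vs} s → σ ∣ f , ρ ⊢ es ↓* vs ⟨ p ⟩ → f · vs ↓ v ⟨ q ∣ ⟦ s ⟧* σ ⟩ →
          σ ∣ f , ρ ⊢ self es ↓ v ⟨ con 1 ⊕ p ⊕ substitute s q ⟩
  ↓self s = ↓self≤ s (Pointwise.refl ℕ.≤-refl)

  ↓call : ∀ {m} {g : Fun m} {es vs} s → σ ∣ f , ρ ⊢ es ↓* vs ⟨ p ⟩ → g · vs ↓ v ⟨ q ∣ ⟦ s ⟧* σ ⟩ →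
          σ ∣ f , ρ ⊢ call g es ↓ v ⟨ con 1 ⊕ p ⊕ substitute s q ⟩
  ↓call s = ↓call≤ s (Pointwise.refl ℕ.≤-refl)

  ↓[] : σ ∣ f , ρ ⊢ [] ↓* [] ⟨ con 0 ⟩
  ↓[] = evals* [] ℕ.≤-refl

  infixr 5 _↓∷_

  _↓∷_ : ∀ {m} {es : Vec (Term k n) m} {vs} →
         σ ∣ f , ρ ⊢ e ↓ v ⟨ p ⟩ → σ ∣ f , ρ ⊢ es ↓* vs ⟨ q ⟩ →
         σ ∣ f , ρ ⊢ e ∷ es ↓* v ∷ vs ⟨ p ⊕ q ⟩
  evals r s≤ ↓∷ evals* r′ t≤ = evals* (r ∷ r′) (ℕ.+-mono-≤ s≤ t≤)

quote-⇓ : ∀ {k n} {f : Fun k} {ρ : Vec Tree n} x → f , ρ ⊢ ⌜ x ⌝ ⇓ x ⟨ size x ⟩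
quote-⇓ nil     = ⇓nil
quote-⇓ (x ∙ y) = ⇓cons (quote-⇓ x) (quote-⇓ y)

↓quote : ∀ {σ k n} {f : Fun k} {ρ : Vec Tree n} x → σ ∣ f , ρ ⊢ ⌜ x ⌝ ↓ x ⟨ con (size x) ⟩
↓quote x = evals (quote-⇓ x) ℕ.≤-refl

-- The size of a constant that depends on the concrete domain is not a numeral. Bounding it by a
-- variable keeps the comparison of bounds computable.
↓quote-within : ∀ {σ k n} {f : Fun k} {ρ : Vec Tree n} x p → size x ≤ ⟦ p ⟧ σ →
                σ ∣ f , ρ ⊢ ⌜ x ⌝ ↓ x ⟨ p ⟩
↓quote-within x p x≤p = evals (quote-⇓ x) x≤p

-- The evaluation is timed in `σ`, the sizes of the components of the arguments, whereas the stated
-- bound `q` speaks of the sizes of the arguments themselves, which `s` gives as polynomials in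
-- those components. With concrete polynomials the last premise is checked by computation.
finish : ∀ {k} {f : Fun k} {xs v p q} σ s → σ ∣ f , xs ⊢ f ↓ v ⟨ p ⟩ →
         (p ≤ᵖ substitute s q) ≡ true → f · xs ↓ v ⟨ q ∣ ⟦ s ⟧* σ ⟩
finish {p = p} {q} σ s (evals {t} r t≤) p≤q =
  halts r (subst (t ≤_) (⟦substitute⟧ s q σ) (ℕ.≤-trans t≤ (≤ᵖ-sound σ p (substitute s q) p≤q)))

↓weaken : ∀ {σ k n} {f : Fun k} {ρ : Vec Tree n} {e v p} q → σ ∣ f , ρ ⊢ e ↓ v ⟨ p ⟩ →
          (p ≤ᵖ q) ≡ true → σ ∣ f , ρ ⊢ e ↓ v ⟨ q ⟩
↓weaken {σ} {p = p} q (evals r t≤) p≤q = evals r (ℕ.≤-trans t≤ (≤ᵖ-sound σ p q p≤q))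

-- One bound covers both branches, and the result is a function `v` of the condition, so no case
-- split on the condition is needed where the rule is applied.
↓if : ∀ {σ k n} {f : Fun k} {ρ : Vec Tree n} {c d e p q₁ q₂} (v : Bool → Tree) b q →
      σ ∣ f , ρ ⊢ c ↓ encode b ⟨ p ⟩ →
      σ ∣ f , ρ ⊢ d ↓ v true ⟨ q₁ ⟩ → (q₁ ≤ᵖ q) ≡ true →
      σ ∣ f , ρ ⊢ e ↓ v false ⟨ q₂ ⟩ → (q₂ ≤ᵖ q) ≡ true →
      σ ∣ f , ρ ⊢ if c then d else e ↓ v b ⟨ con 1 ⊕ p ⊕ q ⟩
↓if v true  q c d q₁≤q e q₂≤q = ↓then c (↓weaken q d q₁≤q)
↓if v false q c d q₁≤q e q₂≤q = ↓else c (↓weaken q e q₂≤q)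

rebound : ∀ {k} {f : Fun k} {xs v p q} σ s s′ → f · xs ↓ v ⟨ p ∣ ⟦ s ⟧* σ ⟩ →
          (substitute s p ≤ᵖ substitute s′ q) ≡ true → f · xs ↓ v ⟨ q ∣ ⟦ s′ ⟧* σ ⟩
rebound {p = p} {q} σ s s′ (halts {t} r t≤) p≤q = halts r
  (subst (t ≤_) (⟦substitute⟧ s′ q σ)
    (ℕ.≤-trans (subst (t ≤_) (sym (⟦substitute⟧ s p σ)) t≤)
               (≤ᵖ-sound σ (substitute s p) (substitute s′ q) p≤q)))

-- Sharing lets a value be exponentially larger than the running time, but
-- not higher.
height : Tree → ℕ
height nil     = 0
height (x ∙ y) = 1 + (height x ⊔ height y)

height≤size : ∀ x → height x ≤ size x
height≤size nil     = z≤n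
height≤size (x ∙ y) = s≤s (ℕ.⊔-lub (ℕ.≤-trans (height≤size x) (ℕ.m≤m+n (size x) (size y)))
                                   (ℕ.≤-trans (height≤size y) (ℕ.m≤n+m (size y) (size x))))

LowerThan : ℕ → ∀ {n} → Vec Tree n → Set
LowerThan h = VecAll.All (λ x → height x ≤ h)

lift-lower : ∀ {h n} {ρ : Vec Tree n} s → LowerThan h ρ → LowerThan (h + s) ρ
lift-lower {h} s = VecAll.map (λ h≤ → ℕ.≤-trans h≤ (ℕ.m≤m+n h s))

private
  module _ {h : ℕ} where

    weakenˡ : ∀ s t {a} → a ≤ h + s → a ≤ h + (s + t)
    weakenˡ s t a≤ = ℕ.≤-trans a≤ (ℕ.+-monoʳ-≤ h (ℕ.m≤m+n s t))

    weakenʳ : ∀ s t {a} → a ≤ h + t → a ≤ h + (s + t)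
    weakenʳ s t a≤ = ℕ.≤-trans a≤ (ℕ.+-monoʳ-≤ h (ℕ.m≤n+m t s))

    weaken-suc : ∀ t {a} → a ≤ h + t → a ≤ h + ℕ.suc t
    weaken-suc t a≤ = ℕ.≤-trans a≤ (ℕ.+-monoʳ-≤ h (ℕ.n≤1+n t))

    weaken-assoc : ∀ s t {a} → a ≤ h + s + t → a ≤ h + ℕ.suc (s + t)
    weaken-assoc s t {a} a≤ = weaken-suc (s + t) (subst (a ≤_) (ℕ.+-assoc h s t) a≤)

-- Only `_∙_` makes a tree higher, by one level for one step. `case` passes on subtrees of what it
-- evaluated, and the body of a call runs on arguments whose height is already paid for by the time
-- spent on them.
height-bounded : ∀ {h k n} {f : Fun k} {ρ : Vec Tree n} {e v t} → LowerThan h ρ →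
                 f , ρ ⊢ e ⇓ v ⟨ t ⟩ → height v ≤ h + t
height-bounded* : ∀ {h k n m} {f : Fun k} {ρ : Vec Tree n} {es : Vec (Term k n) m} {vs t} →
                  LowerThan h ρ → f , ρ ⊢ es ⇓* vs ⟨ t ⟩ → LowerThan (h + t) vs

height-bounded {h} low (⇓var {i = i}) = ℕ.≤-trans (VecAll.lookup⁺ low i) (ℕ.m≤m+n h 1)
height-bounded low ⇓nil = z≤n
height-bounded {h} low (⇓cons {x = x} {y} {s = s} {t} r r′) =
  subst (1 + (height x ⊔ height y) ≤_) (sym (ℕ.+-suc h (s + t)))
    (s≤s (ℕ.⊔-lub (weakenˡ s t (height-bounded low r)) (weakenʳ s t (height-bounded low r′))))
height-bounded low (⇓then {s = s} {t} r r′) = weaken-suc (s + t) (weakenʳ s t (height-bounded low r′))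
height-bounded low (⇓else {s = s} {t} r r′) = weaken-suc (s + t) (weakenʳ s t (height-bounded low r′))
height-bounded low (⇓case-nil {s = s} {t} r r′) = weaken-suc (s + t) (weakenʳ s t (height-bounded low r′))
height-bounded low (⇓case-cons {x = x} {y} {s = s} {t} r r′) =
  let low-xy = ℕ.≤-trans (ℕ.n≤1+n (height x ⊔ height y)) (height-bounded low r) in
  weaken-assoc s t (height-bounded
    (ℕ.m⊔n≤o⇒m≤o (height x) (height y) low-xy VecAll.∷
     ℕ.m⊔n≤o⇒n≤o (height x) (height y) low-xy VecAll.∷
     lift-lower s low) r′)
height-bounded low (⇓self {s = s} {t} rs r) = weaken-assoc s t (height-bounded (height-bounded* low rs) r)
height-bounded low (⇓call {s = s} {t} rs r) = weaken-assoc s t (height-bounded (height-bounded* low rs) r)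

height-bounded* low []                         = VecAll.[]
height-bounded* {h} low (_∷_ {s = s} {t} r rs) =
  weakenˡ s t (height-bounded low r) VecAll.∷
  VecAll.map (weakenʳ s t) (height-bounded* low rs)

length≤height : ∀ {A : Set} {{_ : Code A}} (xs : List A) → length xs ≤ height (encode xs)
length≤height []       = z≤n
length≤height (x ∷ xs) = s≤s (ℕ.≤-trans (length≤height xs) (ℕ.m≤n⊔m (height (encode x)) _))

-- Trees and lists

infix 4 _≟ᵀ_

_≟ᵀ_ : DecidableEquality Tree
nil     ≟ᵀ nil     = Dec.yes refl
nil     ≟ᵀ (c ∙ d) = Dec.no λ ()
(a ∙ b) ≟ᵀ nil     = Dec.no λ ()
(a ∙ b) ≟ᵀ (c ∙ d) =
  Dec.map′ (uncurry (cong₂ _∙_)) < ∙-injˡ , ∙-injʳ > ((a ≟ᵀ c) ×-dec (b ≟ᵀ d))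

equalBound : Poly
equalBound = con 12 ⊗ x₀

-- The recursion descends in both trees at once, so the size of the first alone bounds the time.
equal-run : ∀ a b → equal · a ∷ b ∷ [] ↓ encode (does (a ≟ᵀ b)) ⟨ equalBound ∣ size a ∷ [] ⟩
equal-run nil nil = finish [] (con 1 ∷ [])
  (↓case-nil ↓var (↓else ↓var (↓quote (encode true)))) refl
equal-run nil (c ∙ d) = finish [] (con 1 ∷ [])
  (↓case-nil ↓var (↓then ↓var (↓quote (encode false)))) refl
equal-run (a ∙ b) nil = finish (size a ∷ size b ∷ []) (con 1 ⊕ x₀ ⊕ x₁ ∷ [])
  (↓case-cons ↓var (↓case-nil ↓var (↓quote (encode false)))) refl
equal-run (a ∙ b) (c ∙ d) = finish (size a ∷ size b ∷ []) (con 1 ⊕ x₀ ⊕ x₁ ∷ [])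
  (↓case-cons ↓var (↓case-cons ↓var
    -- `does` of the product decision reduces to a conjunction, which is the value of the nested
    -- conditional.
    (↓if (λ β → encode (β ∧ does (b ≟ᵀ d))) (does (a ≟ᵀ c)) (con 3 ⊕ con 12 ⊗ x₁)
      (↓self (x₀ ∷ []) (↓var ↓∷ ↓var ↓∷ ↓[]) (equal-run a c))
      (↓self (x₁ ∷ []) (↓var ↓∷ ↓var ↓∷ ↓[]) (equal-run b d)) refl
      (↓quote (encode false)) refl))) refl

-- The bound grows with the inspected tree `x`. Every use inspects a closed tag, where it is a
-- numeral.
↓is : ∀ {σ k n} {f : Fun k} {ρ : Vec Tree n} {e p} x tag → σ ∣ f , ρ ⊢ e ↓ x ⟨ p ⟩ →
      σ ∣ f , ρ ⊢ e is tag ↓ encode (does (x ≟ᵀ tag))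
        ⟨ con 1 ⊕ (p ⊕ (con (size tag) ⊕ con 0)) ⊕ con 12 ⊗ con (size x) ⟩
↓is x tag r = ↓call (con (size x) ∷ []) (r ↓∷ ↓quote tag ↓∷ ↓[]) (equal-run x tag)

∥_∥ : ∀ {A : Set} {{_ : Code A}} → A → ℕ
∥ x ∥ = size (encode x)

memberBound : Poly
memberBound = x₁ ⊗ (con 20 ⊕ con 12 ⊗ x₀)

subsetBound : Poly
subsetBound = con 40 ⊗ x₀ ⊗ (con 1 ⊕ x₁)

sameSetBound : Poly
sameSetBound = con 100 ⊗ (con 1 ⊕ x₀) ⊗ (con 1 ⊕ x₁)

module _ {A : Set} {{c : Code A}} where

  infix 4 _≟_ _⊆?_ _≋?_

  -- Injective codes carry the decision on trees over to data, and `does` stays that of the codes.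
  -- The answers of the programs and of the decision procedures thus agree by computation.
  _≟_ : DecidableEquality A
  x ≟ y = Dec.map′ (Code.injective c) (cong encode) (encode x ≟ᵀ encode y)

  open DecMembership _≟_ public using (_∈?_)

  _⊆?_ : (l m : List A) → Dec (All (_∈ m) l)
  l ⊆? m = all? (_∈? m) l

  _≋?_ : (l m : List A) → Dec (All (_∈ m) l × All (_∈ l) m)
  l ≋? m = (l ⊆? m) ×-dec (m ⊆? l)

  member-run : ∀ x l → member · encode x ∷ encode l ∷ [] ↓ encode (does (x ∈? l))
                 ⟨ memberBound ∣ ∥ x ∥ ∷ ∥ l ∥ ∷ [] ⟩
  member-run x [] = finish (∥ x ∥ ∷ []) (x₀ ∷ con 1 ∷ [])
    (↓case-nil ↓var (↓quote (encode false))) refl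
  member-run x (y ∷ l) =
    finish (∥ x ∥ ∷ ∥ y ∥ ∷ ∥ l ∥ ∷ []) (x₀ ∷ con 1 ⊕ x₁ ⊕ x₂ ∷ [])
      (↓case-cons ↓var
        (↓if (λ β → encode (β ∨ does (x ∈? l))) (does (x ≟ y))
          (con 3 ⊕ x₂ ⊗ (con 20 ⊕ con 12 ⊗ x₀))
          (↓call (x₀ ∷ []) (↓var ↓∷ ↓var ↓∷ ↓[]) (equal-run (encode x) (encode y)))
          (↓quote (encode true)) refl
          (↓self (x₀ ∷ x₂ ∷ []) (↓var ↓∷ ↓var ↓∷ ↓[]) (member-run x l)) refl))
      refl

  subset-run : ∀ l m → subset · encode l ∷ encode m ∷ [] ↓ encode (does (l ⊆? m))
                 ⟨ subsetBound ∣ ∥ l ∥ ∷ ∥ m ∥ ∷ [] ⟩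
  subset-run [] m = finish (∥ m ∥ ∷ []) (con 1 ∷ x₀ ∷ [])
    (↓case-nil ↓var (↓quote (encode true))) refl
  subset-run (x ∷ l) m =
    finish (∥ x ∥ ∷ ∥ l ∥ ∷ ∥ m ∥ ∷ []) (con 1 ⊕ x₀ ⊕ x₁ ∷ x₂ ∷ [])
      (↓case-cons ↓var
        (↓if (λ β → encode (β ∧ does (l ⊆? m))) (does (x ∈? m))
          (con 3 ⊕ con 40 ⊗ x₁ ⊗ (con 1 ⊕ x₂))
          (↓call (x₀ ∷ x₂ ∷ []) (↓var ↓∷ ↓var ↓∷ ↓[]) (member-run x m))
          (↓self (x₁ ∷ x₂ ∷ []) (↓var ↓∷ ↓var ↓∷ ↓[]) (subset-run l m)) refl
          (↓quote (encode false)) refl))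
      refl

  sameSet-run : ∀ l m → sameSet · encode l ∷ encode m ∷ [] ↓ encode (does (l ≋? m))
                  ⟨ sameSetBound ∣ ∥ l ∥ ∷ ∥ m ∥ ∷ [] ⟩
  sameSet-run l m =
    finish (∥ l ∥ ∷ ∥ m ∥ ∷ []) (x₀ ∷ x₁ ∷ [])
      (↓if (λ β → encode (β ∧ does (m ⊆? l))) (does (l ⊆? m))
        (con 4 ⊕ con 40 ⊗ x₁ ⊗ (con 1 ⊕ x₀))
        (↓call (x₀ ∷ x₁ ∷ []) (↓var ↓∷ ↓var ↓∷ ↓[]) (subset-run l m))
        (↓call (x₁ ∷ x₀ ∷ []) (↓var ↓∷ ↓var ↓∷ ↓[]) (subset-run m l)) refl
        (↓quote (encode false)) refl)
      refl

-- Concepts and ontologies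

module _ {N K : Set} where

  abstractᶜ : Concept N K → Concept (N ⊎ K) ⊥
  abstractᶜ ⊤ᶜ       = ⊤ᶜ
  abstractᶜ ⊥ᶜ       = ⊥ᶜ
  abstractᶜ (nm A)   = nm (inj₁ A)
  abstractᶜ [ α ]    = nm (inj₂ α)
  abstractᶜ (C ⊓ D)  = abstractᶜ C ⊓ abstractᶜ D
  abstractᶜ (∃ᶜ r C) = ∃ᶜ r (abstractᶜ C)

  concretise : Concept (N ⊎ K) ⊥ → Concept N K
  concretise ⊤ᶜ            = ⊤ᶜ
  concretise ⊥ᶜ            = ⊥ᶜ
  concretise (nm (inj₁ A)) = nm A
  concretise (nm (inj₂ α)) = [ α ]
  concretise (C ⊓ D)       = concretise C ⊓ concretise D
  concretise (∃ᶜ r C)      = ∃ᶜ r (concretise C)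

  abstractᴳ : GCI N K → GCI (N ⊎ K) ⊥
  abstractᴳ (C ⊑ D) = abstractᶜ C ⊑ abstractᶜ D

  conj : List K → Concept (N ⊎ K) ⊥
  conj []             = ⊤ᶜ
  conj (α ∷ [])       = nm (inj₂ α)
  conj (α ∷ αs@(_ ∷ _)) = nm (inj₂ α) ⊓ conj αs

-- The factor 1000 is a safe margin over the constant work done at each node of a code.
linearBound : Poly
linearBound = con 1000 ⊗ x₀

module _ {N K : Set} {{cN : Code N}} {{cK : Code K}} where

  abstractConcept-run : ∀ (C : Concept N K) →
    abstractConcept · encode C ∷ [] ↓ encode (abstractᶜ C) ⟨ linearBound ∣ ∥ C ∥ ∷ [] ⟩
  abstractConcept-run ⊤ᶜ = finish [] (con 3 ∷ [])
    (↓case-cons ↓var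
      (↓else (↓is tag⊤ tagName ↓var) (↓else (↓is tag⊤ tagConstraint ↓var)
      (↓else (↓is tag⊤ tag⊓ ↓var) (↓else (↓is tag⊤ tag∃ ↓var) ↓var))))) refl
  abstractConcept-run ⊥ᶜ = finish [] (con 5 ∷ [])
    (↓case-cons ↓var
      (↓else (↓is tag⊥ tagName ↓var) (↓else (↓is tag⊥ tagConstraint ↓var)
      (↓else (↓is tag⊥ tag⊓ ↓var) (↓else (↓is tag⊥ tag∃ ↓var) ↓var))))) refl
  abstractConcept-run (nm A) = finish (∥ A ∥ ∷ []) ((con 6 ⊕ x₀) ∷ [])
    (↓case-cons ↓var
      (↓then (↓is tagName tagName ↓var) (↓cons (↓quote tagName) (↓cons (↓quote tag₁) ↓var)))) refl
  abstractConcept-run [ α ] = finish (∥ α ∥ ∷ []) ((con 8 ⊕ x₀) ∷ [])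
    (↓case-cons ↓var
      (↓else (↓is tagConstraint tagName ↓var) (↓then (↓is tagConstraint tagConstraint ↓var)
        (↓cons (↓quote tagName) (↓cons (↓quote tag₂) ↓var))))) refl
  abstractConcept-run (C ⊓ D) = finish (∥ C ∥ ∷ ∥ D ∥ ∷ []) ((con 10 ⊕ (con 1 ⊕ x₀ ⊕ x₁)) ∷ [])
    (↓case-cons ↓var
      (↓else (↓is tag⊓ tagName ↓var) (↓else (↓is tag⊓ tagConstraint ↓var)
      (↓then (↓is tag⊓ tag⊓ ↓var) (↓case-cons ↓var (↓cons (↓quote tag⊓) (↓cons
        (↓self (x₀ ∷ []) (↓var ↓∷ ↓[]) (abstractConcept-run C))
        (↓self (x₁ ∷ []) (↓var ↓∷ ↓[]) (abstractConcept-run D))))))))) refl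
  abstractConcept-run (∃ᶜ r C) = finish (∥ r ∥ ∷ ∥ C ∥ ∷ []) ((con 12 ⊕ (con 1 ⊕ x₀ ⊕ x₁)) ∷ [])
    (↓case-cons ↓var
      (↓else (↓is tag∃ tagName ↓var) (↓else (↓is tag∃ tagConstraint ↓var)
      (↓else (↓is tag∃ tag⊓ ↓var) (↓then (↓is tag∃ tag∃ ↓var)
        (↓case-cons ↓var (↓cons (↓quote tag∃) (↓cons ↓var
          (↓self (x₁ ∷ []) (↓var ↓∷ ↓[]) (abstractConcept-run C)))))))))) refl

  concretiseConcept-run : ∀ (C : Concept (N ⊎ K) ⊥) →
    concretiseConcept · encode C ∷ [] ↓ encode (concretise C) ⟨ linearBound ∣ ∥ C ∥ ∷ [] ⟩
  concretiseConcept-run ⊤ᶜ = finish [] (con 3 ∷ [])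
    (↓case-cons ↓var
      (↓else (↓is tag⊤ tagName ↓var)
      (↓else (↓is tag⊤ tag⊓ ↓var) (↓else (↓is tag⊤ tag∃ ↓var) ↓var)))) refl
  concretiseConcept-run ⊥ᶜ = finish [] (con 5 ∷ [])
    (↓case-cons ↓var
      (↓else (↓is tag⊥ tagName ↓var)
      (↓else (↓is tag⊥ tag⊓ ↓var) (↓else (↓is tag⊥ tag∃ ↓var) ↓var)))) refl
  concretiseConcept-run (nm (inj₁ A)) = finish (∥ A ∥ ∷ []) ((con 6 ⊕ (con 2 ⊕ x₀)) ∷ [])
    (↓case-cons ↓var
      (↓then (↓is tagName tagName ↓var) (↓case-cons ↓var
        (↓else (↓is tag₁ tag₂ ↓var) (↓cons (↓quote tagName) ↓var))))) refl
  concretiseConcept-run (nm (inj₂ α)) = finish (∥ α ∥ ∷ []) ((con 6 ⊕ (con 4 ⊕ x₀)) ∷ [])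
    (↓case-cons ↓var
      (↓then (↓is tagName tagName ↓var) (↓case-cons ↓var
        (↓then (↓is tag₂ tag₂ ↓var) (↓cons (↓quote tagConstraint) ↓var))))) refl
  concretiseConcept-run (C ⊓ D) = finish (∥ C ∥ ∷ ∥ D ∥ ∷ []) ((con 10 ⊕ (con 1 ⊕ x₀ ⊕ x₁)) ∷ [])
    (↓case-cons ↓var
      (↓else (↓is tag⊓ tagName ↓var)
      (↓then (↓is tag⊓ tag⊓ ↓var) (↓case-cons ↓var (↓cons (↓quote tag⊓) (↓cons
        (↓self (x₀ ∷ []) (↓var ↓∷ ↓[]) (concretiseConcept-run C))
        (↓self (x₁ ∷ []) (↓var ↓∷ ↓[]) (concretiseConcept-run D)))))))) refl
  concretiseConcept-run (∃ᶜ r C) = finish (∥ r ∥ ∷ ∥ C ∥ ∷ []) ((con 12 ⊕ (con 1 ⊕ x₀ ⊕ x₁)) ∷ [])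
    (↓case-cons ↓var
      (↓else (↓is tag∃ tagName ↓var)
      (↓else (↓is tag∃ tag⊓ ↓var) (↓then (↓is tag∃ tag∃ ↓var)
        (↓case-cons ↓var (↓cons (↓quote tag∃) (↓cons ↓var
          (↓self (x₁ ∷ []) (↓var ↓∷ ↓[]) (concretiseConcept-run C))))))))) refl

module _ {A B : Set} {{_ : Code A}} {{_ : Code B}} {g : Fun 1} {h : A → B}
         (g-run : ∀ a → g · encode a ∷ [] ↓ encode (h a) ⟨ linearBound ∣ ∥ a ∥ ∷ [] ⟩) where

  mapPairs-run : ∀ (l : List (A × A)) →
    mapPairs g · encode l ∷ [] ↓ encode (map (Product.map h h) l) ⟨ linearBound ∣ ∥ l ∥ ∷ [] ⟩
  mapPairs-run [] = finish [] (con 1 ∷ []) (↓case-nil ↓var ↓nil) refl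
  mapPairs-run ((a , b) ∷ l) =
    finish (∥ a ∥ ∷ ∥ b ∥ ∷ ∥ l ∥ ∷ []) ((con 1 ⊕ (con 1 ⊕ x₀ ⊕ x₁) ⊕ x₂) ∷ [])
      (↓case-cons ↓var (↓case-cons ↓var (↓cons
        (↓cons (↓call (x₀ ∷ []) (↓var ↓∷ ↓[]) (g-run a))
               (↓call (x₁ ∷ []) (↓var ↓∷ ↓[]) (g-run b)))
        (↓self (x₂ ∷ []) (↓var ↓∷ ↓[]) (mapPairs-run l))))) refl

sides : ∀ {N K} → GCI N K → Concept N K × Concept N K
sides (C ⊑ D) = C , D

-- An axiom and the pair of its sides have the same code, so the program for lists of pairs also
-- serves for ontologies.
encode-sides : ∀ {N K} {{_ : Code N}} {{_ : Code K}} (O : Ontology N K) →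
               encode (map sides O) ≡ encode O
encode-sides []            = refl
encode-sides ((C ⊑ D) ∷ O) = cong ((encode C ∙ encode D) ∙_) (encode-sides O)

module _ {N K : Set} {{cN : Code N}} {{cK : Code K}} where

  encode-abstractᴼ : ∀ (O : Ontology N K) →
    encode (map (Product.map abstractᶜ abstractᶜ) (map sides O)) ≡ encode (map abstractᴳ O)
  encode-abstractᴼ []            = refl
  encode-abstractᴼ ((C ⊑ D) ∷ O) =
    cong ((encode (abstractᶜ C) ∙ encode (abstractᶜ D)) ∙_) (encode-abstractᴼ O)

  abstractOntology-run : ∀ (O : Ontology N K) →
    abstractOntology · encode O ∷ [] ↓ encode (map abstractᴳ O) ⟨ linearBound ∣ ∥ O ∥ ∷ [] ⟩
  abstractOntology-run O =
    subst₂ (λ x y → abstractOntology · x ∷ [] ↓ y ⟨ linearBound ∣ size x ∷ [] ⟩)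
      (encode-sides O) (encode-abstractᴼ O)
      (mapPairs-run {A = Concept N K} {B = Concept (N ⊎ K) ⊥} {g = abstractConcept} {h = abstractᶜ}
        abstractConcept-run (map sides O))

  concretisePairs-run : ∀ (L : List (Concept (N ⊎ K) ⊥ × Concept (N ⊎ K) ⊥)) →
    concretisePairs · encode L ∷ [] ↓ encode (map (Product.map concretise concretise) L)
      ⟨ linearBound ∣ ∥ L ∥ ∷ [] ⟩
  concretisePairs-run = mapPairs-run
    {A = Concept (N ⊎ K) ⊥} {B = Concept N K} {g = concretiseConcept} {h = concretise}
    concretiseConcept-run

  abstractᶜ-size : ∀ (C : Concept N K) → ∥ abstractᶜ C ∥ ≤ 2 * ∥ C ∥
  abstractᶜ-size ⊤ᶜ       = ℕ.m≤m+n 3 3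
  abstractᶜ-size ⊥ᶜ       = ℕ.m≤m+n 5 5
  abstractᶜ-size (nm A)   =
    ≤ᵖ-sound (∥ A ∥ ∷ []) (con 6 ⊕ (con 2 ⊕ x₀)) (con 2 ⊗ (con 6 ⊕ x₀)) refl
  abstractᶜ-size [ α ]    =
    ≤ᵖ-sound (∥ α ∥ ∷ []) (con 6 ⊕ (con 4 ⊕ x₀)) (con 2 ⊗ (con 8 ⊕ x₀)) refl
  abstractᶜ-size (C ⊓ D)  = ℕ.≤-trans
    (ℕ.+-monoʳ-≤ 11 (ℕ.+-mono-≤ (abstractᶜ-size C) (abstractᶜ-size D)))
    (≤ᵖ-sound (∥ C ∥ ∷ ∥ D ∥ ∷ []) (con 11 ⊕ (con 2 ⊗ x₀ ⊕ con 2 ⊗ x₁))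
      (con 2 ⊗ (con 11 ⊕ (x₀ ⊕ x₁))) refl)
  abstractᶜ-size (∃ᶜ r C) = ℕ.≤-trans
    (ℕ.+-monoʳ-≤ 13 (ℕ.+-monoʳ-≤ ∥ r ∥ (abstractᶜ-size C)))
    (≤ᵖ-sound (∥ r ∥ ∷ ∥ C ∥ ∷ []) (con 13 ⊕ (x₀ ⊕ con 2 ⊗ x₁))
      (con 2 ⊗ (con 13 ⊕ (x₀ ⊕ x₁))) refl)

  abstractᴼ-size : ∀ (O : Ontology N K) → ∥ map abstractᴳ O ∥ ≤ 2 * ∥ O ∥
  abstractᴼ-size []            = s≤s z≤n
  abstractᴼ-size ((C ⊑ D) ∷ O) = ℕ.≤-trans
    (s≤s (ℕ.+-mono-≤ (s≤s (ℕ.+-mono-≤ (abstractᶜ-size C) (abstractᶜ-size D))) (abstractᴼ-size O)))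
    (≤ᵖ-sound (∥ C ∥ ∷ ∥ D ∥ ∷ ∥ O ∥ ∷ [])
      (con 2 ⊕ (con 2 ⊗ x₀ ⊕ con 2 ⊗ x₁ ⊕ con 2 ⊗ x₂)) (con 2 ⊗ (con 2 ⊕ (x₀ ⊕ x₁ ⊕ x₂))) refl)

-- Each constraint in the concept causes a membership test against an accumulator that may have
-- grown by the size of the concept, which accounts for the last factor.
accBound : Poly
accBound = con 1000 ⊗ x₀ ⊗ (con 1 ⊕ x₀ ⊕ x₁)

collectBound : Poly
collectBound = con 1000 ⊗ x₀ ⊗ (con 1 ⊕ x₀) ⊗ (con 1 ⊕ x₀)

-- A concept of size n has at most n subconcepts, each of size at most n and in a list cell of its
-- own. The function is superadditive, so bounds for the parts add up to the bound for the whole.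
quadratic : ℕ → ℕ
quadratic n = n * (1 + n)

module _ {N K : Set} {{cN : Code N}} {{cK : Code K}} where

  -- The accumulator is passed along and shared, never traversed, so its size does not enter the
  -- bound.
  subconcepts-run : ∀ (C : Concept N K) acc →
    subconcepts · encode C ∷ encode acc ∷ [] ↓ encode (sub C ++ acc) ⟨ linearBound ∣ ∥ C ∥ ∷ [] ⟩
  subconcepts-run ⊤ᶜ acc = finish [] (con 3 ∷ [])
    (↓cons ↓var (↓case-cons ↓var
      (↓else (↓is tag⊤ tag⊓ ↓var) (↓else (↓is tag⊤ tag∃ ↓var) ↓var)))) refl
  subconcepts-run ⊥ᶜ acc = finish [] (con 5 ∷ [])
    (↓cons ↓var (↓case-cons ↓var
      (↓else (↓is tag⊥ tag⊓ ↓var) (↓else (↓is tag⊥ tag∃ ↓var) ↓var)))) refl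
  subconcepts-run (nm A) acc = finish (∥ A ∥ ∷ []) (con 6 ⊕ x₀ ∷ [])
    (↓cons ↓var (↓case-cons ↓var
      (↓else (↓is tagName tag⊓ ↓var) (↓else (↓is tagName tag∃ ↓var) ↓var)))) refl
  subconcepts-run [ α ] acc = finish (∥ α ∥ ∷ []) (con 8 ⊕ x₀ ∷ [])
    (↓cons ↓var (↓case-cons ↓var
      (↓else (↓is tagConstraint tag⊓ ↓var) (↓else (↓is tagConstraint tag∃ ↓var) ↓var)))) refl
  subconcepts-run (C ⊓ D) acc rewrite List.++-assoc (sub C) (sub D) acc =
    finish (∥ C ∥ ∷ ∥ D ∥ ∷ []) (con 11 ⊕ (x₀ ⊕ x₁) ∷ [])
      (↓cons ↓var (↓case-cons ↓var
        (↓then (↓is tag⊓ tag⊓ ↓var) (↓case-cons ↓var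
          (↓self (x₀ ∷ [])
            (↓var ↓∷
             ↓self (x₁ ∷ []) (↓var ↓∷ ↓var ↓∷ ↓[]) (subconcepts-run D acc) ↓∷ ↓[])
            (subconcepts-run C (sub D ++ acc))))))) refl
  subconcepts-run (∃ᶜ r C) acc = finish (∥ r ∥ ∷ ∥ C ∥ ∷ []) (con 13 ⊕ (x₀ ⊕ x₁) ∷ [])
    (↓cons ↓var (↓case-cons ↓var
      (↓else (↓is tag∃ tag⊓ ↓var) (↓then (↓is tag∃ tag∃ ↓var) (↓case-cons ↓var
        (↓self (x₁ ∷ []) (↓var ↓∷ ↓var ↓∷ ↓[]) (subconcepts-run C acc))))))) refl

  subconcepts-run′ : ∀ (C : Concept N K) acc →
    subconcepts · encode C ∷ encode acc ∷ [] ↓ encode (sub C ++ acc)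
      ⟨ accBound ∣ ∥ C ∥ ∷ ∥ acc ∥ ∷ [] ⟩
  subconcepts-run′ C acc =
    rebound (∥ C ∥ ∷ ∥ acc ∥ ∷ []) (x₀ ∷ []) (x₀ ∷ x₁ ∷ []) (subconcepts-run C acc) refl

  sub-size : ∀ (C : Concept N K) acc → ∥ sub C ++ acc ∥ ≤ quadratic ∥ C ∥ + ∥ acc ∥
  sub-size ⊤ᶜ acc       = ℕ.+-monoˡ-≤ ∥ acc ∥ (ℕ.m≤m+n 4 8)
  sub-size ⊥ᶜ acc       = ℕ.+-monoˡ-≤ ∥ acc ∥ (ℕ.m≤m+n 6 24)
  sub-size (nm A) acc   = ≤ᵖ-sound (∥ A ∥ ∷ ∥ acc ∥ ∷ [])
    (con 1 ⊕ (con 6 ⊕ x₀) ⊕ x₁) ((con 6 ⊕ x₀) ⊗ (con 1 ⊕ (con 6 ⊕ x₀)) ⊕ x₁) refl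
  sub-size [ α ] acc    = ≤ᵖ-sound (∥ α ∥ ∷ ∥ acc ∥ ∷ [])
    (con 1 ⊕ (con 8 ⊕ x₀) ⊕ x₁) ((con 8 ⊕ x₀) ⊗ (con 1 ⊕ (con 8 ⊕ x₀)) ⊕ x₁) refl
  sub-size (C ⊓ D) acc rewrite List.++-assoc (sub C) (sub D) acc = ℕ.≤-trans
    (ℕ.+-monoʳ-≤ (1 + ∥ C ⊓ D ∥)
      (ℕ.≤-trans (sub-size C (sub D ++ acc)) (ℕ.+-monoʳ-≤ (quadratic ∥ C ∥) (sub-size D acc))))
    (≤ᵖ-sound (∥ C ∥ ∷ ∥ D ∥ ∷ ∥ acc ∥ ∷ [])
      (con 1 ⊕ (con 11 ⊕ (x₀ ⊕ x₁)) ⊕ (x₀ ⊗ (con 1 ⊕ x₀) ⊕ (x₁ ⊗ (con 1 ⊕ x₁) ⊕ x₂)))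
      ((con 11 ⊕ (x₀ ⊕ x₁)) ⊗ (con 1 ⊕ (con 11 ⊕ (x₀ ⊕ x₁))) ⊕ x₂) refl)
  sub-size (∃ᶜ r C) acc = ℕ.≤-trans
    (ℕ.+-monoʳ-≤ (1 + ∥ ∃ᶜ r C ∥) (sub-size C acc))
    (≤ᵖ-sound (∥ r ∥ ∷ ∥ C ∥ ∷ ∥ acc ∥ ∷ [])
      (con 1 ⊕ (con 13 ⊕ (x₀ ⊕ x₁)) ⊕ (x₁ ⊗ (con 1 ⊕ x₁) ⊕ x₂))
      ((con 13 ⊕ (x₀ ⊕ x₁)) ⊗ (con 1 ⊕ (con 13 ⊕ (x₀ ⊕ x₁))) ⊕ x₂) refl)

  constraintsᶜ : Concept N K → List K → List K
  constraintsᶜ ⊤ᶜ       acc = acc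
  constraintsᶜ ⊥ᶜ       acc = acc
  constraintsᶜ (nm A)   acc = acc
  constraintsᶜ [ α ]    acc = ifᵇ does (α ∈? acc) then acc else (α ∷ acc)
  constraintsᶜ (C ⊓ D)  acc = constraintsᶜ C (constraintsᶜ D acc)
  constraintsᶜ (∃ᶜ r C) acc = constraintsᶜ C acc

  constraintsᶜ-size : ∀ (C : Concept N K) acc → ∥ constraintsᶜ C acc ∥ ≤ ∥ C ∥ + ∥ acc ∥
  constraintsᶜ-size ⊤ᶜ       acc = ℕ.m≤n+m ∥ acc ∥ 3
  constraintsᶜ-size ⊥ᶜ       acc = ℕ.m≤n+m ∥ acc ∥ 5
  constraintsᶜ-size (nm A)   acc = ℕ.m≤n+m ∥ acc ∥ (6 + ∥ A ∥)
  constraintsᶜ-size [ α ]    acc with does (α ∈? acc)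
  ... | true  = ℕ.m≤n+m ∥ acc ∥ (8 + ∥ α ∥)
  ... | false = ℕ.+-monoˡ-≤ ∥ acc ∥ (ℕ.+-monoˡ-≤ ∥ α ∥ (ℕ.m≤m+n 1 7))
  constraintsᶜ-size (C ⊓ D)  acc = ℕ.≤-trans
    (ℕ.≤-trans (constraintsᶜ-size C (constraintsᶜ D acc))
               (ℕ.+-monoʳ-≤ ∥ C ∥ (constraintsᶜ-size D acc)))
    (≤ᵖ-sound (∥ C ∥ ∷ ∥ D ∥ ∷ ∥ acc ∥ ∷ [])
      (x₀ ⊕ (x₁ ⊕ x₂)) (con 11 ⊕ (x₀ ⊕ x₁) ⊕ x₂) refl)
  constraintsᶜ-size (∃ᶜ r C) acc = ℕ.≤-trans (constraintsᶜ-size C acc)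
    (≤ᵖ-sound (∥ r ∥ ∷ ∥ C ∥ ∷ ∥ acc ∥ ∷ []) (x₁ ⊕ x₂) (con 13 ⊕ (x₀ ⊕ x₁) ⊕ x₂) refl)

  constraintsᶜ-run : ∀ (C : Concept N K) acc →
    constraintsOfConcept · encode C ∷ encode acc ∷ [] ↓ encode (constraintsᶜ C acc)
      ⟨ accBound ∣ ∥ C ∥ ∷ ∥ acc ∥ ∷ [] ⟩
  constraintsᶜ-run ⊤ᶜ acc = finish (∥ acc ∥ ∷ []) (con 3 ∷ x₀ ∷ [])
    (↓case-cons ↓var
      (↓else (↓is tag⊤ tagConstraint ↓var)
      (↓else (↓is tag⊤ tag⊓ ↓var) (↓else (↓is tag⊤ tag∃ ↓var) ↓var)))) refl
  constraintsᶜ-run ⊥ᶜ acc = finish (∥ acc ∥ ∷ []) (con 5 ∷ x₀ ∷ [])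
    (↓case-cons ↓var
      (↓else (↓is tag⊥ tagConstraint ↓var)
      (↓else (↓is tag⊥ tag⊓ ↓var) (↓else (↓is tag⊥ tag∃ ↓var) ↓var)))) refl
  constraintsᶜ-run (nm A) acc = finish (∥ A ∥ ∷ ∥ acc ∥ ∷ []) (con 6 ⊕ x₀ ∷ x₁ ∷ [])
    (↓case-cons ↓var
      (↓else (↓is tagName tagConstraint ↓var)
      (↓else (↓is tagName tag⊓ ↓var) (↓else (↓is tagName tag∃ ↓var) ↓var)))) refl
  constraintsᶜ-run [ α ] acc = finish (∥ α ∥ ∷ ∥ acc ∥ ∷ []) (con 8 ⊕ x₀ ∷ x₁ ∷ [])
    (↓case-cons ↓var
      (↓then (↓is tagConstraint tagConstraint ↓var)
        (↓if (λ β → encode (ifᵇ β then acc else (α ∷ acc))) (does (α ∈? acc)) (con 3)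
          (↓call (x₀ ∷ x₁ ∷ []) (↓var ↓∷ ↓var ↓∷ ↓[]) (member-run α acc))
          ↓var refl
          (↓cons ↓var ↓var) refl))) refl
  constraintsᶜ-run (C ⊓ D) acc =
    finish (∥ C ∥ ∷ ∥ D ∥ ∷ ∥ acc ∥ ∷ []) (con 11 ⊕ (x₀ ⊕ x₁) ∷ x₂ ∷ [])
      (↓case-cons ↓var
        (↓else (↓is tag⊓ tagConstraint ↓var)
        (↓then (↓is tag⊓ tag⊓ ↓var) (↓case-cons ↓var
          -- The accumulator left by `D` has grown by at most the size of `D`, which bounds the
          -- second argument of the call for `C`.
          (↓self≤ (x₀ ∷ x₁ ⊕ x₂ ∷ []) (ℕ.≤-refl ∷ constraintsᶜ-size D acc ∷ [])
            (↓var ↓∷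
             ↓self (x₁ ∷ x₂ ∷ []) (↓var ↓∷ ↓var ↓∷ ↓[]) (constraintsᶜ-run D acc) ↓∷ ↓[])
            (constraintsᶜ-run C (constraintsᶜ D acc))))))) refl
  constraintsᶜ-run (∃ᶜ r C) acc =
    finish (∥ r ∥ ∷ ∥ C ∥ ∷ ∥ acc ∥ ∷ []) (con 13 ⊕ (x₀ ⊕ x₁) ∷ x₂ ∷ [])
      (↓case-cons ↓var
        (↓else (↓is tag∃ tagConstraint ↓var)
        (↓else (↓is tag∃ tag⊓ ↓var) (↓then (↓is tag∃ tag∃ ↓var) (↓case-cons ↓var
          (↓self (x₁ ∷ x₂ ∷ []) (↓var ↓∷ ↓var ↓∷ ↓[]) (constraintsᶜ-run C acc))))))) refl

  collectᴼ : ∀ {B : Set} → (Concept N K → List B → List B) → Ontology N K → List B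
  collectᴼ h []            = []
  collectᴼ h ((C ⊑ D) ∷ O) = h C (h D (collectᴼ h O))

  module _ {B : Set} {{cB : Code B}} {g : Fun 2} {h : Concept N K → List B → List B}
           (g-run : ∀ C acc → g · encode C ∷ encode acc ∷ [] ↓ encode (h C acc)
                                ⟨ accBound ∣ ∥ C ∥ ∷ ∥ acc ∥ ∷ [] ⟩)
           (h-size : ∀ C acc → ∥ h C acc ∥ ≤ quadratic ∥ C ∥ + ∥ acc ∥) where

    collect-size : ∀ O → ∥ collectᴼ h O ∥ ≤ quadratic ∥ O ∥
    collect-size []            = s≤s z≤n
    collect-size ((C ⊑ D) ∷ O) = ℕ.≤-trans
      (ℕ.≤-trans (h-size C _) (ℕ.+-monoʳ-≤ (quadratic ∥ C ∥)
        (ℕ.≤-trans (h-size D _) (ℕ.+-monoʳ-≤ (quadratic ∥ D ∥) (collect-size O)))))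
      (≤ᵖ-sound (∥ C ∥ ∷ ∥ D ∥ ∷ ∥ O ∥ ∷ [])
        (x₀ ⊗ (con 1 ⊕ x₀) ⊕ (x₁ ⊗ (con 1 ⊕ x₁) ⊕ x₂ ⊗ (con 1 ⊕ x₂)))
        ((con 2 ⊕ (x₀ ⊕ x₁ ⊕ x₂)) ⊗ (con 3 ⊕ (x₀ ⊕ x₁ ⊕ x₂))) refl)

    collect-run : ∀ O → collect g · encode O ∷ [] ↓ encode (collectᴼ h O) ⟨ collectBound ∣ ∥ O ∥ ∷ [] ⟩
    collect-run [] = finish [] (con 1 ∷ []) (↓case-nil ↓var ↓nil) refl
    collect-run ((C ⊑ D) ∷ O) =
      finish (∥ C ∥ ∷ ∥ D ∥ ∷ ∥ O ∥ ∷ []) (con 1 ⊕ (con 1 ⊕ x₀ ⊕ x₁) ⊕ x₂ ∷ [])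
        (↓case-cons ↓var (↓case-cons ↓var
          (↓call≤ (x₀ ∷ x₁ ⊗ (con 1 ⊕ x₁) ⊕ x₂ ⊗ (con 1 ⊕ x₂) ∷ [])
            (ℕ.≤-refl ∷ ℕ.≤-trans (h-size D _) (ℕ.+-monoʳ-≤ (quadratic ∥ D ∥) (collect-size O)) ∷ [])
            (↓var ↓∷
             ↓call≤ (x₁ ∷ x₂ ⊗ (con 1 ⊕ x₂) ∷ []) (ℕ.≤-refl ∷ collect-size O ∷ [])
               (↓var ↓∷ ↓self (x₂ ∷ []) (↓var ↓∷ ↓[]) (collect-run O) ↓∷ ↓[])
               (g-run D (collectᴼ h O)) ↓∷ ↓[])
            (g-run C (h D (collectᴼ h O)))))) refl

  subᴼ-collect : ∀ (O : Ontology N K) → collectᴼ (λ C acc → sub C ++ acc) O ≡ subᴼ O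
  subᴼ-collect []            = refl
  subᴼ-collect ((C ⊑ D) ∷ O) =
    trans (sym (List.++-assoc (sub C) (sub D) _)) (cong ((sub C ++ sub D) ++_) (subᴼ-collect O))

  subOntology-run : ∀ (O : Ontology N K) →
    subOntology · encode O ∷ [] ↓ encode (subᴼ O) ⟨ collectBound ∣ ∥ O ∥ ∷ [] ⟩
  subOntology-run O =
    subst (λ l → subOntology · encode O ∷ [] ↓ encode l ⟨ collectBound ∣ ∥ O ∥ ∷ [] ⟩)
      (subᴼ-collect O) (collect-run subconcepts-run′ sub-size O)

  subᴼ-size : ∀ (O : Ontology N K) → ∥ subᴼ O ∥ ≤ quadratic ∥ O ∥
  subᴼ-size O = subst (λ l → ∥ l ∥ ≤ quadratic ∥ O ∥) (subᴼ-collect O)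
    (collect-size subconcepts-run′ sub-size O)

  constraintsᴼ : Ontology N K → List K
  constraintsᴼ = collectᴼ constraintsᶜ

  constraintsᶜ-size′ : ∀ (C : Concept N K) acc →
    ∥ constraintsᶜ C acc ∥ ≤ quadratic ∥ C ∥ + ∥ acc ∥
  constraintsᶜ-size′ C acc = ℕ.≤-trans (constraintsᶜ-size C acc)
    (ℕ.+-monoˡ-≤ ∥ acc ∥ (ℕ.m≤m*n ∥ C ∥ (1 + ∥ C ∥)))

  constraints-run : ∀ (O : Ontology N K) →
    constraints · encode O ∷ [] ↓ encode (constraintsᴼ O) ⟨ collectBound ∣ ∥ O ∥ ∷ [] ⟩
  constraints-run = collect-run constraintsᶜ-run constraintsᶜ-size′

  constraintsᴼ-size : ∀ (O : Ontology N K) → ∥ constraintsᴼ O ∥ ≤ quadratic ∥ O ∥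
  constraintsᴼ-size = collect-size constraintsᶜ-run constraintsᶜ-size′

↓abstractName : ∀ {σ k n} {f : Fun k} {ρ : Vec Tree n} {e x p} → σ ∣ f , ρ ⊢ e ↓ x ⟨ p ⟩ →
  σ ∣ f , ρ ⊢ abstractName e ↓ tagName ∙ (tag₂ ∙ x) ⟨ con 1 ⊕ con 5 ⊕ (con 1 ⊕ con 3 ⊕ p) ⟩
↓abstractName r = ↓cons (↓quote tagName) (↓cons (↓quote tag₂) r)

selectBound : Poly
selectBound = con 400 ⊗ x₁ ⊗ (con 1 ⊕ x₂) ⊗ (con 1 ⊕ x₀)

module _ {N K : Set} {{cN : Code N}} {{cK : Code K}} where

  private
    Conceptᴬ : Set
    Conceptᴬ = Concept (N ⊎ K) ⊥

    A⟨_⟩ : K → Conceptᴬ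
    A⟨ α ⟩ = nm (inj₂ α)

  conjunction-run : ∀ (αs : List K) →
    conjunction · encode αs ∷ [] ↓ encode (conj {N} αs) ⟨ linearBound ∣ ∥ αs ∥ ∷ [] ⟩
  conjunction-run [] = finish [] (con 1 ∷ [])
    (↓case-nil ↓var (↓cons (↓quote tag⊤) ↓nil)) refl
  conjunction-run (α ∷ []) = finish (∥ α ∥ ∷ []) (con 1 ⊕ x₀ ⊕ con 1 ∷ [])
    (↓case-cons ↓var (↓else ↓var (↓abstractName ↓var))) refl
  conjunction-run (α ∷ αs@(_ ∷ _)) = finish (∥ α ∥ ∷ ∥ αs ∥ ∷ []) (con 1 ⊕ x₀ ⊕ x₁ ∷ [])
    (↓case-cons ↓var (↓then ↓var (↓cons (↓quote tag⊓) (↓cons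
      (↓abstractName ↓var)
      (↓self (x₁ ∷ []) (↓var ↓∷ ↓[]) (conjunction-run αs)))))) refl

  -- A further conjunct adds 11 nodes for the conjunction and 10 for the name around the code of
  -- `α`, hence the factor 21.
  conj-size : ∀ (αs : List K) → ∥ conj {N} αs ∥ ≤ 21 * ∥ αs ∥
  conj-size []               = ℕ.m≤m+n 3 18
  conj-size (α ∷ [])         = ≤ᵖ-sound (∥ α ∥ ∷ [])
    (con 10 ⊕ x₀) (con 21 ⊗ (con 1 ⊕ x₀ ⊕ con 1)) refl
  conj-size (α ∷ αs@(_ ∷ _)) = ℕ.≤-trans
    (ℕ.+-monoʳ-≤ (21 + ∥ α ∥) (conj-size αs))
    (≤ᵖ-sound (∥ α ∥ ∷ ∥ αs ∥ ∷ []) (con 21 ⊕ x₀ ⊕ con 21 ⊗ x₁)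
      (con 21 ⊗ (con 1 ⊕ x₀ ⊕ x₁)) refl)

  select : Conceptᴬ → List K → List (Conceptᴬ × Conceptᴬ) → List K
  select C cs L = filter (λ α → (C , A⟨ α ⟩) ∈? L) cs

  -- Brings `filter` into the conditional form that `↓if` expects.
  select-∷ : ∀ C α cs L → select C (α ∷ cs) L ≡
    (ifᵇ does ((C , A⟨ α ⟩) ∈? L) then (α ∷ select C cs L) else select C cs L)
  select-∷ C α cs L with does ((C , A⟨ α ⟩) ∈? L)
  ... | true  = refl
  ... | false = refl

  select-size : ∀ C cs L → ∥ select C cs L ∥ ≤ ∥ cs ∥
  select-size C []       L = ℕ.≤-refl
  select-size C (α ∷ cs) L with does ((C , A⟨ α ⟩) ∈? L)
  ... | true  = s≤s (ℕ.+-monoʳ-≤ ∥ α ∥ (select-size C cs L))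
  ... | false = ℕ.≤-trans (select-size C cs L) (ℕ.m≤n+m ∥ cs ∥ (1 + ∥ α ∥))

  selectD-run : ∀ C cs L →
    selectD · encode C ∷ encode cs ∷ encode L ∷ [] ↓ encode (select C cs L)
      ⟨ selectBound ∣ ∥ C ∥ ∷ ∥ cs ∥ ∷ ∥ L ∥ ∷ [] ⟩
  selectD-run C [] L = finish (∥ C ∥ ∷ ∥ L ∥ ∷ []) (x₀ ∷ con 1 ∷ x₁ ∷ []) (↓case-nil ↓var ↓nil) refl
  selectD-run C (α ∷ cs) L rewrite select-∷ C α cs L =
    finish (∥ C ∥ ∷ ∥ α ∥ ∷ ∥ cs ∥ ∷ ∥ L ∥ ∷ []) (x₀ ∷ con 1 ⊕ x₁ ⊕ x₂ ∷ x₃ ∷ [])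
      (↓case-cons ↓var
        (↓if (λ β → encode (ifᵇ β then (α ∷ select C cs L) else select C cs L))
          (does ((C , A⟨ α ⟩) ∈? L))
          (con 20 ⊕ con 400 ⊗ x₂ ⊗ (con 1 ⊕ x₃) ⊗ (con 1 ⊕ x₀))
          (↓call (con 1 ⊕ x₀ ⊕ (con 10 ⊕ x₁) ∷ x₃ ∷ []) (↓cons ↓var (↓abstractName ↓var) ↓∷ ↓var ↓∷ ↓[])
            (member-run (C , A⟨ α ⟩) L))
          (↓cons ↓var (↓self (x₀ ∷ x₂ ∷ x₃ ∷ []) (↓var ↓∷ ↓var ↓∷ ↓var ↓∷ ↓[])
            (selectD-run C cs L))) refl
          (↓self (x₀ ∷ x₂ ∷ x₃ ∷ []) (↓var ↓∷ ↓var ↓∷ ↓var ↓∷ ↓[]) (selectD-run C cs L)) refl)) refl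

-- The passes of the loop

polyTime : ℕ → ℕ → ℕ → ℕ
polyTime c d n = c * n ^ d + c

polyTime-mono : ∀ c d {m n} → m ≤ n → polyTime c d m ≤ polyTime c d n
polyTime-mono c d m≤n = ℕ.+-monoˡ-≤ c (ℕ.*-monoʳ-≤ c (ℕ.^-monoˡ-≤ d m≤n))

module _ {N K : Set} {{cN : Code N}} {{cK : Code K}} where

  sub-size-∈ : ∀ (C : Concept N K) {D} → D ∈ sub C → ∥ D ∥ ≤ ∥ C ∥
  sub-size-∈ ⊤ᶜ       (here refl) = ℕ.≤-refl
  sub-size-∈ ⊥ᶜ       (here refl) = ℕ.≤-refl
  sub-size-∈ (nm A)   (here refl) = ℕ.≤-refl
  sub-size-∈ [ α ]    (here refl) = ℕ.≤-refl
  sub-size-∈ (C ⊓ D)  (here refl) = ℕ.≤-refl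
  sub-size-∈ (C ⊓ D)  (there i) with List.∈-++⁻ (sub C) i
  ... | inj₁ i = ℕ.≤-trans (sub-size-∈ C i)
    (≤ᵖ-sound (∥ C ∥ ∷ ∥ D ∥ ∷ []) x₀ (con 11 ⊕ (x₀ ⊕ x₁)) refl)
  ... | inj₂ i = ℕ.≤-trans (sub-size-∈ D i)
    (≤ᵖ-sound (∥ C ∥ ∷ ∥ D ∥ ∷ []) x₁ (con 11 ⊕ (x₀ ⊕ x₁)) refl)
  sub-size-∈ (∃ᶜ r C) (here refl) = ℕ.≤-refl
  sub-size-∈ (∃ᶜ r C) (there i)   = ℕ.≤-trans (sub-size-∈ C i)
    (≤ᵖ-sound (∥ r ∥ ∷ ∥ C ∥ ∷ []) x₁ (con 13 ⊕ (x₀ ⊕ x₁)) refl)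

  subᴼ-size-∈ : ∀ (O : Ontology N K) {D} → D ∈ subᴼ O → ∥ D ∥ ≤ ∥ O ∥
  subᴼ-size-∈ ((C ⊑ D) ∷ O) i with List.∈-++⁻ (sub C ++ sub D) i
  ... | inj₂ j = ℕ.≤-trans (subᴼ-size-∈ O j) (ℕ.m≤n+m ∥ O ∥ (2 + (∥ C ∥ + ∥ D ∥)))
  ... | inj₁ j with List.∈-++⁻ (sub C) j
  ... | inj₁ k = ℕ.≤-trans (sub-size-∈ C k)
    (≤ᵖ-sound (∥ C ∥ ∷ ∥ D ∥ ∷ ∥ O ∥ ∷ []) x₀ (con 2 ⊕ (x₀ ⊕ x₁ ⊕ x₂)) refl)
  ... | inj₂ k = ℕ.≤-trans (sub-size-∈ D k)
    (≤ᵖ-sound (∥ C ∥ ∷ ∥ D ∥ ∷ ∥ O ∥ ∷ []) x₁ (con 2 ⊕ (x₀ ⊕ x₁ ⊕ x₂)) refl)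

list-size : ∀ {A : Set} {{_ : Code A}} {b} (xs : List A) → All (λ x → ∥ x ∥ ≤ b) xs →
            ∥ xs ∥ ≤ 1 + length xs * (1 + b)
list-size []       []           = s≤s z≤n
list-size {b = b} (x ∷ xs) (x≤b ∷ xs≤b) = ℕ.≤-trans
  (s≤s (ℕ.+-mono-≤ x≤b (list-size xs xs≤b)))
  (≤ᵖ-sound (b ∷ length xs * (1 + b) ∷ []) (con 1 ⊕ x₀ ⊕ (con 1 ⊕ x₁)) (con 1 ⊕ (con 1 ⊕ x₀ ⊕ x₁)) refl)

-- Bounds for validity tests, classifications and one pass

module Run (𝒟 : ConcreteDomain) (adm : PAdmissible 𝒟) (cls : Classifier (Nameᴬ 𝒟)) where

  open PAdmissible adm
  open Classifier cls renaming (program to classifier; correct to classifies)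
  open Algorithm tester classifier (encode (⊥-constraint 𝒟))

  K : Set
  K = Constraint 𝒟

  Conceptᴬ : Set
  Conceptᴬ = Concept (Nameᴬ 𝒟) ⊥

  Ontologyᴬ : Set
  Ontologyᴬ = Ontology (Nameᴬ 𝒟) ⊥

  A⟨_⟩ : K → Conceptᴬ
  A⟨ α ⟩ = nm (inj₂ α)

  valid? : List K → K → Bool
  valid? γ α = proj₁ (proj₂ (proj₂ validity) (γ , List⁺.[ α ]))

  valid?-correct : ∀ γ α → DecidesValidity 𝒟 (γ , List⁺.[ α ]) (valid? γ α)
  valid?-correct γ α = proj₂ (proj₂ (proj₂ (proj₂ (proj₂ (proj₂ validity) (γ , List⁺.[ α ])))))

  validTime : ℕ → ℕ
  validTime = polyTime (proj₁ validity) (proj₁ (proj₂ validity))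

  -- The degree of the tester's running time is arbitrary, so the time enters the bound as the value
  -- of a variable. Monotonicity in the input size lets the one value at `m` serve all tests on
  -- smaller inputs.
  valid?-run : ∀ γ α {m} → 3 + (∥ γ ∥ + ∥ α ∥) ≤ m →
    tester · encode (γ , List⁺.[ α ]) ∷ [] ↓ encode (valid? γ α) ⟨ x₀ ∣ validTime m ∷ [] ⟩
  valid?-run γ α {m} m≥ with proj₂ (proj₂ validity) (γ , List⁺.[ α ])
  ... | b , t , run , t≤ , _ = halts run (ℕ.≤-trans t≤ (polyTime-mono (proj₁ validity) (proj₁ (proj₂ validity))
    (ℕ.≤-trans (≤ᵖ-sound (∥ γ ∥ ∷ ∥ α ∥ ∷ []) (con 1 ⊕ x₀ ⊕ (con 1 ⊕ x₁ ⊕ con 1)) (con 3 ⊕ (x₀ ⊕ x₁)) refl) m≥)))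

  cl : Ontologyᴬ → List (Conceptᴬ × Conceptᴬ)
  cl O = proj₁ (proj₂ (proj₂ classifies) O)

  cl-correct : ∀ O → IsClassification O (cl O)
  cl-correct O = proj₂ (proj₂ (proj₂ (proj₂ (proj₂ (proj₂ classifies) O))))

  clTime : ℕ → ℕ
  clTime = polyTime (proj₁ classifies) (proj₁ (proj₂ classifies))

  clTime-mono : ∀ {m n} → m ≤ n → clTime m ≤ clTime n
  clTime-mono = polyTime-mono (proj₁ classifies) (proj₁ (proj₂ classifies))

  cl-run : ∀ O {M} → ∥ O ∥ ≤ M →
    classifier · encode O ∷ [] ↓ encode (cl O) ⟨ x₀ ∣ clTime M ∷ [] ⟩
  cl-run O O≤M with proj₂ (proj₂ classifies) O
  ... | _ , t , run , t≤ , _ = halts run (ℕ.≤-trans t≤ (clTime-mono O≤M))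

  clSize : ℕ → ℕ
  clSize n = 1 + (n + clTime n) * (1 + (1 + n + n))

  -- The specification fixes only which pairs occur, so with possible repetitions counting
  -- subconcepts does not bound the length. The height of the code does, and it is at most the size
  -- of the input plus the running time.
  cl-size : ∀ O {M} → ∥ O ∥ ≤ M → ∥ cl O ∥ ≤ clSize M
  cl-size O {M} O≤M = ℕ.≤-trans
    (list-size (cl O) (All.tabulate λ {(C , D)} i →
      let C∈ , D∈ , _ = Equivalence.to (cl-correct O C D) i in
      s≤s (ℕ.+-mono-≤ (ℕ.≤-trans (subᴼ-size-∈ O C∈) O≤M) (ℕ.≤-trans (subᴼ-size-∈ O D∈) O≤M))))
    (s≤s (ℕ.*-monoˡ-≤ (1 + (1 + M + M)) length≤))
    where
    length≤ : length (cl O) ≤ M + clTime M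
    length≤ = ℕ.≤-trans (length≤height (cl O)) (ℕ.≤-trans
      (height-bounded (height≤size (encode O) VecAll.∷ VecAll.[]) (_·_↓_⟨_∣_⟩.run (cl-run O O≤M)))
      (ℕ.+-mono-≤ O≤M (_·_↓_⟨_∣_⟩.bound (cl-run O O≤M))))

  falsum : K
  falsum = ⊥-constraint 𝒟

  implied : List K → List K → Ontologyᴬ
  implied D []       = []
  implied D (β ∷ cs) = ifᵇ valid? D β then ((conj D ⊑ A⟨ β ⟩) ∷ implied D cs) else implied D cs

  newAxioms : List K → List K → Ontologyᴬ
  newAxioms cs D = ifᵇ valid? D falsum then ((conj D ⊑ ⊥ᶜ) ∷ []) else implied D cs

  implied-size : ∀ D cs O → ∥ implied D cs ++ O ∥ ≤ ∥ cs ∥ * (20 + 21 * ∥ D ∥) + ∥ O ∥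
  implied-size D []       O = ℕ.m≤n+m ∥ O ∥ _
  implied-size D (β ∷ cs) O with valid? D β
  ... | false = ℕ.≤-trans (implied-size D cs O)
    (≤ᵖ-sound (∥ β ∥ ∷ ∥ cs ∥ ∷ ∥ D ∥ ∷ ∥ O ∥ ∷ [])
      (x₁ ⊗ (con 20 ⊕ con 21 ⊗ x₂) ⊕ x₃) ((con 1 ⊕ x₀ ⊕ x₁) ⊗ (con 20 ⊕ con 21 ⊗ x₂) ⊕ x₃) refl)
  ... | true  = ℕ.≤-trans
    (s≤s (ℕ.+-mono-≤ (s≤s (ℕ.+-monoˡ-≤ (10 + ∥ β ∥) (conj-size D))) (implied-size D cs O)))
    (≤ᵖ-sound (∥ β ∥ ∷ ∥ cs ∥ ∷ ∥ D ∥ ∷ ∥ O ∥ ∷ [])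
      (con 1 ⊕ (con 1 ⊕ (con 21 ⊗ x₂ ⊕ (con 10 ⊕ x₀)) ⊕ (x₁ ⊗ (con 20 ⊕ con 21 ⊗ x₂) ⊕ x₃)))
      ((con 1 ⊕ x₀ ⊕ x₁) ⊗ (con 20 ⊕ con 21 ⊗ x₂) ⊕ x₃) refl)

  -- Bounds what the axioms generated from one set D_C add to the ontology. The summand 1 of the
  -- first factor makes room for the single axiom with `⊥ᶜ`.
  growth : ℕ → ℕ
  growth k = (1 + k) * (20 + 21 * k)

  newAxioms-size : ∀ {k} cs D O → ∥ cs ∥ ≤ k → ∥ D ∥ ≤ k → ∥ newAxioms cs D ++ O ∥ ≤ growth k + ∥ O ∥
  newAxioms-size {k} cs D O cs≤ D≤ with valid? D falsum
  ... | true  = ℕ.≤-trans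
    (ℕ.+-monoˡ-≤ ∥ O ∥ (s≤s (s≤s (ℕ.+-monoˡ-≤ 5 (ℕ.≤-trans (conj-size D) (ℕ.*-monoʳ-≤ 21 D≤))))))
    (≤ᵖ-sound (k ∷ ∥ O ∥ ∷ []) (con 2 ⊕ (con 21 ⊗ x₀ ⊕ con 5) ⊕ x₁)
      ((con 1 ⊕ x₀) ⊗ (con 20 ⊕ con 21 ⊗ x₀) ⊕ x₁) refl)
  ... | false = ℕ.≤-trans (implied-size D cs O) (ℕ.+-monoˡ-≤ ∥ O ∥
    (ℕ.*-mono-≤ (ℕ.≤-trans cs≤ (ℕ.n≤1+n k)) (ℕ.+-monoʳ-≤ 20 (ℕ.*-monoʳ-≤ 21 D≤))))

  addImplied-run : ∀ {m} D cs O → 3 + (∥ D ∥ + ∥ cs ∥) ≤ m →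
    addImplied · encode D ∷ encode cs ∷ encode O ∷ [] ↓ encode (implied D cs ++ O)
      ⟨ con 1100 ⊗ x₂ ⊗ (con 1 ⊕ x₀ ⊕ x₁) ∣ validTime m ∷ ∥ D ∥ ∷ ∥ cs ∥ ∷ [] ⟩
  addImplied-run {m} D [] O m≥ = finish (validTime m ∷ ∥ D ∥ ∷ []) (x₀ ∷ x₁ ∷ con 1 ∷ [])
    (↓case-nil ↓var ↓var) refl
  addImplied-run {m} D (β ∷ cs) O m≥ =
    finish (validTime m ∷ ∥ D ∥ ∷ ∥ β ∥ ∷ ∥ cs ∥ ∷ []) (x₀ ∷ x₁ ∷ con 1 ⊕ x₂ ⊕ x₃ ∷ [])
      (↓case-cons ↓var
        (↓if (λ b → encode ((ifᵇ b then ((conj D ⊑ A⟨ β ⟩) ∷ implied D cs) else implied D cs) ++ O))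
          (valid? D β) (con 30 ⊕ con 1000 ⊗ x₁ ⊕ con 1100 ⊗ x₃ ⊗ (con 1 ⊕ x₀ ⊕ x₁))
          (↓call (x₀ ∷ []) (↓cons ↓var (↓cons ↓var ↓nil) ↓∷ ↓[]) (valid?-run D β m≥β))
          (↓cons (↓cons (↓call (x₁ ∷ []) (↓var ↓∷ ↓[]) (conjunction-run {N = ConceptName} D)) (↓abstractName ↓var))
            (↓self (x₀ ∷ x₁ ∷ x₃ ∷ []) (↓var ↓∷ ↓var ↓∷ ↓var ↓∷ ↓[]) (addImplied-run D cs O m≥cs))) refl
          (↓self (x₀ ∷ x₁ ∷ x₃ ∷ []) (↓var ↓∷ ↓var ↓∷ ↓var ↓∷ ↓[]) (addImplied-run D cs O m≥cs)) refl))
      refl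
    where
    m≥β : 3 + (∥ D ∥ + ∥ β ∥) ≤ m
    m≥β = ℕ.≤-trans (≤ᵖ-sound (∥ D ∥ ∷ ∥ β ∥ ∷ ∥ cs ∥ ∷ [])
      (con 3 ⊕ (x₀ ⊕ x₁)) (con 3 ⊕ (x₀ ⊕ (con 1 ⊕ x₁ ⊕ x₂))) refl) m≥
    m≥cs : 3 + (∥ D ∥ + ∥ cs ∥) ≤ m
    m≥cs = ℕ.≤-trans (≤ᵖ-sound (∥ D ∥ ∷ ∥ β ∥ ∷ ∥ cs ∥ ∷ [])
      (con 3 ⊕ (x₀ ⊕ x₂)) (con 3 ⊕ (x₀ ⊕ (con 1 ⊕ x₁ ⊕ x₂))) refl) m≥

  -- Large enough for the tests of D_C against `falsum` and against each constraint of `cs`, when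
  -- both lists have size at most `k`.
  implicationSize : ℕ → ℕ
  implicationSize k = 3 + (k + (k + ∥ falsum ∥))

  addAxiomsBound : Poly
  addAxiomsBound = con 1200 ⊗ (con 1 ⊕ x₁) ⊗ (con 1 ⊕ x₀ ⊕ x₁) ⊕ x₂

  addAxioms-run : ∀ {k} cs D O → ∥ cs ∥ ≤ k → ∥ D ∥ ≤ k →
    addAxioms · encode D ∷ encode cs ∷ encode O ∷ [] ↓ encode (newAxioms cs D ++ O)
      ⟨ addAxiomsBound ∣ validTime (implicationSize k) ∷ k ∷ ∥ falsum ∥ ∷ [] ⟩
  addAxioms-run {k} cs D O cs≤ D≤ =
    finish (validTime (implicationSize k) ∷ k ∷ ∥ falsum ∥ ∷ []) (x₀ ∷ x₁ ∷ x₂ ∷ [])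
      (↓if (λ b → encode ((ifᵇ b then ((conj D ⊑ ⊥ᶜ) ∷ []) else implied D cs) ++ O))
        (valid? D falsum) (con 40 ⊕ con 1100 ⊗ (con 1 ⊕ x₁) ⊗ (con 1 ⊕ x₀ ⊕ x₁))
        (↓call (x₀ ∷ [])
          (↓cons ↓var (↓cons (↓quote-within (encode falsum) x₂ ℕ.≤-refl) ↓nil) ↓∷ ↓[])
          (valid?-run D falsum
            (ℕ.+-monoʳ-≤ 3 (ℕ.+-mono-≤ D≤ (ℕ.m≤n+m ∥ falsum ∥ k)))))
        (↓cons (↓cons (↓call≤ (x₁ ∷ []) (D≤ ∷ []) (↓var ↓∷ ↓[]) (conjunction-run {N = ConceptName} D))
                      (↓cons (↓quote tag⊥) ↓nil))
               ↓var) refl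
        (↓call≤ (x₀ ∷ x₁ ∷ x₁ ∷ []) (ℕ.≤-refl ∷ D≤ ∷ cs≤ ∷ []) (↓var ↓∷ ↓var ↓∷ ↓var ↓∷ ↓[])
          (addImplied-run D cs O
            (ℕ.+-monoʳ-≤ 3 (ℕ.+-mono-≤ D≤ (ℕ.≤-trans cs≤ (ℕ.m≤m+n k ∥ falsum ∥)))))) refl)
      refl

  -- As in `forEach`, each concept uses the classification of the ontology already enlarged by the
  -- concepts before it, so the ontology changes within a pass.
  sweep : List K → List Conceptᴬ → Ontologyᴬ → Ontologyᴬ
  sweep cs []      O = O
  sweep cs (C ∷ S) O = sweep cs S (newAxioms cs (select C cs (cl O)) ++ O)

  -- The values of x₁, …, x₅ in sweepBound.
  parameters : ℕ → ℕ → Values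
  parameters k M = k ∷ validTime (implicationSize k) ∷ ∥ falsum ∥ ∷ clTime M ∷ clSize M ∷ []

  sweepBound : Poly
  sweepBound = x₀ ⊗ (con 3000 ⊗ (con 1 ⊕ x₁) ⊗ (con 1 ⊕ x₁ ⊕ x₂ ⊕ x₃ ⊕ x₄ ⊕ x₅))

  module _ {k} (cs : List K) (cs≤ : ∥ cs ∥ ≤ k) where

    sweep-size : ∀ S O → ∥ sweep cs S O ∥ ≤ ∥ S ∥ * growth k + ∥ O ∥
    sweep-size []      O = ℕ.m≤n+m ∥ O ∥ (1 * growth k)
    sweep-size (C ∷ S) O = ℕ.≤-trans (sweep-size S _) (ℕ.≤-trans
      (ℕ.+-monoʳ-≤ (∥ S ∥ * growth k)
        (newAxioms-size cs _ O cs≤ (ℕ.≤-trans (select-size C cs (cl O)) cs≤)))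
      (≤ᵖ-sound (∥ C ∥ ∷ ∥ S ∥ ∷ growth k ∷ ∥ O ∥ ∷ [])
        (x₁ ⊗ x₂ ⊕ (x₂ ⊕ x₃)) ((con 1 ⊕ x₀ ⊕ x₁) ⊗ x₂ ⊕ x₃) refl))

    -- The premise reserves room for the growth still to come. Every ontology classified during the
    -- pass then has size at most `M`, and the one time bound `clTime M` covers all the classifier
    -- calls.
    forEach-run : ∀ {M} S O → ∥ S ∥ * growth k + ∥ O ∥ ≤ M →
      forEach · encode S ∷ encode cs ∷ encode O ∷ [] ↓ encode (sweep cs S O)
        ⟨ sweepBound ∣ ∥ S ∥ ∷ parameters k M ⟩
    forEach-run {M} [] O M≥ = finish (parameters k M) (con 1 ∷ x₀ ∷ x₁ ∷ x₂ ∷ x₃ ∷ x₄ ∷ [])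
      (↓case-nil ↓var ↓var) refl
    forEach-run {M} (C ∷ S) O M≥ =
      finish (∥ C ∥ ∷ ∥ S ∥ ∷ parameters k M) (con 1 ⊕ x₀ ⊕ x₁ ∷ x₂ ∷ x₃ ∷ x₄ ∷ x₅ ∷ ind 6 ∷ [])
        (↓case-cons ↓var
          (↓self (x₁ ∷ x₂ ∷ x₃ ∷ x₄ ∷ x₅ ∷ ind 6 ∷ [])
            (↓var ↓∷ ↓var ↓∷
             ↓call (x₃ ∷ x₂ ∷ x₄ ∷ [])
               (↓call≤ (x₀ ∷ x₂ ∷ ind 6 ∷ []) (ℕ.≤-refl ∷ cs≤ ∷ cl-size O O≤M ∷ [])
                  (↓var ↓∷ ↓var ↓∷ ↓call (x₅ ∷ []) (↓var ↓∷ ↓[]) (cl-run O O≤M) ↓∷ ↓[])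
                  (selectD-run C cs (cl O)) ↓∷
                ↓var ↓∷ ↓var ↓∷ ↓[])
               (addAxioms-run cs D O cs≤ D≤) ↓∷ ↓[])
            (forEach-run S (newAxioms cs D ++ O) M≥′))) refl
      where
      D : List K
      D = select C cs (cl O)
      D≤ : ∥ D ∥ ≤ k
      D≤ = ℕ.≤-trans (select-size C cs (cl O)) cs≤
      O≤M : ∥ O ∥ ≤ M
      O≤M = ℕ.≤-trans (ℕ.m≤n+m ∥ O ∥ (∥ C ∷ S ∥ * growth k)) M≥
      M≥′ : ∥ S ∥ * growth k + ∥ newAxioms cs D ++ O ∥ ≤ M
      M≥′ = ℕ.≤-trans
        (ℕ.≤-trans (ℕ.+-monoʳ-≤ (∥ S ∥ * growth k) (newAxioms-size cs D O cs≤ D≤))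
          (≤ᵖ-sound (∥ C ∥ ∷ ∥ S ∥ ∷ growth k ∷ ∥ O ∥ ∷ [])
            (x₁ ⊗ x₂ ⊕ (x₂ ⊕ x₃)) ((con 1 ⊕ x₀ ⊕ x₁) ⊗ x₂ ⊕ x₃) refl)) M≥

-- Termination

length-cartesianProduct : ∀ {A B : Set} (xs : List A) (ys : List B) →
                          length (cartesianProduct xs ys) ≡ length xs * length ys
length-cartesianProduct []       ys = refl
length-cartesianProduct (x ∷ xs) ys = trans (List.length-++ (map (x ,_) ys))
  (cong₂ _+_ (List.length-map (x ,_) ys) (length-cartesianProduct xs ys))

filter-cong-∈ : ∀ {A : Set} {P Q : A → Set} (P? : Decidable P) (Q? : Decidable Q) xs →
                (∀ {x} → x ∈ xs → P x → Q x) → (∀ {x} → x ∈ xs → Q x → P x) →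
                filter P? xs ≡ filter Q? xs
filter-cong-∈ P? Q? []       P⇒Q Q⇒P = refl
filter-cong-∈ P? Q? (x ∷ xs) P⇒Q Q⇒P
  with P? x | Q? x | filter-cong-∈ P? Q? xs (P⇒Q ∘ there) (Q⇒P ∘ there)
... | Dec.yes _  | Dec.yes _  | eq = cong (x ∷_) eq
... | Dec.yes Px | Dec.no ¬Qx | _  = contradiction (P⇒Q (here refl) Px) ¬Qx
... | Dec.no ¬Px | Dec.yes Qx | _  = contradiction (Q⇒P (here refl) Qx) ¬Px
... | Dec.no _   | Dec.no _   | eq = eq

entails-mono : ∀ {N} {O O′ : Ontology N ⊥} {ax} → O ⊆ O′ → Entails O ax → Entails O′ ax
entails-mono O⊆O′ e I m = e I (Subset.All-resp-⊇ O⊆O′ m)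

module Progress (𝒟 : ConcreteDomain) (adm : PAdmissible 𝒟) (cls : Classifier (Nameᴬ 𝒟)) where

  open Run 𝒟 adm cls

  ∈-cl⁺ : ∀ {O C D} → C ∈ subᴼ O → D ∈ subᴼ O → Entails O (C ⊑ D) → (C , D) ∈ cl O
  ∈-cl⁺ C∈ D∈ e = Equivalence.from (cl-correct _ _ _) (C∈ , D∈ , e)

  ∈-cl⁻ : ∀ {O C D} → (C , D) ∈ cl O → C ∈ subᴼ O × D ∈ subᴼ O × Entails O (C ⊑ D)
  ∈-cl⁻ = Equivalence.to (cl-correct _ _ _)

  cl-mono : ∀ {O O′} → O ⊆ O′ → cl O ⊆ cl O′
  cl-mono O⊆O′ {C , D} i =
    let C∈ , D∈ , e = ∈-cl⁻ i in
    ∈-cl⁺ (Subset.concatMap⁺ _ O⊆O′ C∈) (Subset.concatMap⁺ _ O⊆O′ D∈) (entails-mono {ax = C ⊑ D} O⊆O′ e)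

  module _ (cs : List K) where

    sweep-extends : ∀ S {O} → O ⊆ sweep cs S O
    sweep-extends []      i = i
    sweep-extends (C ∷ S) i = sweep-extends S (List.∈-++⁺ʳ _ i)

    -- For `O` contained in `O′`, this says that the two ontologies have the same sets D_C for all C
    -- in `S`.
    Stable : List Conceptᴬ → Ontologyᴬ → Ontologyᴬ → Set
    Stable S O O′ = ∀ {C α} → C ∈ S → α ∈ cs → (C , A⟨ α ⟩) ∈ cl O′ → (C , A⟨ α ⟩) ∈ cl O

    -- `P` lies between `O` and `Q`, so by monotonicity its classification is caught between theirs,
    -- which agree on the relevant pairs.
    select-stable : ∀ {S C O P Q} → C ∈ S → O ⊆ P → P ⊆ Q → Stable S O Q →
                    select C cs (cl P) ≡ select C cs (cl O)
    select-stable C∈ O⊆P P⊆Q stable = filter-cong-∈ _ _ cs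
      (λ α∈ → stable C∈ α∈ ∘ cl-mono P⊆Q) (λ _ → cl-mono O⊆P)

    -- The sweep reads the sets D_C off growing intermediate ontologies. Stability up to `Q`
    -- identifies them all with those of `O`, so the axioms added are the ones computed from `O`.
    sweep-stable-⊇ : ∀ S {O P Q} → O ⊆ P → sweep cs S P ⊆ Q → Stable S O Q → ∀ {C} → C ∈ S →
                     newAxioms cs (select C cs (cl O)) ⊆ sweep cs S P
    sweep-stable-⊇ (C ∷ S) {O} {P} O⊆P ⊆Q stable (here refl) i =
      sweep-extends S (List.∈-++⁺ˡ
        (subst (λ D → _ ∈ newAxioms cs D) (sym (select-stable {C ∷ S} (here refl) O⊆P P⊆Q stable)) i))
      where
      P⊆Q : P ⊆ _
      P⊆Q = ⊆Q ∘ sweep-extends S ∘ List.∈-++⁺ʳ _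
    sweep-stable-⊇ (C ∷ S) O⊆P ⊆Q stable (there C∈) =
      sweep-stable-⊇ S (List.∈-++⁺ʳ _ ∘ O⊆P) ⊆Q (stable ∘ there) C∈

    sweep-stable-⊆ : ∀ S {O P Q} → O ⊆ P → sweep cs S P ⊆ Q → Stable S O Q → ∀ {ax} →
                     ax ∈ sweep cs S P →
                     ax ∈ P ⊎ ∃ λ C → C ∈ S × ax ∈ newAxioms cs (select C cs (cl O))
    sweep-stable-⊆ [] O⊆P ⊆Q stable i = inj₁ i
    sweep-stable-⊆ (C ∷ S) {O} {P} O⊆P ⊆Q stable i
      with sweep-stable-⊆ S (List.∈-++⁺ʳ _ ∘ O⊆P) ⊆Q (stable ∘ there) i
    ... | inj₂ (D , D∈ , j) = inj₂ (D , there D∈ , j)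
    ... | inj₁ j with List.∈-++⁻ (newAxioms cs (select C cs (cl P))) j
    ... | inj₂ k = inj₁ k
    ... | inj₁ k = inj₂ (C , here refl ,
      subst (λ D → _ ∈ newAxioms cs D) (select-stable {C ∷ S} (here refl) O⊆P P⊆Q stable) k)
      where
      P⊆Q : P ⊆ _
      P⊆Q = ⊆Q ∘ sweep-extends S ∘ List.∈-++⁺ʳ _

    module _ (S : List Conceptᴬ) where

      Derived : Ontologyᴬ → Conceptᴬ × K → Set
      Derived O (C , α) = (C , A⟨ α ⟩) ∈ cl O

      derived? : ∀ O → Decidable (Derived O)
      derived? O (C , α) = (C , A⟨ α ⟩) ∈? cl O

      derived : Ontologyᴬ → List (Conceptᴬ × K)
      derived O = filter (derived? O) (cartesianProduct S cs)

      -- A sublist rather than a mere subset: lengths can then be compared, and equal length forces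
      -- equality of the lists.
      derived-mono : ∀ {O O′} → O ⊆ O′ → derived O Sublist.⊆ derived O′
      derived-mono {O} {O′} O⊆O′ =
        Sublist.filter⁺ (derived? O) (derived? O′) (λ { refl → cl-mono O⊆O′ })
          (⊆-refl {x = cartesianProduct S cs})

      potential : Ontologyᴬ → ℕ
      potential O = length (derived O)

      potential-bounded : ∀ O → potential O ≤ length S * length cs
      potential-bounded O = ℕ.≤-trans (List.length-filter (derived? O) (cartesianProduct S cs))
        (ℕ.≤-reflexive (length-cartesianProduct S cs))

      grows-or-stable : ∀ {O O′} → O ⊆ O′ → potential O < potential O′ ⊎ Stable S O O′
      grows-or-stable {O} {O′} O⊆O′ with ℕ.m≤n⇒m<n∨m≡n (HSublist.length-mono-≤ (derived-mono O⊆O′))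
      ... | inj₁ <  = inj₁ <
      ... | inj₂ eq = inj₂ λ C∈ α∈ i →
        proj₂ (List.∈-filter⁻ (derived? O) {xs = cartesianProduct S cs}
          (subst (_ ∈_) (sym derived≡)
            (List.∈-filter⁺ (derived? O′) (List.∈-cartesianProduct⁺ C∈ α∈) i)))
        where
        derived≡ : derived O ≡ derived O′
        derived≡ = Pointwise.Pointwise-≡⇒≡ (HSublist.toPointwise eq (derived-mono O⊆O′))

      -- If the sets D_C do not change over two sweeps, the second sweep
      -- adds the same axioms as the first.
      progress : ∀ O → potential O < potential (sweep cs S (sweep cs S O)) ⊎
                       sweep cs S (sweep cs S O) ⊆ sweep cs S O
      progress O with grows-or-stable (sweep-extends S {sweep cs S O} ∘ sweep-extends S {O})
      ... | inj₁ <      = inj₁ <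
      ... | inj₂ stable = inj₂ λ i → back (sweep-stable-⊆ S (sweep-extends S) id stable i)
        where
        back : ∀ {ax} → ax ∈ sweep cs S O ⊎ (∃ λ C → C ∈ S × ax ∈ newAxioms cs (select C cs (cl O))) →
               ax ∈ sweep cs S O
        back (inj₁ i)            = i
        back (inj₂ (C , C∈ , i)) = sweep-stable-⊇ S id (sweep-extends S) stable C∈ i

length≤size : ∀ {A : Set} {{_ : Code A}} (xs : List A) → length xs ≤ ∥ xs ∥
length≤size xs = ℕ.≤-trans (length≤height xs) (height≤size (encode xs))

-- Running time and number of passes of the loop

module Loop (𝒟 : ConcreteDomain) (adm : PAdmissible 𝒟) (cls : Classifier (Nameᴬ 𝒟)) where

  open Run 𝒟 adm cls
  open Progress 𝒟 adm cls
  open PAdmissible adm using (tester)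
  open Classifier cls using () renaming (program to classifier)
  open Algorithm tester classifier (encode (⊥-constraint 𝒟))

  iteration loopBound : Poly
  iteration = con 200 ⊗ (con 1 ⊕ ind 6) ⊗ (con 1 ⊕ ind 6) ⊕ con 3 ⊗ x₅ ⊕
              substitute (x₁ ∷ x₂ ∷ x₃ ∷ x₄ ∷ x₅ ∷ ind 6 ∷ []) sweepBound
  loopBound = x₀ ⊗ iteration

  module _ (cs : List K) (S : List Conceptᴬ) where

    data Reachable (O : Ontologyᴬ) : Ontologyᴬ → Set where
      start  : Reachable O O
      onward : ∀ {O′} → Reachable O O′ → Reachable O (sweep cs S O′)

    later : ∀ {O O′} → Reachable (sweep cs S O) O′ → Reachable O O′
    later start      = onward start
    later (onward r) = onward (later r)

    -- What correctness uses of a finished loop. The inclusion reverse to `unchanged` is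
    -- monotonicity of the classification.
    record Stops (O : Ontologyᴬ) (L : List (Conceptᴬ × Conceptᴬ)) : Set where
      field
        {final}   : Ontologyᴬ
        reachable : Reachable O final
        result    : L ≡ cl final
        unchanged : cl (sweep cs S final) ⊆ cl final

  module _ {k} (cs : List K) (S : List Conceptᴬ) (cs≤ : ∥ cs ∥ ≤ k) where

    private
      next : Ontologyᴬ → Ontologyᴬ
      next = sweep cs S

      step : ℕ
      step = ∥ S ∥ * growth k

      next-size : ∀ O {M} → step + ∥ O ∥ ≤ M → ∥ next O ∥ ≤ M
      next-size O = ℕ.≤-trans (sweep-size cs cs≤ S O)

    module _ {M : ℕ} where

      LoopRun : List (Conceptᴬ × Conceptᴬ) → Ontologyᴬ → List (Conceptᴬ × Conceptᴬ) → ℕ → Set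
      LoopRun N O L n =
        while · encode N ∷ encode O ∷ encode S ∷ encode cs ∷ [] ↓ encode L
          ⟨ loopBound ∣ n ∷ ∥ S ∥ ∷ parameters k M ⟩

      sameSet-run-is : ∀ {b} (l m : List (Conceptᴬ × Conceptᴬ)) → does (l ≋? m) ≡ b →
        sameSet · encode l ∷ encode m ∷ [] ↓ encode b ⟨ sameSetBound ∣ ∥ l ∥ ∷ ∥ m ∥ ∷ [] ⟩
      sameSet-run-is l m refl = sameSet-run l m

      stop : ∀ {N O} n → ∥ O ∥ ≤ M → ∥ N ∥ ≤ clSize M →
             All (_∈ cl O) N → All (_∈ N) (cl O) → LoopRun N O N (1 + n)
      stop {N} {O} n O≤ N≤ N⊆ ⊆N =
        finish (n ∷ ∥ S ∥ ∷ parameters k M)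
          (con 1 ⊕ x₀ ∷ x₁ ∷ x₂ ∷ x₃ ∷ x₄ ∷ x₅ ∷ ind 6 ∷ [])
          (↓then
            (↓call≤ (ind 6 ∷ ind 6 ∷ []) (N≤ ∷ cl-size O O≤ ∷ [])
              (↓var ↓∷ ↓call (x₅ ∷ []) (↓var ↓∷ ↓[]) (cl-run O O≤) ↓∷ ↓[])
              (sameSet-run-is N (cl O) (Dec.dec-true (N ≋? cl O) (N⊆ , ⊆N))))
            ↓var) refl

      iterate : ∀ {N O L} n → step + ∥ O ∥ ≤ M → ∥ N ∥ ≤ clSize M →
                does (N ≋? cl O) ≡ false → LoopRun (cl O) (next O) L n → LoopRun N O L (1 + n)
      iterate {N} {O} n O≤ N≤ changed run =
        finish (n ∷ ∥ S ∥ ∷ parameters k M)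
          (con 1 ⊕ x₀ ∷ x₁ ∷ x₂ ∷ x₃ ∷ x₄ ∷ x₅ ∷ ind 6 ∷ [])
          (↓else
            (↓call≤ (ind 6 ∷ ind 6 ∷ []) (N≤ ∷ cl-size O O≤M ∷ [])
              (↓var ↓∷ ↓call (x₅ ∷ []) (↓var ↓∷ ↓[]) (cl-run O O≤M) ↓∷ ↓[])
              (sameSet-run-is N (cl O) changed))
            (↓self (x₀ ∷ x₁ ∷ x₂ ∷ x₃ ∷ x₄ ∷ x₅ ∷ ind 6 ∷ [])
              (↓call (x₅ ∷ []) (↓var ↓∷ ↓[]) (cl-run O O≤M) ↓∷
               ↓call (x₁ ∷ x₂ ∷ x₃ ∷ x₄ ∷ x₅ ∷ ind 6 ∷ []) (↓var ↓∷ ↓var ↓∷ ↓var ↓∷ ↓[])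
                 (forEach-run cs cs≤ S O O≤) ↓∷
               ↓var ↓∷ ↓var ↓∷ ↓[])
              run)) refl
        where
        O≤M : ∥ O ∥ ≤ M
        O≤M = ℕ.≤-trans (ℕ.m≤n+m ∥ O ∥ step) O≤

      cap : ℕ
      cap = length S * length cs

      ϕ : Ontologyᴬ → ℕ
      ϕ = potential cs S

      -- `n` is a budget of passes. The size premise leaves room for `n` further sweeps, and the
      -- last premise says that the budget exceeds what the potentials of two consecutive ontologies
      -- can still gain below `cap + cap`. Two potentials are summed because the strict increase is
      -- only known across two sweeps.
      loop : ∀ n O → n * step + ∥ next O ∥ ≤ M → ∥ O ∥ ≤ M →
             cap + cap < n + (ϕ O + ϕ (next O)) →
             ∃ λ L → LoopRun (cl O) (next O) L (1 + n) × ∥ L ∥ ≤ clSize M × Stops cs S O L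
      loop n O fits O≤ enough with cl O ≋? cl (next O) in same
      ... | Dec.yes (⊆ , ⊇) =
        cl O ,
        stop n (ℕ.≤-trans (ℕ.m≤n+m _ (n * step)) fits) (cl-size O O≤) ⊆ ⊇ ,
        cl-size O O≤ ,
        record { reachable = start ; result = refl ; unchanged = All.lookup ⊇ }
      -- With no budget left, the potentials would exceed their maximum `cap + cap`.
      loop ℕ.zero O fits O≤ enough | Dec.no _ =
        contradiction (ℕ.+-mono-≤ (potential-bounded cs S O) (potential-bounded cs S (next O)))
                      (ℕ.<⇒≱ enough)
      loop (ℕ.suc n) O fits O≤ enough | Dec.no changed with progress cs S O
      ... | inj₁ grown =
        let L , run , L≤ , stops = loop n (next O) fits′ next≤M (ℕ.≤-trans enough enough′) in
        L ,
        iterate (1 + n) step≤M (cl-size O O≤) (cong does same) run ,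
        L≤ ,
        record { reachable = later cs S (Stops.reachable stops)
               ; result = Stops.result stops ; unchanged = Stops.unchanged stops }
        where
        step≤M : step + ∥ next O ∥ ≤ M
        step≤M = ℕ.≤-trans (ℕ.+-monoˡ-≤ ∥ next O ∥ (ℕ.m≤m+n step (n * step))) fits
        next≤M : ∥ next O ∥ ≤ M
        next≤M = ℕ.≤-trans (ℕ.m≤n+m ∥ next O ∥ step) step≤M
        fits′ : n * step + ∥ next (next O) ∥ ≤ M
        fits′ = ℕ.≤-trans (ℕ.+-monoʳ-≤ (n * step) (sweep-size cs cs≤ S (next O)))
          (ℕ.≤-trans (≤ᵖ-sound (n * step ∷ step ∷ ∥ next O ∥ ∷ []) (x₀ ⊕ (x₁ ⊕ x₂)) (x₁ ⊕ x₀ ⊕ x₂) refl) fits)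
        -- The next pair replaces `ϕ O` by the strictly larger `ϕ (next (next O))`, which pays for
        -- the pass just spent.
        enough′ : ℕ.suc n + (ϕ O + ϕ (next O)) ≤ n + (ϕ (next O) + ϕ (next (next O)))
        enough′ = ℕ.≤-trans
          (≤ᵖ-sound (n ∷ ϕ O ∷ ϕ (next O) ∷ []) (con 1 ⊕ x₀ ⊕ (x₁ ⊕ x₂)) (x₀ ⊕ (x₂ ⊕ (con 1 ⊕ x₁))) refl)
          (ℕ.+-monoʳ-≤ n (ℕ.+-monoʳ-≤ (ϕ (next O)) grown))
      -- The second sweep adds nothing new, so after one more iteration the classifications agree
      -- and the loop stops.
      ... | inj₂ closed =
        cl (next O) ,
        iterate (1 + n) step≤M (cl-size O O≤) (cong does same)
          (stop n (next-size (next O) step≤M) (cl-size (next O) next≤M)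
            (All.tabulate (cl-mono (sweep-extends cs S))) (All.tabulate (cl-mono closed))) ,
        cl-size (next O) next≤M ,
        record { reachable = onward start ; result = refl ; unchanged = cl-mono closed }
        where
        step≤M : step + ∥ next O ∥ ≤ M
        step≤M = ℕ.≤-trans (ℕ.+-monoˡ-≤ ∥ next O ∥ (ℕ.m≤m+n step (n * step))) fits
        next≤M : ∥ next O ∥ ≤ M
        next≤M = ℕ.≤-trans (ℕ.m≤n+m ∥ next O ∥ step) step≤M

      -- Separate from `loop`, because the first test compares with the initial empty set instead of
      -- the classification of a preceding ontology. It takes one pass on top of the `1 + n` of
      -- `loop`.
      while-run : ∀ n O → (1 + n) * step + ∥ O ∥ ≤ M → cap + cap < n →
        ∃ λ L → LoopRun [] O L (2 + n) × ∥ L ∥ ≤ clSize M × (cl O ⊆ [] ⊎ Stops cs S O L)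
      while-run n O fits enough with [] ≋? cl O in same
      ... | Dec.yes (⊆ , ⊇) =
        [] , stop (1 + n) (ℕ.≤-trans (ℕ.m≤n+m ∥ O ∥ _) fits) (s≤s z≤n) ⊆ ⊇ , s≤s z≤n , inj₁ (All.lookup ⊇)
      ... | Dec.no changed =
        let L , run , L≤ , stops = loop n O fits′ O≤M (ℕ.≤-trans enough (ℕ.m≤m+n n _)) in
        L , iterate (1 + n) step≤M (s≤s z≤n) (cong does same) run , L≤ , inj₂ stops
        where
        O≤M : ∥ O ∥ ≤ M
        O≤M = ℕ.≤-trans (ℕ.m≤n+m ∥ O ∥ _) fits
        step≤M : step + ∥ O ∥ ≤ M
        step≤M = ℕ.≤-trans (ℕ.+-monoˡ-≤ ∥ O ∥ (ℕ.m≤m+n step (n * step))) fits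
        fits′ : n * step + ∥ next O ∥ ≤ M
        fits′ = ℕ.≤-trans (ℕ.+-monoʳ-≤ (n * step) (sweep-size cs cs≤ S O))
          (ℕ.≤-trans (≤ᵖ-sound (n * step ∷ step ∷ ∥ O ∥ ∷ []) (x₀ ⊕ (x₁ ⊕ x₂)) (x₁ ⊕ x₀ ⊕ x₂) refl) fits)

  abstractᴼ : Ontologyᴰ 𝒟 → Ontologyᴬ
  abstractᴼ = map abstractᴳ

  concretiseᴾ : List (Conceptᴬ × Conceptᴬ) → List (Conceptᴰ 𝒟 × Conceptᴰ 𝒟)
  concretiseᴾ = map (Product.map concretise concretise)

  -- `conceptCount` is the quadratic bound at twice the input size, since abstraction may double the
  -- size. `sweepCount` exceeds twice the product of the other two, since the potentials of two
  -- ontologies are summed.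
  constraintCount conceptCount sweepCount : Poly
  constraintCount = x₀ ⊗ (con 1 ⊕ x₀)
  conceptCount    = con 2 ⊗ x₀ ⊗ (con 1 ⊕ con 2 ⊗ x₀)
  sweepCount      = con 1 ⊕ (conceptCount ⊗ constraintCount ⊕ conceptCount ⊗ constraintCount)

  -- `ontologySize` allows for the abstraction, of at most twice the input size, and for the growth
  -- of all the sweeps that the budget permits.
  constraintsSize ontologySize : ℕ → ℕ
  constraintsSize n = ⟦ constraintCount ⟧ (n ∷ [])
  ontologySize n =
    (1 + ⟦ sweepCount ⟧ (n ∷ [])) * (⟦ conceptCount ⟧ (n ∷ []) * growth (constraintsSize n)) + 2 * n

  values : ℕ → Values
  values n = n ∷ validTime (implicationSize (constraintsSize n)) ∷ ∥ falsum ∥ ∷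
             clTime (ontologySize n) ∷ clSize (ontologySize n) ∷ []

  mainBound : Poly
  mainBound = con 20 ⊕ con 2 ⊗ linearBound ⊕ collectBound ⊕
    substitute (con 2 ⊗ x₀ ∷ []) collectBound ⊕
    substitute (con 2 ⊕ sweepCount ∷ conceptCount ∷ constraintCount ∷ x₁ ∷ x₂ ∷ x₃ ∷ x₄ ∷ []) loopBound ⊕
    substitute (x₄ ∷ []) linearBound

  -- The first alternative is the run on the empty ontology, where the
  -- initial value ∅ of the variable 𝒩 is already the classification.
  main-run : ∀ O → ∃ λ L →
    main · encode O ∷ [] ↓ encode (concretiseᴾ L) ⟨ mainBound ∣ values ∥ O ∥ ⟩ ×
    (cl (abstractᴼ O) ⊆ [] ⊎
     Stops (constraintsᴼ O) (subᴼ (abstractᴼ O)) (abstractᴼ O) L)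
  main-run O =
    let L , run , L≤ , stops = while-run cs S cs≤ it O₀ fits enough in
    L ,
    finish (values n) (x₀ ∷ x₁ ∷ x₂ ∷ x₃ ∷ x₄ ∷ [])
      (↓call≤ (x₄ ∷ []) (L≤ ∷ [])
        (↓call≤ (con 2 ⊕ sweepCount ∷ conceptCount ∷ constraintCount ∷ x₁ ∷ x₂ ∷ x₃ ∷ x₄ ∷ [])
          (ℕ.≤-refl ∷ S≤ ∷ Pointwise.refl ℕ.≤-refl)
          (↓nil ↓∷
           ↓call (x₀ ∷ []) (↓var ↓∷ ↓[]) (abstractOntology-run O) ↓∷
           ↓call≤ (con 2 ⊗ x₀ ∷ []) (abstractᴼ-size O ∷ [])
             (↓call (x₀ ∷ []) (↓var ↓∷ ↓[]) (abstractOntology-run O) ↓∷ ↓[])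
             (subOntology-run O₀) ↓∷
           ↓call (x₀ ∷ []) (↓var ↓∷ ↓[]) (constraints-run O) ↓∷ ↓[])
          run ↓∷ ↓[])
        (concretisePairs-run {N = ConceptName} {K = K} L)) refl ,
    stops
    where
    n it : ℕ
    n  = ∥ O ∥
    it = ⟦ sweepCount ⟧ (n ∷ [])
    O₀ : Ontologyᴬ
    O₀ = abstractᴼ O
    S : List Conceptᴬ
    S = subᴼ O₀
    cs : List K
    cs = constraintsᴼ O
    cs≤ : ∥ cs ∥ ≤ constraintsSize n
    cs≤ = constraintsᴼ-size O
    S≤ : ∥ S ∥ ≤ ⟦ conceptCount ⟧ (n ∷ [])
    S≤ = ℕ.≤-trans (subᴼ-size O₀)
      (ℕ.*-mono-≤ (abstractᴼ-size O) (s≤s (abstractᴼ-size O)))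
    fits : (1 + it) * (∥ S ∥ * growth (constraintsSize n)) + ∥ O₀ ∥ ≤ ontologySize n
    fits = ℕ.+-mono-≤ (ℕ.*-monoʳ-≤ (1 + it) (ℕ.*-monoˡ-≤ (growth (constraintsSize n)) S≤))
                      (abstractᴼ-size O)
    cap≤ : length S * length cs ≤ ⟦ conceptCount ⟧ (n ∷ []) * constraintsSize n
    cap≤ = ℕ.*-mono-≤ (ℕ.≤-trans (length≤size S) S≤) (ℕ.≤-trans (length≤size cs) cs≤)
    enough : length S * length cs + length S * length cs < it
    enough = s≤s (ℕ.+-mono-≤ cap≤ cap≤)

-- Correctness

module _ {N K : Set} where

  concretise-abstractᶜ : ∀ (C : Concept N K) → concretise (abstractᶜ C) ≡ C
  concretise-abstractᶜ ⊤ᶜ       = refl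
  concretise-abstractᶜ ⊥ᶜ       = refl
  concretise-abstractᶜ (nm A)   = refl
  concretise-abstractᶜ [ α ]    = refl
  concretise-abstractᶜ (C ⊓ D)  = cong₂ _⊓_ (concretise-abstractᶜ C) (concretise-abstractᶜ D)
  concretise-abstractᶜ (∃ᶜ r C) = cong (∃ᶜ r) (concretise-abstractᶜ C)

  -- The disjoint union separates fresh names from old ones. Concretisation is thus injective, and
  -- replacing the names in the output confuses no two pairs.
  abstractᶜ-concretise : ∀ (C : Concept (N ⊎ K) ⊥) → abstractᶜ (concretise C) ≡ C
  abstractᶜ-concretise ⊤ᶜ            = refl
  abstractᶜ-concretise ⊥ᶜ            = refl
  abstractᶜ-concretise (nm (inj₁ A)) = refl
  abstractᶜ-concretise (nm (inj₂ α)) = refl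
  abstractᶜ-concretise (C ⊓ D)       = cong₂ _⊓_ (abstractᶜ-concretise C) (abstractᶜ-concretise D)
  abstractᶜ-concretise (∃ᶜ r C)      = cong (∃ᶜ r) (abstractᶜ-concretise C)

  ∈-concretise⁺ : ∀ {C D : Concept N K} {L} → (abstractᶜ C , abstractᶜ D) ∈ L →
                  (C , D) ∈ map (Product.map concretise concretise) L
  ∈-concretise⁺ {C} {D} i = subst (_∈ _)
    (cong₂ _,_ (concretise-abstractᶜ C) (concretise-abstractᶜ D))
    (List.∈-map⁺ (Product.map concretise concretise) i)

  ∈-concretise⁻ : ∀ {C D : Concept N K} {L} →
                  (C , D) ∈ map (Product.map concretise concretise) L →
                  (abstractᶜ C , abstractᶜ D) ∈ L
  ∈-concretise⁻ i with List.∈-map⁻ (Product.map concretise concretise) i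
  ... | (C , D) , j , refl =
    subst (_∈ _) (sym (cong₂ _,_ (abstractᶜ-concretise C) (abstractᶜ-concretise D))) j

  sub-refl : ∀ (C : Concept N K) → C ∈ sub C
  sub-refl ⊤ᶜ       = here refl
  sub-refl ⊥ᶜ       = here refl
  sub-refl (nm A)   = here refl
  sub-refl [ α ]    = here refl
  sub-refl (C ⊓ D)  = here refl
  sub-refl (∃ᶜ r C) = here refl

  sub-trans : ∀ (C : Concept N K) {D} → D ∈ sub C → sub D ⊆ sub C
  sub-trans ⊤ᶜ       (here refl) = id
  sub-trans ⊥ᶜ       (here refl) = id
  sub-trans (nm A)   (here refl) = id
  sub-trans [ α ]    (here refl) = id
  sub-trans (C ⊓ D)  (here refl) = id
  sub-trans (C ⊓ D)  (there i) with List.∈-++⁻ (sub C) i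
  ... | inj₁ j = there ∘ List.∈-++⁺ˡ ∘ sub-trans C j
  ... | inj₂ j = there ∘ List.∈-++⁺ʳ (sub C) ∘ sub-trans D j
  sub-trans (∃ᶜ r C) (here refl) = id
  sub-trans (∃ᶜ r C) (there i)   = there ∘ sub-trans C i

  subᴼ-trans : ∀ (O : Ontology N K) {D} → D ∈ subᴼ O → sub D ⊆ subᴼ O
  subᴼ-trans ((C ⊑ D) ∷ O) i with List.∈-++⁻ (sub C ++ sub D) i
  ... | inj₂ j = List.∈-++⁺ʳ (sub C ++ sub D) ∘ subᴼ-trans O j
  ... | inj₁ j with List.∈-++⁻ (sub C) j
  ... | inj₁ k = List.∈-++⁺ˡ ∘ List.∈-++⁺ˡ ∘ sub-trans C k
  ... | inj₂ k = List.∈-++⁺ˡ ∘ List.∈-++⁺ʳ (sub C) ∘ sub-trans D k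

  lhs-⊆ : ∀ (O : Ontology N K) {C D} → (C ⊑ D) ∈ O → sub C ⊆ subᴼ O
  lhs-⊆ (_ ∷ O) (here refl) = List.∈-++⁺ˡ ∘ List.∈-++⁺ˡ
  lhs-⊆ (_ ∷ O) (there i)   = List.∈-++⁺ʳ _ ∘ lhs-⊆ O i

  rhs-⊆ : ∀ (O : Ontology N K) {C D} → (C ⊑ D) ∈ O → sub D ⊆ subᴼ O
  rhs-⊆ (_ ∷ O) {C} (here refl) = List.∈-++⁺ˡ ∘ List.∈-++⁺ʳ (sub C)
  rhs-⊆ (_ ∷ O)     (there i)   = List.∈-++⁺ʳ _ ∘ rhs-⊆ O i

  sub-abstractᶜ : ∀ (C : Concept N K) → sub (abstractᶜ C) ≡ map abstractᶜ (sub C)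
  sub-abstractᶜ ⊤ᶜ       = refl
  sub-abstractᶜ ⊥ᶜ       = refl
  sub-abstractᶜ (nm A)   = refl
  sub-abstractᶜ [ α ]    = refl
  sub-abstractᶜ (C ⊓ D)  = cong (abstractᶜ (C ⊓ D) ∷_)
    (trans (cong₂ _++_ (sub-abstractᶜ C) (sub-abstractᶜ D))
           (sym (List.map-++ abstractᶜ (sub C) (sub D))))
  sub-abstractᶜ (∃ᶜ r C) = cong (abstractᶜ (∃ᶜ r C) ∷_) (sub-abstractᶜ C)

  subᴼ-abstractᴳ : ∀ (O : Ontology N K) → subᴼ (map abstractᴳ O) ≡ map abstractᶜ (subᴼ O)
  subᴼ-abstractᴳ []            = refl
  subᴼ-abstractᴳ ((C ⊑ D) ∷ O) = trans
    (cong₂ _++_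
      (trans (cong₂ _++_ (sub-abstractᶜ C) (sub-abstractᶜ D))
             (sym (List.map-++ abstractᶜ (sub C) (sub D))))
      (subᴼ-abstractᴳ O))
    (sym (List.map-++ abstractᶜ (sub C ++ sub D) (subᴼ O)))

  ∈-subᴼ-abstract : ∀ {O : Ontology N K} {C} → C ∈ subᴼ O → abstractᶜ C ∈ subᴼ (map abstractᴳ O)
  ∈-subᴼ-abstract {O} i = subst (_ ∈_) (sym (subᴼ-abstractᴳ O)) (List.∈-map⁺ abstractᶜ i)

module _ {N K : Set} {{cN : Code N}} {{cK : Code K}} where

  constraintsᶜ-⊇ : ∀ (C : Concept N K) acc → acc ⊆ constraintsᶜ C acc
  constraintsᶜ-⊇ ⊤ᶜ       acc i = i
  constraintsᶜ-⊇ ⊥ᶜ       acc i = i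
  constraintsᶜ-⊇ (nm A)   acc i = i
  constraintsᶜ-⊇ [ α ]    acc i with does (α ∈? acc)
  ... | true  = i
  ... | false = there i
  constraintsᶜ-⊇ (C ⊓ D)  acc = constraintsᶜ-⊇ C _ ∘ constraintsᶜ-⊇ D acc
  constraintsᶜ-⊇ (∃ᶜ r C) acc = constraintsᶜ-⊇ C acc

  ∈-constraintsᶜ⁺ : ∀ (C : Concept N K) acc {α} → [ α ] ∈ sub C → α ∈ constraintsᶜ C acc
  ∈-constraintsᶜ⁺ ⊤ᶜ       acc (here ())
  ∈-constraintsᶜ⁺ ⊥ᶜ       acc (here ())
  ∈-constraintsᶜ⁺ (nm A)   acc (here ())
  ∈-constraintsᶜ⁺ [ α ]    acc (here refl) with α ∈? acc
  ... | Dec.yes i = i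
  ... | Dec.no  _ = here refl
  ∈-constraintsᶜ⁺ (C ⊓ D)  acc (there i) with List.∈-++⁻ (sub C) i
  ... | inj₁ j = ∈-constraintsᶜ⁺ C (constraintsᶜ D acc) j
  ... | inj₂ j = constraintsᶜ-⊇ C (constraintsᶜ D acc) (∈-constraintsᶜ⁺ D acc j)
  ∈-constraintsᶜ⁺ (∃ᶜ r C) acc (there i) = ∈-constraintsᶜ⁺ C acc i

  ∈-constraintsᶜ⁻ : ∀ (C : Concept N K) acc {α} → α ∈ constraintsᶜ C acc →
                    [ α ] ∈ sub C ⊎ α ∈ acc
  ∈-constraintsᶜ⁻ ⊤ᶜ       acc i = inj₂ i
  ∈-constraintsᶜ⁻ ⊥ᶜ       acc i = inj₂ i
  ∈-constraintsᶜ⁻ (nm A)   acc i = inj₂ i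
  ∈-constraintsᶜ⁻ [ α ]    acc i with does (α ∈? acc) | i
  ... | true  | j         = inj₂ j
  ... | false | here refl = inj₁ (here refl)
  ... | false | there j   = inj₂ j
  ∈-constraintsᶜ⁻ (C ⊓ D)  acc i with ∈-constraintsᶜ⁻ C (constraintsᶜ D acc) i
  ... | inj₁ j = inj₁ (there (List.∈-++⁺ˡ j))
  ... | inj₂ j = Sum.map₁ (there ∘ List.∈-++⁺ʳ (sub C)) (∈-constraintsᶜ⁻ D acc j)
  ∈-constraintsᶜ⁻ (∃ᶜ r C) acc i = Sum.map₁ there (∈-constraintsᶜ⁻ C acc i)

  ∈-constraintsᴼ⁺ : ∀ (O : Ontology N K) {α} → [ α ] ∈ subᴼ O → α ∈ constraintsᴼ O
  ∈-constraintsᴼ⁺ ((C ⊑ D) ∷ O) i with List.∈-++⁻ (sub C ++ sub D) i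
  ... | inj₂ j = constraintsᶜ-⊇ C _ (constraintsᶜ-⊇ D _ (∈-constraintsᴼ⁺ O j))
  ... | inj₁ j with List.∈-++⁻ (sub C) j
  ... | inj₁ k = ∈-constraintsᶜ⁺ C _ k
  ... | inj₂ k = constraintsᶜ-⊇ C _ (∈-constraintsᶜ⁺ D _ k)

  ∈-constraintsᴼ⁻ : ∀ (O : Ontology N K) {α} → α ∈ constraintsᴼ O → [ α ] ∈ subᴼ O
  ∈-constraintsᴼ⁻ ((C ⊑ D) ∷ O) i with ∈-constraintsᶜ⁻ C _ i
  ... | inj₁ j = List.∈-++⁺ˡ (List.∈-++⁺ˡ j)
  ... | inj₂ j with ∈-constraintsᶜ⁻ D _ j
  ... | inj₁ k = List.∈-++⁺ˡ (List.∈-++⁺ʳ (sub C) k)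
  ... | inj₂ k = List.∈-++⁺ʳ (sub C ++ sub D) (∈-constraintsᴼ⁻ O k)

-- Soundness: models of the input satisfy the generated axioms

module Soundness (𝒟 : ConcreteDomain) (adm : PAdmissible 𝒟) (cls : Classifier (Nameᴬ 𝒟))
                 (I : Interpretationᴰ 𝒟) where

  open Run 𝒟 adm cls
  open Loop 𝒟 adm cls
  open Interpretationᴰ I

  abstraction : Interpretation (Nameᴬ 𝒟)
  abstraction = record
    { Dom   = Dom
    ; point = point
    ; name  = λ { (inj₁ A) → name A ; (inj₂ α) → holds α }
    ; role  = role
    }

  Extᴬ : Conceptᴬ → Dom → Set
  Extᴬ = Ext abstraction (λ ())

  ext-abstract : ∀ C {d} → Ext base holds C d → Extᴬ (abstractᶜ C) d
  ext-abstract ⊤ᶜ       _              = tt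
  ext-abstract (nm A)   x              = x
  ext-abstract [ α ]    x              = x
  ext-abstract (C ⊓ D)  (x , y)        = ext-abstract C x , ext-abstract D y
  ext-abstract (∃ᶜ r C) (e , d→e , x)  = e , d→e , ext-abstract C x

  ext-concrete : ∀ C {d} → Extᴬ (abstractᶜ C) d → Ext base holds C d
  ext-concrete ⊤ᶜ       _              = tt
  ext-concrete (nm A)   x              = x
  ext-concrete [ α ]    x              = x
  ext-concrete (C ⊓ D)  (x , y)        = ext-concrete C x , ext-concrete D y
  ext-concrete (∃ᶜ r C) (e , d→e , x)  = e , d→e , ext-concrete C x

  conj-holds : ∀ D {d} → Extᴬ (conj D) d → All (λ α → holds α d) D
  conj-holds []              _        = []
  conj-holds (α ∷ [])        x        = x ∷ []
  conj-holds (α ∷ D@(_ ∷ _)) (x , xs) = x ∷ conj-holds D xs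

  Modelᴬ : Ontologyᴬ → Set
  Modelᴬ = ModelOf abstraction (λ ())

  implied-sound : ∀ D cs → Modelᴬ (implied D cs)
  implied-sound D []       = []
  implied-sound D (β ∷ cs) with valid? D β | valid?-correct D β
  ... | false | _     = implied-sound D cs
  ... | true  | valid = sound ∷ implied-sound D cs
    where
    sound : ∀ d → Extᴬ (conj D) d → holds β d
    -- Validity is applied to the partial assignment given by the values of the variables at `d`.
    sound d x with Equivalence.to valid refl (λ y → value y d) (conj-holds D x)
    ... | here β-holds = β-holds

  falsum-fails : ∀ v → ¬ Satisfies 𝒟 v falsum
  falsum-fails v ([] , _ , p) = ConcreteDomain.⊥ᴾ-empty 𝒟 p

  newAxioms-sound : ∀ cs D → Modelᴬ (newAxioms cs D)
  newAxioms-sound cs D with valid? D falsum | valid?-correct D falsum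
  ... | false | _     = implied-sound D cs
  ... | true  | valid = sound ∷ []
    where
    sound : ∀ d → Extᴬ (conj D) d → ⊥
    sound d x with Equivalence.to valid refl (λ y → value y d) (conj-holds D x)
    ... | here fails = falsum-fails (λ y → value y d) fails

  sweep-sound : ∀ cs S {O} → Modelᴬ O → Modelᴬ (sweep cs S O)
  sweep-sound cs []      m = m
  sweep-sound cs (C ∷ S) m = sweep-sound cs S (All.++⁺ (newAxioms-sound cs _) m)

  reachable-sound : ∀ cs S {O O′} → Reachable cs S O O′ → Modelᴬ O → Modelᴬ O′
  reachable-sound cs S start      m = m
  reachable-sound cs S (onward r) m = sweep-sound cs S (reachable-sound cs S r m)

  abstract-model : ∀ {O} → ModelOf base holds O → Modelᴬ (abstractᴼ O)
  abstract-model []                    = []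
  abstract-model {(C ⊑ D) ∷ O} (m ∷ ms) =
    (λ d → ext-abstract D ∘ m d ∘ ext-concrete C) ∷ abstract-model ms

-- Completeness: the canonical model

module Completeness (em : ExcludedMiddle (suc 0ℓ)) (𝒟 : ConcreteDomain)
                    (adm : PAdmissible 𝒟) (cls : Classifier (Nameᴬ 𝒟)) (O : Ontologyᴰ 𝒟)
                    {L : List (Concept (Nameᴬ 𝒟) ⊥ × Concept (Nameᴬ 𝒟) ⊥)}
                    (stops : Loop.Stops 𝒟 adm cls (constraintsᴼ O) (subᴼ (map abstractᴳ O))
                               (map abstractᴳ O) L) where

  open Run 𝒟 adm cls
  open Progress 𝒟 adm cls
  open Loop 𝒟 adm cls
  open Stops stops

  em₀ : {P : Set} → Dec P
  em₀ {P} = Dec.map′ Level.lower Level.lift (em {Level.Lift (suc 0ℓ) P})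

  private
    S : List Conceptᴬ
    S = subᴼ (abstractᴼ O)

    cs : List K
    cs = constraintsᴼ O

    -- One sweep beyond `final`: it contains the axioms generated from the sets D_C of `final`,
    -- while by `unchanged` its classification, and so its sets D_C, are still those of `final`.
    closure : Ontologyᴬ
    closure = sweep cs S final

    infix 4 _⊨_
    _⊨_ : Conceptᴬ → Conceptᴬ → Set₁
    C ⊨ D = Entails closure (C ⊑ D)

    reachable-⊇ : ∀ {P Q} → Reachable cs S P Q → P ⊆ Q
    reachable-⊇ start      = id
    reachable-⊇ (onward r) = sweep-extends cs S ∘ reachable-⊇ r

    ⊆-closure : abstractᴼ O ⊆ closure
    ⊆-closure = sweep-extends cs S ∘ reachable-⊇ reachable

    S-⊆ : S ⊆ subᴼ closure
    S-⊆ = Subset.concatMap⁺ _ ⊆-closure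

    ⊨-cl : ∀ {C D} → C ∈ S → D ∈ S → C ⊨ D → (C , D) ∈ cl final
    ⊨-cl C∈ D∈ C⊨D = unchanged (∈-cl⁺ (S-⊆ C∈) (S-⊆ D∈) C⊨D)

    A-∈ : ∀ {α} → α ∈ cs → A⟨ α ⟩ ∈ S
    A-∈ α∈ = ∈-subᴼ-abstract {O = O} (∈-constraintsᴼ⁻ O α∈)

    𝐃 : Conceptᴬ → List K
    𝐃 C = select C cs (cl final)

    ∈-𝐃⁺ : ∀ {C α} → C ∈ S → α ∈ cs → C ⊨ A⟨ α ⟩ → α ∈ 𝐃 C
    ∈-𝐃⁺ {C} {α} C∈ α∈ C⊨α = List.∈-filter⁺ _ α∈ (⊨-cl {C} {A⟨ α ⟩} C∈ (A-∈ α∈) C⊨α)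

    ∈-𝐃⁻ : ∀ {C α} → α ∈ 𝐃 C → C ⊨ A⟨ α ⟩
    ∈-𝐃⁻ {C} {α} α∈ = entails-mono {ax = C ⊑ A⟨ α ⟩} (sweep-extends cs S)
      (proj₂ (proj₂ (∈-cl⁻ (proj₂ (List.∈-filter⁻ (λ α → (C , A⟨ α ⟩) ∈? cl final) {xs = cs} α∈)))))

    ⊨-conj : ∀ {C} D → (∀ {α} → α ∈ D → C ⊨ A⟨ α ⟩) → C ⊨ conj D
    ⊨-conj []              C⊨ I m d x = tt
    ⊨-conj (α ∷ [])        C⊨         = C⊨ (here refl)
    ⊨-conj {C} (α ∷ D@(_ ∷ _)) C⊨ I m d x = C⊨ (here refl) I m d x , ⊨-conj {C} D (C⊨ ∘ there) I m d x

    -- Stability is an instance of `unchanged`, for the single sweep that starts at `final`.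
    newAxioms-⊆ : ∀ {C} → C ∈ S → newAxioms cs (𝐃 C) ⊆ closure
    newAxioms-⊆ = sweep-stable-⊇ cs S id id (λ _ _ → unchanged)

    ⊨-axiom : ∀ {C D} → C ∈ S → (conj (𝐃 C) ⊑ D) ∈ newAxioms cs (𝐃 C) → C ⊨ D
    ⊨-axiom {C} C∈ ax∈ I m d x =
      All.lookup m (newAxioms-⊆ C∈ ax∈) d (⊨-conj {C} (𝐃 C) ∈-𝐃⁻ I m d x)

    ∈-implied : ∀ D {β} ds → valid? D β ≡ true → β ∈ ds → (conj D ⊑ A⟨ β ⟩) ∈ implied D ds
    ∈-implied D (β ∷ ds) valid (here refl) rewrite valid = here refl
    ∈-implied D (γ ∷ ds) valid (there β∈) with valid? D γ
    ... | true  = there (∈-implied D ds valid β∈)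
    ... | false = ∈-implied D ds valid β∈

    valid⇒true : ∀ D α → Valid 𝒟 D List⁺.[ α ] → valid? D α ≡ true
    valid⇒true D α = Equivalence.from (valid?-correct D α)

    inconsistent : ∀ {C} → C ∈ S → Valid 𝒟 (𝐃 C) List⁺.[ falsum ] → C ⊨ ⊥ᶜ
    inconsistent {C} C∈ valid = ⊨-axiom C∈ ax∈
      where
      ax∈ : (conj (𝐃 C) ⊑ ⊥ᶜ) ∈ newAxioms cs (𝐃 C)
      ax∈ rewrite valid⇒true (𝐃 C) falsum valid = here refl

    ⊨-implied : ∀ {C β} → C ∈ S → ¬ (C ⊨ ⊥ᶜ) → β ∈ cs → Valid 𝒟 (𝐃 C) List⁺.[ β ] → C ⊨ A⟨ β ⟩
    ⊨-implied {C} {β} C∈ satisfiable β∈ valid = ⊨-axiom C∈ ax∈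
      where
      ax∈ : (conj (𝐃 C) ⊑ A⟨ β ⟩) ∈ newAxioms cs (𝐃 C)
      ax∈ with valid? (𝐃 C) falsum in eq
      -- If 𝐃_C implied falsity, the sweep would have added the axiom with `⊥ᶜ`, and `C` would be
      -- unsatisfiable.
      ... | true  = contradiction
        (inconsistent C∈ (Equivalence.to (valid?-correct (𝐃 C) falsum) eq)) satisfiable
      ... | false = ∈-implied (𝐃 C) cs (valid⇒true (𝐃 C) β valid) β∈

    -- `falsum` keeps the disjunction non-empty, and if convexity selects it, `C` is inconsistent.
    outside : Conceptᴬ → List⁺ K
    outside C = falsum List⁺.∷ filter (λ β → ¬? (β ∈? 𝐃 C)) cs

    -- By convexity, ⋀ 𝐃_C does not imply the disjunction of all
    -- constraints outside 𝐃_C.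
    solution : ∀ {C} → C ∈ S → ¬ (C ⊨ ⊥ᶜ) → ∃ λ (v : Assignment 𝒟) →
      All (Satisfies 𝒟 v) (𝐃 C) × (∀ {β} → β ∈ cs → Satisfies 𝒟 v β → β ∈ 𝐃 C)
    solution {C} C∈ satisfiable 
      with em₀ {∃ λ v → All (Satisfies 𝒟 v) (𝐃 C) × ¬ Any (Satisfies 𝒟 v) (List⁺.toList (outside C))}
    ... | Dec.yes (v , all , none) = v , all , λ {β} β∈ vβ →
      Dec.decidable-stable (β ∈? 𝐃 C) λ β∉ →
        none (there (lose (List.∈-filter⁺ (λ β → ¬? (β ∈? 𝐃 C)) β∈ β∉) vβ))
    ... | Dec.no ∄v = ⊥-elim (refute (PAdmissible.convex adm (𝐃 C) (outside C) valid))
      where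
      valid : Valid 𝒟 (𝐃 C) (outside C)
      valid v all = Dec.decidable-stable em₀ λ none → ∄v (v , all , none)
      refute : ¬ (∃ λ α → α ∈ List⁺.toList (outside C) × Valid 𝒟 (𝐃 C) List⁺.[ α ])
      refute (_ , here refl , valid-α) = satisfiable (inconsistent C∈ valid-α)
      -- A constraint of 𝒞(O) implied by 𝐃_C has its axiom in `closure`, hence lies in 𝐃_C already.
      refute (_ , there α∈ , valid-α)  =
        let α∈cs , α∉ = List.∈-filter⁻ (λ β → ¬? (β ∈? 𝐃 C)) {xs = cs} α∈ in
        α∉ (∈-𝐃⁺ C∈ α∈cs (⊨-implied C∈ satisfiable α∈cs valid-α))

    -- Excluded middle also brings entailment, which quantifies over all
    -- interpretations, down to Set.
    Element : Set
    Element = ∃ λ C → C ∈ S × False (em {C ⊨ ⊥ᶜ})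

    element : ∀ {C} → C ∈ S → ¬ (C ⊨ ⊥ᶜ) → Element
    element C∈ satisfiable = _ , C∈ , fromWitnessFalse satisfiable

    assignment : Element → Assignment 𝒟
    assignment (_ , C∈ , satisfiable) = proj₁ (solution C∈ (toWitnessFalse satisfiable))

    -- Interpretations have a point, and `Element` is inhabited only if some subconcept is
    -- satisfiable, hence the argument `d`.
    canonical : Element → Interpretationᴰ 𝒟
    canonical d = record
      { base = record
        { Dom   = Element
        ; point = d
        ; name  = λ A (C , _) → True (em {C ⊨ nm (inj₁ A)})
        ; role  = λ r (C , _) (D , _) → True (em {C ⊨ ∃ᶜ r D})
        }
      ; value = λ x d → assignment d x
      }

    module _ (d₀ : Element) where

      open Interpretationᴰ (canonical d₀)

      -- The elements in the extension of a concept are those whose own concept entails it. The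
      -- restriction to subconcepts of `O` matters for constraints, which must lie in 𝒞(O), and for
      -- existentials, whose filler must itself be an element.
      truth : ∀ D → sub D ⊆ subᴼ O → ∀ {d} → Ext base holds D d → proj₁ d ⊨ abstractᶜ D
      truth⁻ : ∀ D → sub D ⊆ subᴼ O → ∀ {d} → proj₁ d ⊨ abstractᶜ D → Ext base holds D d

      truth ⊤ᶜ       D⊆ _ I m e _ = tt
      truth (nm A)   D⊆ x         = toWitness x
      truth [ α ]    D⊆ {_ , C∈ , satisfiable} x =
        -- The chosen assignment satisfies no constraint of 𝒞(O) outside 𝐃_C.
        ∈-𝐃⁻ (proj₂ (proj₂ (solution C∈ (toWitnessFalse satisfiable)))
          (∈-constraintsᴼ⁺ O (D⊆ (here refl))) x)
      truth (D ⊓ E)  D⊆ {d} (x , y) I m e z =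
        truth D (D⊆ ∘ there ∘ List.∈-++⁺ˡ) {d} x I m e z ,
        truth E (D⊆ ∘ there ∘ List.∈-++⁺ʳ (sub D)) {d} y I m e z
      truth (∃ᶜ r D) D⊆ (d′ , d→d′ , x) I m e z =
        let e′ , e→e′ , y = toWitness d→d′ I m e z in
        e′ , e→e′ , truth D (D⊆ ∘ there) {d′} x I m e′ y

      truth⁻ ⊤ᶜ       D⊆ _ = tt
      truth⁻ ⊥ᶜ       D⊆ {_ , _ , satisfiable} C⊨⊥ = toWitnessFalse satisfiable C⊨⊥
      truth⁻ (nm A)   D⊆ C⊨A = fromWitness C⊨A
      truth⁻ [ α ]    D⊆ {_ , C∈ , satisfiable} C⊨α =
        All.lookup (proj₁ (proj₂ (solution C∈ (toWitnessFalse satisfiable))))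
          (∈-𝐃⁺ C∈ (∈-constraintsᴼ⁺ O (D⊆ (here refl))) C⊨α)
      truth⁻ (D ⊓ E)  D⊆ {d} C⊨ =
        truth⁻ D (D⊆ ∘ there ∘ List.∈-++⁺ˡ) {d} (λ I m e z → proj₁ (C⊨ I m e z)) ,
        truth⁻ E (D⊆ ∘ there ∘ List.∈-++⁺ʳ (sub D)) {d} (λ I m e z → proj₂ (C⊨ I m e z))
      truth⁻ (∃ᶜ r D) D⊆ {C , _ , satisfiable} C⊨ =
        -- The successor is the abstraction of the filler `D` itself. It is satisfiable, for
        -- otherwise the existential, and with it `C`, would be unsatisfiable.
        d′ , fromWitness C⊨ , truth⁻ D (D⊆ ∘ there) {d′} (λ I m e z → z)
        where
        d′ : Element
        d′ = element (∈-subᴼ-abstract {O = O} (D⊆ (there (sub-refl D)))) λ D⊨⊥ →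
          toWitnessFalse satisfiable λ I m e z →
            let e′ , _ , y = C⊨ I m e z in D⊨⊥ I m e′ y

      canonical-model : ModelOf base holds O
      canonical-model = All.tabulate model
        where
        model : ∀ {ax} → ax ∈ O → ModelOfGCI base holds ax
        model {C ⊑ D} ax∈ d x = truth⁻ D (rhs-⊆ O ax∈) {d} λ I m e z →
          All.lookup m (⊆-closure (List.∈-map⁺ abstractᴳ ax∈)) e
            (truth C (lhs-⊆ O ax∈) {d} x I m e z)

  complete : ∀ {C D} → C ∈ subᴼ O → D ∈ subᴼ O → Entailsᴰ 𝒟 O (C ⊑ D) →
             (abstractᶜ C , abstractᶜ D) ∈ L
  complete {C} {D} C∈ D∈ O⊨ rewrite result =
    ⊨-cl (∈-subᴼ-abstract {O = O} C∈) (∈-subᴼ-abstract {O = O} D∈) C⊨D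
    where
    C⊨D : abstractᶜ C ⊨ abstractᶜ D
    C⊨D with em {abstractᶜ C ⊨ ⊥ᶜ}
    ... | Dec.yes C⊨⊥ = λ I m e z → ⊥-elim (C⊨⊥ I m e z)
    ... | Dec.no satisfiable =
      -- A satisfiable `C` is an element in its own extension. `O⊨` puts it into the extension of
      -- `D`, and `truth` turns this into entailment.
      truth d D (subᴼ-trans O D∈) {d}
        (O⊨ (canonical d) (canonical-model d) d
          (truth⁻ d C (subᴼ-trans O C∈) {d} (λ I m e z → z)))
      where
      d : Element
      d = element (∈-subᴼ-abstract {O = O} C∈) satisfiable

-- Polynomial growth

-- The base `suc n` is positive, so a bound may be raised to a higher degree, which closes the class
-- under sums.
record PolyBounded (f : ℕ → ℕ) : Set where
  constructor bounded-by
  field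
    coefficient degree : ℕ
    bounded            : ∀ n → f n ≤ coefficient * ℕ.suc n ^ degree

const-bounded : ∀ k → PolyBounded (λ _ → k)
const-bounded k = bounded-by k 0 λ n → ℕ.≤-reflexive (sym (ℕ.*-identityʳ k))

id-bounded : PolyBounded id
id-bounded = bounded-by 1 1 λ n → ℕ.≤-trans (ℕ.n≤1+n n)
  (ℕ.≤-reflexive (sym (trans (ℕ.*-identityˡ _) (ℕ.*-identityʳ (ℕ.suc n)))))

infixl 6 _+ᵇ_
infixl 7 _*ᵇ_

_+ᵇ_ : ∀ {f g} → PolyBounded f → PolyBounded g → PolyBounded (λ n → f n + g n)
bounded-by c d f≤ +ᵇ bounded-by c′ d′ g≤ = bounded-by (c + c′) (d + d′) λ n → ℕ.≤-trans
  (ℕ.+-mono-≤ (ℕ.≤-trans (f≤ n) (ℕ.*-monoʳ-≤ c (ℕ.^-monoʳ-≤ (ℕ.suc n) (ℕ.m≤m+n d d′))))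
              (ℕ.≤-trans (g≤ n) (ℕ.*-monoʳ-≤ c′ (ℕ.^-monoʳ-≤ (ℕ.suc n) (ℕ.m≤n+m d′ d)))))
  (ℕ.≤-reflexive (sym (ℕ.*-distribʳ-+ (ℕ.suc n ^ (d + d′)) c c′)))

_*ᵇ_ : ∀ {f g} → PolyBounded f → PolyBounded g → PolyBounded (λ n → f n * g n)
bounded-by c d f≤ *ᵇ bounded-by c′ d′ g≤ = bounded-by (c * c′) (d + d′) λ n → ℕ.≤-trans
  (ℕ.*-mono-≤ (f≤ n) (g≤ n))
  (ℕ.≤-reflexive (trans (ℕ.[m*n]*[o*p]≡[m*o]*[n*p] c (ℕ.suc n ^ d) c′ (ℕ.suc n ^ d′))
    (cong (c * c′ *_) (sym (ℕ.^-distribˡ-+-* (ℕ.suc n) d d′)))))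

^-bounded : ∀ {f} d → PolyBounded f → PolyBounded (λ n → f n ^ d)
^-bounded ℕ.zero    f≤ = const-bounded 1
^-bounded (ℕ.suc d) f≤ = f≤ *ᵇ ^-bounded d f≤

polyTime-bounded : ∀ {f} c d → PolyBounded f → PolyBounded (λ n → polyTime c d (f n))
polyTime-bounded c d f≤ = const-bounded c *ᵇ ^-bounded d f≤ +ᵇ const-bounded c

⟦⟧-bounded : ∀ p {σ : ℕ → Values} → (∀ i → PolyBounded (λ n → nth (σ n) i)) →
             PolyBounded (λ n → ⟦ p ⟧ (σ n))
⟦⟧-bounded (con c) σ≤ = const-bounded c
⟦⟧-bounded (ind i) σ≤ = σ≤ i
⟦⟧-bounded (p ⊕ q) σ≤ = ⟦⟧-bounded p σ≤ +ᵇ ⟦⟧-bounded q σ≤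
⟦⟧-bounded (p ⊗ q) σ≤ = ⟦⟧-bounded p σ≤ *ᵇ ⟦⟧-bounded q σ≤

⟦⟧₁-bounded : ∀ p → PolyBounded (λ n → ⟦ p ⟧ (n ∷ []))
⟦⟧₁-bounded p = ⟦⟧-bounded p {_∷ []} λ where
  ℕ.zero    → id-bounded
  (ℕ.suc i) → const-bounded 0

^-distrib-* : ∀ m n d → (m * n) ^ d ≡ m ^ d * n ^ d
^-distrib-* m n ℕ.zero    = refl
^-distrib-* m n (ℕ.suc d) = trans (cong (m * n *_) (^-distrib-* m n d))
  (ℕ.[m*n]*[o*p]≡[m*o]*[n*p] m n (m ^ d) (n ^ d))

-- For positive n, `suc n` is at most 2n. At 0 the power `n ^ d` may vanish, and the summand 1 takes
-- over.
suc-^-bound : ∀ n d → ℕ.suc n ^ d ≤ 2 ^ d * n ^ d + 1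
suc-^-bound ℕ.zero      d = ℕ.≤-trans (ℕ.≤-reflexive (ℕ.^-zeroˡ d)) (ℕ.m≤n+m 1 _)
suc-^-bound n@(ℕ.suc _) d = ℕ.≤-trans
  (ℕ.^-monoˡ-≤ d (ℕ.+-mono-≤ {1} {n} {n} {n + 0} (s≤s z≤n) (ℕ.m≤m+n n 0)))
  (ℕ.≤-trans (ℕ.≤-reflexive (^-distrib-* 2 n d)) (ℕ.m≤m+n _ 1))

toPolyTime : ∀ {f} → PolyBounded f → ∃₂ λ c d → ∀ n → f n ≤ polyTime c d n
toPolyTime (bounded-by c d f≤) = c * 2 ^ d , d , λ n → ℕ.≤-trans
  (ℕ.≤-trans (f≤ n) (ℕ.*-monoʳ-≤ c (suc-^-bound n d)))
  (ℕ.≤-trans (ℕ.≤-reflexive (ℕ.*-distribˡ-+ c (2 ^ d * n ^ d) 1))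
    (ℕ.+-mono-≤ (ℕ.≤-reflexive (sym (ℕ.*-assoc c (2 ^ d) (n ^ d))))
                (ℕ.*-monoʳ-≤ c (ℕ.m^n>0 2 d))))

-- `c` and `d` are fixed before the program, its arguments and `n`, so the same constants serve
-- every input.
TimeBounded : Poly → (ℕ → Values) → ℕ → ℕ → Set
TimeBounded p σ c d = ∀ {k} {f : Fun k} {xs v} n → f · xs ↓ v ⟨ p ∣ σ n ⟩ →
                      ∃ λ t → f · xs ⇓ v ⟨ t ⟩ × t ≤ polyTime c d n

time-bounded : ∀ p (σ : ℕ → Values) → (∀ i → PolyBounded (λ n → nth (σ n) i)) →
               ∃₂ (TimeBounded p σ)
time-bounded p σ σ≤ with toPolyTime (⟦⟧-bounded p {σ} σ≤)
... | c , d , p≤ = c , d , λ { n (halts {t} run t≤) → t , run , ℕ.≤-trans t≤ (p≤ n) }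

-- Polynomial time and correctness of the algorithm

module Main (em : ExcludedMiddle (suc 0ℓ)) (𝒟 : ConcreteDomain)
            (adm : PAdmissible 𝒟) (cls : Classifier (Nameᴬ 𝒟)) where

  open Run 𝒟 adm cls
  open Progress 𝒟 adm cls
  open Loop 𝒟 adm cls

  validTime-bounded : ∀ {f} → PolyBounded f → PolyBounded (λ n → validTime (f n))
  validTime-bounded =
    polyTime-bounded (proj₁ (PAdmissible.validity adm)) (proj₁ (proj₂ (PAdmissible.validity adm)))

  clTime-bounded : ∀ {f} → PolyBounded f → PolyBounded (λ n → clTime (f n))
  clTime-bounded =
    polyTime-bounded (proj₁ (Classifier.correct cls)) (proj₁ (proj₂ (Classifier.correct cls)))

  clSize-bounded : ∀ {f} → PolyBounded f → PolyBounded (λ n → clSize (f n))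
  clSize-bounded f≤ = const-bounded 1 +ᵇ (f≤ +ᵇ clTime-bounded f≤) *ᵇ
    (const-bounded 1 +ᵇ (const-bounded 1 +ᵇ f≤ +ᵇ f≤))

  growth-bounded : ∀ {f} → PolyBounded f → PolyBounded (λ n → growth (f n))
  growth-bounded f≤ = (const-bounded 1 +ᵇ f≤) *ᵇ (const-bounded 20 +ᵇ const-bounded 21 *ᵇ f≤)

  implicationSize-bounded : ∀ {f} → PolyBounded f → PolyBounded (λ n → implicationSize (f n))
  implicationSize-bounded f≤ = const-bounded 3 +ᵇ (f≤ +ᵇ (f≤ +ᵇ const-bounded ∥ falsum ∥))

  constraintsSize-bounded : PolyBounded constraintsSize
  constraintsSize-bounded = ⟦⟧₁-bounded constraintCount

  ontologySize-bounded : PolyBounded ontologySize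
  ontologySize-bounded =
    (const-bounded 1 +ᵇ ⟦⟧₁-bounded sweepCount) *ᵇ
    (⟦⟧₁-bounded conceptCount *ᵇ growth-bounded constraintsSize-bounded) +ᵇ
    const-bounded 2 *ᵇ id-bounded

  values-bounded : ∀ i → PolyBounded (λ n → nth (values n) i)
  values-bounded 0 = id-bounded
  values-bounded 1 = validTime-bounded (implicationSize-bounded constraintsSize-bounded)
  values-bounded 2 = const-bounded ∥ falsum ∥
  values-bounded 3 = clTime-bounded ontologySize-bounded
  values-bounded 4 = clSize-bounded ontologySize-bounded
  values-bounded (ℕ.suc (ℕ.suc (ℕ.suc (ℕ.suc (ℕ.suc i))))) = const-bounded 0

  classification : ∀ O {L} →
    cl (abstractᴼ O) ⊆ [] ⊎ Stops (constraintsᴼ O) (subᴼ (abstractᴼ O)) (abstractᴼ O) L →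
    ComputesClassification {𝒟} O (concretiseᴾ L)
  classification O (inj₁ empty) C D C∈ D∈ =
    -- A subconcept `C` puts ⟨C, C⟩ into the classification, which therefore cannot be empty.
    ⊥-elim (absurd (empty (∈-cl⁺ C∈′ C∈′ (λ I m d x → x))))
    where
    C∈′ : abstractᶜ C ∈ subᴼ (abstractᴼ O)
    C∈′ = ∈-subᴼ-abstract {O = O} C∈
    absurd : ¬ ((abstractᶜ C , abstractᶜ C) ∈ [])
    absurd ()
  classification O {L} (inj₂ stops) C D C∈ D∈ = mk⇔ sound (∈-concretise⁺ ∘ complete C∈ D∈)
    where
    open Completeness em 𝒟 adm cls O stops
    open Stops stops
    sound : (C , D) ∈ concretiseᴾ L → Entailsᴰ 𝒟 O (C ⊑ D)
    -- A model of `O`, with each A_α read as the extension of [α], is a model of `final`, where the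
    -- pair is entailed.
    sound i I m d x = ext-concrete D (entailed abstraction
      (reachable-sound _ _ reachable (abstract-model m)) d (ext-abstract C x))
      where
      open Soundness 𝒟 adm cls I
      entailed : Entails final (abstractᶜ C ⊑ abstractᶜ D)
      entailed = proj₂ (proj₂ (∈-cl⁻ (subst (_ ∈_) result (∈-concretise⁻ i))))

  solves : ∃₂ (TimeBounded mainBound values) →
           algorithm1 𝒟 adm cls SolvesInPolyTime ComputesClassification {𝒟}
  solves (c , d , within) = c , d , solve
    where
    solve : ∀ O → ∃₂ λ L t → algorithm1 𝒟 adm cls · encode O ∷ [] ⇓ encode L ⟨ t ⟩ ×
              t ≤ polyTime c d ∥ O ∥ × ComputesClassification {𝒟} O L
    solve O =
      let L , run , stops = main-run O
          t , run′ , t≤   = within ∥ O ∥ run in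
      concretiseᴾ L , t , run′ , t≤ , classification O stops

theorem1 : ExcludedMiddle (suc 0ℓ) →
    (𝒟 : ConcreteDomain) (adm : PAdmissible 𝒟) (cls : Classifier (Nameᴬ 𝒟)) →
    algorithm1 𝒟 adm cls SolvesInPolyTime ComputesClassification {𝒟}
theorem1 em 𝒟 adm cls = solves (time-bounded mainBound values values-bounded)
  where
  open Loop 𝒟 adm cls
  open Main em 𝒟 adm cls
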